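{- Let $c=2\left(\frac{\sqrt{2}-1}{2\sqrt{2}}\right)^{\frac{5}{2}}$. For every $\varepsilon>0$ and all sufficiently large $n$ (depending on $\varepsilon$), $$\frac{1}{2}\binom{n}{2}+(1-\varepsilon)\,c\,n^{\frac{3}{2}}\le \mathrm{lbal}(n,K_5)\le \frac{1}{2}\binom{n}{2}+(1+\varepsilon)\frac{1}{4\sqrt{2}}\,n^{\frac{3}{2}}.$$
   Context: A 2-list coloring of the edges of $K_n$ is a function $L:E(K_n)\to\{\{r\},\{b\},\{r,b\}\}$; it induces color classes $R=\{e: r\in L(e)\}$ and $B=\{e: b\in L(e)\}$ (which may intersect). Given a 2-list coloring with color classes $R,B$, a balanced copy of a graph $G=G(V,E)$ is a (not necessarily induced) copy of $G$ in $K_n$ whose edge set has a partition $E_1\sqcup E_2$ with $E_1\subseteq R$, $E_2\subseteq B$ and $\bigl||E_1|-|E_2|\bigr|\le 1$. For $n\ge |V|$, the list balancing number $\mathrm{lbal}(n,G)$ is the smallest integer $k$ such that every 2-list coloring of the edges of $K_n$ with color classes satisfying $|R|,|B|>k$ contains a balanced copy of $G$. -}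

module Defs where

open import Data.Bool.Base using (Bool; true; false; T)
open import Data.Empty using (⊥-elim-irr)
open import Data.Fin.Base using (Fin) renaming (_<_ to _<ᶠ_)
open import Data.Fin.Properties using () renaming (_<?_ to _<ᶠ?_; <-cmp to <ᶠ-cmp; <⇒≢ to <ᶠ⇒≢)
open import Data.Integer.Base as ℤ using (ℤ; +_)
import Data.Integer.Properties as ℤₚ
open import Data.List.Base using (List; length; filterᵇ; mapMaybe; allFin; cartesianProduct)
open import Data.Maybe.Base using (Maybe) renaming (map to mapᴹ)
open import Data.Nat.Base as ℕ using (ℕ; zero; suc)
open import Data.Nat.Coprimality using (1-coprimeTo)
import Data.Nat.Properties as ℕₚ
open import Data.Product.Base using (Σ; ∃; _×_; _,_; proj₁; proj₂)
open import Data.Rational.Base as ℚ using (ℚ; mkℚ; mkℚ+; 0ℚ; 1ℚ; ½; *≤*)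
import Data.Rational.Properties as ℚₚ
open import Data.Rational.Solver using (module +-*-Solver)
import Data.Rational.Unnormalised.Base as ℚᵘ
import Data.Rational.Unnormalised.Properties as ℚᵘₚ
open import Data.Sum.Base using (_⊎_; inj₁; inj₂)
open import Function.Bundles using (_⇔_)
open import Function.Definitions using (Injective)
open import Relation.Binary.Definitions using (tri<; tri≈; tri>)
open import Relation.Binary.PropositionalEquality
open import Relation.Nullary.Decidable.Core using (yes; no; dec⇒maybe)
open import Relation.Nullary.Negation.Core using (¬_; contradiction)

module Rational where

  open import Data.Rational.Base
  open import Data.Rational.Properties
  open +-*-Solver

  private
    variable
      a b c d p q : ℚ

  ½+½ : ∀ p → ½ * p + ½ * p ≡ p
  ½+½ = solve 1 (λ p → con ½ :* p :+ con ½ :* p := p) refl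

  half-pos : 0ℚ < p → 0ℚ < ½ * p
  half-pos {p} 0<p = subst (_< ½ * p) (*-zeroʳ ½) (*-monoʳ-<-pos ½ 0<p)

  *-pos : 0ℚ < p → 0ℚ < q → 0ℚ < p * q
  *-pos {p} {q} 0<p 0<q =
    subst (_< p * q) (*-zeroʳ p) (*-monoʳ-<-pos p {{positive 0<p}} 0<q)

  *-mono : 0ℚ ≤ a → 0ℚ ≤ d → a ≤ b → c ≤ d → a * c ≤ b * d
  *-mono {a} {d} {b} {c} 0≤a 0≤d a≤b c≤d = ≤-trans
    (*-monoˡ-≤-nonNeg a {{nonNegative 0≤a}} c≤d)
    (*-monoʳ-≤-nonNeg d {{nonNegative 0≤d}} a≤b)

  sq-mono : 0ℚ ≤ a → a ≤ b → a * a ≤ b * b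
  sq-mono 0≤a a≤b = *-mono 0≤a (≤-trans 0≤a a≤b) a≤b a≤b

  p≤p+q : 0ℚ ≤ q → p ≤ p + q
  p≤p+q {q} {p} 0≤q = subst (_≤ p + q) (+-identityʳ p) (+-monoʳ-≤ p 0≤q)

  p<p+q : 0ℚ < q → p < p + q
  p<p+q {q} {p} 0<q = subst (_< p + q) (+-identityʳ p) (+-monoʳ-< p 0<q)

  p≤∣p∣ : ∀ p → p ≤ ∣ p ∣
  p≤∣p∣ p with ≤-total 0ℚ p
  ... | inj₁ 0≤p = ≤-reflexive (sym (0≤p⇒∣p∣≡p 0≤p))
  ... | inj₂ p≤0 = ≤-trans p≤0 (0≤∣p∣ p)

  -p≤∣p∣ : ∀ p → - p ≤ ∣ p ∣
  -p≤∣p∣ p = subst (- p ≤_) (∣-p∣≡∣p∣ p) (p≤∣p∣ (- p))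

  ∣-∣-lub : p ≤ d → - p ≤ d → ∣ p ∣ ≤ d
  ∣-∣-lub {p} p≤d -p≤d with ∣p∣≡p∨∣p∣≡-p p
  ... | inj₁ eq = subst (_≤ _) (sym eq) p≤d
  ... | inj₂ eq = subst (_≤ _) (sym eq) -p≤d

  dist-≤ : a ≤ b + d → b ≤ a + d → ∣ a - b ∣ ≤ d
  dist-≤ {a} {b} {d} a≤b+d b≤a+d = ∣-∣-lub
    (subst (a - b ≤_) (cancel b d) (+-monoˡ-≤ (- b) a≤b+d))
    (subst₂ _≤_ (swap a b) (cancel a d) (+-monoˡ-≤ (- a) b≤a+d))
    where
    cancel : ∀ b d → (b + d) - b ≡ d
    cancel = solve 2 (λ b d → (b :+ d) :- b := d) refl
    swap : ∀ a b → b - a ≡ - (a - b)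
    swap = solve 2 (λ a b → b :- a := :- (a :- b)) refl

  ≤-dist : ∀ a b → ∣ a - b ∣ ≤ d → a ≤ b + d
  ≤-dist {d} a b le = subst (_≤ b + d) (split a b)
    (+-monoʳ-≤ b (≤-trans (p≤∣p∣ (a - b)) le))
    where
    split : ∀ a b → b + (a - b) ≡ a
    split = solve 2 (λ a b → b :+ (a :- b) := a) refl

  dist-sym : ∀ a b → ∣ a - b ∣ ≡ ∣ b - a ∣
  dist-sym a b = trans (sym (∣-p∣≡∣p∣ (a - b)))
    (cong ∣_∣ (solve 2 (λ a b → :- (a :- b) := b :- a) refl a b))

  scale : 0ℚ < b → 0ℚ < d → ∃ λ η → 0ℚ < η × b * η ≡ d
  scale {b} {d} 0<b 0<d = 1/b * d , *-pos 0<1/b 0<d , eq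
    where
    instance
      b-pos : Positive b
      b-pos = positive 0<b
      b-nz : NonZero b
      b-nz = pos⇒nonZero b
    1/b : ℚ
    1/b = 1/ b
    0<1/b : 0ℚ < 1/b
    0<1/b = positive⁻¹ 1/b {{1/pos⇒pos b}}
    eq : b * (1/b * d) ≡ d
    eq = trans (sym (*-assoc b 1/b d))
      (trans (cong (_* d) (*-inverseʳ b)) (*-identityˡ d))

  -- Taking 1/p to be 0 for p ≤ 0 makes the reciprocal total.
  recip : ℚ → ℚ
  recip p with 0ℚ <? p
  ... | yes 0<p = 1/_ p {{>-nonZero 0<p}}
  ... | no  _   = 0ℚ

  *-recip : 0ℚ < p → p * recip p ≡ 1ℚ
  *-recip {p} 0<p with 0ℚ <? p
  ... | yes 0<p′ = *-inverseʳ p {{>-nonZero 0<p′}}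
  ... | no  0≮p  = contradiction 0<p 0≮p

  recip-pos : 0ℚ < p → 0ℚ < recip p
  recip-pos {p} 0<p with 0ℚ <? p
  ... | yes 0<p′ = positive⁻¹ (1/_ p {{>-nonZero 0<p′}})
                     {{1/pos⇒pos p {{positive 0<p′}}}}
  ... | no  0≮p  = contradiction 0<p 0≮p

  halves : ℕ → ℚ
  halves zero    = 1ℚ
  halves (suc k) = ½ * halves k

  halves-pos : ∀ k → 0ℚ < halves k
  halves-pos zero    = positive⁻¹ 1ℚ
  halves-pos (suc k) = half-pos (halves-pos k)

  unit : ℕ → ℚ
  unit k = mkℚ+ 1 (suc k) (1-coprimeTo (suc k))

  ½*unit : ∀ k → ½ * unit k ≤ unit (suc k)
  ½*unit k = toℚᵘ-cancel-≤ (ℚᵘₚ.≤-respˡ-≃ (ℚᵘₚ.≃-sym (toℚᵘ-homo-* ½ (unit k)))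
    (ℚᵘ.*≤* (ℤ.+≤+ (subst₂ ℕ._≤_ (sym (ℕₚ.+-identityʳ _)) (sym (ℕₚ.+-identityʳ _)) le))))
    where
    le : suc (suc k) ℕ.≤ 2 ℕ.* suc k
    le = subst (suc (suc k) ℕ.≤_) (cong suc (sym (ℕₚ.+-suc k (k ℕ.+ 0))))
      (ℕ.s≤s (ℕ.s≤s (ℕₚ.m≤m+n k (k ℕ.+ 0))))

  halves≤unit : ∀ k → halves k ≤ unit k
  halves≤unit zero    = ≤-refl
  halves≤unit (suc k) = ≤-trans (*-monoˡ-≤-nonNeg ½ (halves≤unit k)) (½*unit k)

  unit-antitone : ∀ {j k} → j ℕ.≤ k → unit k ≤ unit j
  unit-antitone j≤k = *≤* (ℤₚ.*-monoˡ-≤-nonNeg (+ 1) (ℤ.+≤+ (ℕ.s≤s j≤k)))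

  unit-archimedean : 0ℚ < p → ∃ λ k → unit k ≤ p
  unit-archimedean {mkℚ (+ zero) _ _} (*<* (ℤ.+<+ ()))
  unit-archimedean {mkℚ (+ suc a) d _} _ =
    d , *≤* (ℤₚ.*-monoʳ-≤-nonNeg (+ suc d) (ℤ.+≤+ (ℕ.s≤s (ℕ.z≤n {a}))))
  unit-archimedean {mkℚ ℤ.-[1+ a ] d _} (*<* ())

  halves-small : 0ℚ < p → ∃ λ N → ∀ m → N ℕ.≤ m → halves m ≤ p
  halves-small 0<p with unit-archimedean 0<p
  ... | N , le = N , λ m N≤m → ≤-trans (halves≤unit m) (≤-trans (unit-antitone N≤m) le)

  -- Bisection for √q, q ≥ 0, starting from the interval [0, q + 1]; sqrt k q
  -- is the left end after k steps.

  step : ℚ → ℚ × ℚ → ℚ × ℚ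
  step q (l , h) with ½ * (l + h) * (½ * (l + h)) ≤? q
  ... | yes _ = ½ * (l + h) , h
  ... | no  _ = l , ½ * (l + h)

  bisect : ℕ → ℚ → ℚ × ℚ
  bisect zero    q = 0ℚ , q + 1ℚ
  bisect (suc k) q = step q (bisect k q)

  sqrt : ℕ → ℚ → ℚ
  sqrt k q = proj₁ (bisect k q)

  record Brackets (q w : ℚ) (lh : ℚ × ℚ) : Set where
    constructor brackets
    l : ℚ
    l = proj₁ lh
    h : ℚ
    h = proj₂ lh
    field
      0≤l   : 0ℚ ≤ l
      l²≤q  : l * l ≤ q
      q<h²  : q < h * h
      width : h ≡ l + w

  step-brackets : ∀ {q w} lh → 0ℚ ≤ w → Brackets q w lh → Brackets q (½ * w) (step q lh)
  step-brackets {q} {w} (l , h) 0≤w (brackets 0≤l l²≤q q<h² width)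
    with ½ * (l + h) * (½ * (l + h)) ≤? q
  ... | yes mid²≤q = brackets
          (≤-trans 0≤l (subst (l ≤_) (sym mid) (p≤p+q 0≤½w)))
          mid²≤q q<h²
          (trans width (trans (solve 2 (λ l w → l :+ w := (l :+ con ½ :* w) :+ con ½ :* w) refl l w)
            (cong (_+ ½ * w) (sym mid))))
    where
    0≤½w : 0ℚ ≤ ½ * w
    0≤½w = subst (_≤ ½ * w) (*-zeroʳ ½) (*-monoˡ-≤-nonNeg ½ 0≤w)
    mid : ½ * (l + h) ≡ l + ½ * w
    mid = trans (cong (λ h → ½ * (l + h)) width)
      (solve 2 (λ l w → con ½ :* (l :+ (l :+ w)) := l :+ con ½ :* w) refl l w)
  ... | no  mid²≰q = brackets 0≤l l²≤q (≰⇒> mid²≰q) (trans (cong (λ h → ½ * (l + h)) width)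
      (solve 2 (λ l w → con ½ :* (l :+ (l :+ w)) := l :+ con ½ :* w) refl l w))

  bisect-brackets : ∀ k {q} → 0ℚ ≤ q → Brackets q (halves k * (q + 1ℚ)) (bisect k q)
  bisect-brackets zero {q} 0≤q = brackets ≤-refl 0≤q
    (<-≤-trans (p<p+q (positive⁻¹ 1ℚ))
      (≤-trans (p≤p+q (≤-trans 0≤q (p≤p+q {p = q} 0≤q²)))
        (≤-reflexive (solve 1 (λ q → (q :+ con 1ℚ) :+ (q :+ q :* q)
          := (q :+ con 1ℚ) :* (q :+ con 1ℚ)) refl q))))
    (solve 1 (λ q → q :+ con 1ℚ := con 0ℚ :+ con 1ℚ :* (q :+ con 1ℚ)) refl q)
    where
    0≤q² : 0ℚ ≤ q * q
    0≤q² = sq-mono {0ℚ} ≤-refl 0≤q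
  bisect-brackets (suc k) {q} 0≤q = subst (λ w → Brackets q w (bisect (suc k) q))
    (sym (*-assoc ½ (halves k) (q + 1ℚ)))
    (step-brackets (bisect k q) 0≤w (bisect-brackets k 0≤q))
    where
    0≤w : 0ℚ ≤ halves k * (q + 1ℚ)
    0≤w = <⇒≤ (*-pos (halves-pos k) (≤-<-trans 0≤q (p<p+q (positive⁻¹ 1ℚ))))

  sqrt-nonNeg : ∀ k → 0ℚ ≤ q → 0ℚ ≤ sqrt k q
  sqrt-nonNeg k 0≤q = Brackets.0≤l (bisect-brackets k 0≤q)

  sqrt-lower : ∀ k → 0ℚ ≤ q → sqrt k q * sqrt k q ≤ q
  sqrt-lower k 0≤q = Brackets.l²≤q (bisect-brackets k 0≤q)

  sqrt-upper : ∀ k → 0ℚ ≤ q → halves k * (q + 1ℚ) ≤ d →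
               q < (sqrt k q + d) * (sqrt k q + d)
  sqrt-upper {q} {d} k 0≤q w≤d = <-≤-trans q<h² (sq-mono 0≤h h≤)
    where
    open Brackets (bisect-brackets k 0≤q)
    0≤w : 0ℚ ≤ halves k * (q + 1ℚ)
    0≤w = <⇒≤ (*-pos (halves-pos k) (≤-<-trans 0≤q (p<p+q (positive⁻¹ 1ℚ))))
    0≤h : 0ℚ ≤ h
    0≤h = subst (0ℚ ≤_) (sym width) (≤-trans 0≤l (p≤p+q 0≤w))
    h≤ : h ≤ l + d
    h≤ = subst (_≤ l + d) (sym width) (+-monoʳ-≤ l w≤d)

  root-close : ∀ {q q′} → 0ℚ < d → 0ℚ ≤ b → a * a ≤ q′ → q′ ≤ q + ½ * (d * d) →
               q < (b + ½ * d) * (b + ½ * d) → a ≤ b + d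
  root-close {d} {b} {a} {q} {q′} 0<d 0≤b a²≤q′ q′≤ q< with a ≤? b + d
  ... | yes a≤b+d = a≤b+d
  ... | no  a≰b+d = contradiction
          (≤-<-trans (≤-trans (≤-trans (sq-mono 0≤b+d (<⇒≤ (≰⇒> a≰b+d))) a²≤q′) q′≤)
            (+-monoˡ-< (½ * (d * d)) q<))
          (≤⇒≯ (≤-trans (p≤p+q 0≤rest) (≤-reflexive expand)))
    where
    ≤⇒≯ : ∀ {x y} → x ≤ y → ¬ (y < x)
    ≤⇒≯ x≤y y<x = <-irrefl refl (≤-<-trans x≤y y<x)
    0≤b+d : 0ℚ ≤ b + d
    0≤b+d = ≤-trans 0≤b (p≤p+q (<⇒≤ 0<d))
    0≤rest : 0ℚ ≤ b * d + (½ * ½) * (d * d)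
    0≤rest = ≤-trans (*-mono ≤-refl (<⇒≤ 0<d) 0≤b (<⇒≤ 0<d))
      (p≤p+q (<⇒≤ (*-pos (positive⁻¹ (½ * ½)) (*-pos 0<d 0<d))))
    expand : ((b + ½ * d) * (b + ½ * d) + ½ * (d * d)) + (b * d + (½ * ½) * (d * d))
             ≡ (b + d) * (b + d)
    expand = solve 2 (λ b d →
      ((b :+ con ½ :* d) :* (b :+ con ½ :* d) :+ con ½ :* (d :* d))
        :+ (b :* d :+ con (½ * ½) :* (d :* d))
      := (b :+ d) :* (b :+ d)) refl b d

-- Real numbers are Cauchy sequences of rationals; x and y denote the same real
-- when Real._≤_ holds in both directions.

record IsCauchy (x : ℕ → ℚ) : Set where
  constructor isCauchy
  field
    modulus : ∀ δ → 0ℚ ℚ.< δ →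
      ∃ λ N → ∀ m n → N ℕ.≤ m → N ℕ.≤ n → ℚ.∣ x m ℚ.- x n ∣ ℚ.≤ δ

record ℝ : Set where
  no-eta-equality
  field
    seq    : ℕ → ℚ
    cauchy : IsCauchy seq

module RealConstructions where

  open import Data.Rational.Base
  open import Data.Rational.Properties
  open +-*-Solver
  open Rational
  open ℝ
  open IsCauchy

  private
    variable
      x y : ℕ → ℚ

  abstract

    one-sided : ∀ x → (∀ δ → 0ℚ < δ → ∃ λ N → ∀ m n → N ℕ.≤ m → N ℕ.≤ n → x m ≤ x n + δ) →
                IsCauchy x
    one-sided x cx .modulus δ 0<δ with cx δ 0<δ
    ... | N , close = N , λ m n N≤m N≤n → dist-≤ (close m n N≤m N≤n) (close n m N≤n N≤m)

    bounded : IsCauchy x → ∃ λ B → 0ℚ < B × ∃ λ N → ∀ m → N ℕ.≤ m → ∣ x m ∣ ≤ B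
    bounded {x} cx with modulus cx 1ℚ (positive⁻¹ 1ℚ)
    ... | N , close = ∣ x N ∣ + 1ℚ , ≤-<-trans (0≤∣p∣ (x N)) (p<p+q (positive⁻¹ 1ℚ)) , N ,
      λ m N≤m → subst (_≤ ∣ x N ∣ + 1ℚ) (cong ∣_∣ (split (x N) (x m)))
        (≤-trans (∣p+q∣≤∣p∣+∣q∣ (x N) (x m - x N))
          (+-monoʳ-≤ ∣ x N ∣ (close m N N≤m ℕₚ.≤-refl)))
      where
      split : ∀ a b → a + (b - a) ≡ b
      split = solve 2 (λ a b → a :+ (b :- a) := b) refl

    const-cauchy : ∀ q → IsCauchy (λ _ → q)
    const-cauchy q = one-sided (λ _ → q) λ δ 0<δ → 0 , λ _ _ _ _ → p≤p+q (<⇒≤ 0<δ)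

    +-cauchy : IsCauchy x → IsCauchy y → IsCauchy (λ m → x m + y m)
    +-cauchy {x} {y} cx cy = one-sided (λ m → x m + y m) λ δ 0<δ →
      let N₁ , close₁ = modulus cx (½ * δ) (half-pos 0<δ)
          N₂ , close₂ = modulus cy (½ * δ) (half-pos 0<δ)
      in N₁ ℕ.⊔ N₂ , λ m n N≤m N≤n → subst (x m + y m ≤_) (regroup (x n) (y n) δ)
           (+-mono-≤
             (≤-dist (x m) (x n) (close₁ m n (ℕₚ.m⊔n≤o⇒m≤o N₁ N₂ N≤m) (ℕₚ.m⊔n≤o⇒m≤o N₁ N₂ N≤n)))
             (≤-dist (y m) (y n) (close₂ m n (ℕₚ.m⊔n≤o⇒n≤o N₁ N₂ N≤m) (ℕₚ.m⊔n≤o⇒n≤o N₁ N₂ N≤n))))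
      where
      regroup : ∀ a b d → (a + ½ * d) + (b + ½ * d) ≡ (a + b) + d
      regroup = solve 3 (λ a b d →
        (a :+ con ½ :* d) :+ (b :+ con ½ :* d) := (a :+ b) :+ d) refl

    neg-cauchy : IsCauchy x → IsCauchy (λ m → - x m)
    neg-cauchy {x} cx .modulus δ 0<δ with modulus cx δ 0<δ
    ... | N , close = N , λ m n N≤m N≤n →
      subst (_≤ δ) (trans (dist-sym (x m) (x n)) (cong ∣_∣ (flip (x m) (x n)))) (close m n N≤m N≤n)
      where
      flip : ∀ a b → b - a ≡ (- a) - (- b)
      flip = solve 2 (λ a b → b :- a := (:- a) :- (:- b)) refl

    *-cauchy : IsCauchy x → IsCauchy y → IsCauchy (λ m → x m * y m)
    *-cauchy {x} {y} cx cy .modulus δ 0<δ =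
      let A , 0<A , M₁ , x≤A = bounded cx
          B , 0<B , M₂ , y≤B = bounded cy
          α , 0<α , Bα≡ = scale 0<B (half-pos 0<δ)
          β , 0<β , Aβ≡ = scale 0<A (half-pos 0<δ)
          N₁ , close₁ = modulus cx α 0<α
          N₂ , close₂ = modulus cy β 0<β
          M = M₁ ℕ.⊔ M₂
          N = N₁ ℕ.⊔ N₂
      in M ℕ.⊔ N , λ m n ≤m ≤n →
        let M≤m = ℕₚ.m⊔n≤o⇒m≤o M N ≤m
            M≤n = ℕₚ.m⊔n≤o⇒m≤o M N ≤n
            N≤m = ℕₚ.m⊔n≤o⇒n≤o M N ≤m
            N≤n = ℕₚ.m⊔n≤o⇒n≤o M N ≤n
            first : ∣ x m * (y m - y n) ∣ ≤ ½ * δ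
            first = subst₂ _≤_ (sym (∣p*q∣≡∣p∣*∣q∣ (x m) (y m - y n))) Aβ≡
              (*-mono (0≤∣p∣ (x m)) (<⇒≤ 0<β) (x≤A m (ℕₚ.m⊔n≤o⇒m≤o M₁ M₂ M≤m))
                (close₂ m n (ℕₚ.m⊔n≤o⇒n≤o N₁ N₂ N≤m) (ℕₚ.m⊔n≤o⇒n≤o N₁ N₂ N≤n)))
            second : ∣ y n * (x m - x n) ∣ ≤ ½ * δ
            second = subst₂ _≤_ (sym (∣p*q∣≡∣p∣*∣q∣ (y n) (x m - x n))) Bα≡
              (*-mono (0≤∣p∣ (y n)) (<⇒≤ 0<α) (y≤B n (ℕₚ.m⊔n≤o⇒n≤o M₁ M₂ M≤n))
                (close₁ m n (ℕₚ.m⊔n≤o⇒m≤o N₁ N₂ N≤m) (ℕₚ.m⊔n≤o⇒m≤o N₁ N₂ N≤n)))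
        in subst₂ _≤_ (cong ∣_∣ (expand (x m) (x n) (y m) (y n))) (½+½ δ)
             (≤-trans (∣p+q∣≤∣p∣+∣q∣ (x m * (y m - y n)) (y n * (x m - x n)))
               (+-mono-≤ first second))
      where
      expand : ∀ a a′ b b′ → a * (b - b′) + b′ * (a - a′) ≡ a * b - a′ * b′
      expand = solve 4 (λ a a′ b b′ →
        a :* (b :- b′) :+ b′ :* (a :- a′) := a :* b :- a′ :* b′) refl

    recip-cauchy : ∀ {d K} → 0ℚ < d → (∀ m → K ℕ.≤ m → d ≤ x m) →
                   IsCauchy x → IsCauchy (λ m → recip (x m))
    recip-cauchy {x} {d} {K} 0<d d≤x cx = one-sided (λ m → recip (x m)) λ δ 0<δ →
      let N , close = modulus cx (d * d * δ) (*-pos (*-pos 0<d 0<d) 0<δ)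
      in K ℕ.⊔ N , λ m n ≤m ≤n →
        let K≤m = ℕₚ.m⊔n≤o⇒m≤o K N ≤m
            K≤n = ℕₚ.m⊔n≤o⇒m≤o K N ≤n
        in recip-close 0<d 0<δ (d≤x m K≤m) (d≤x n K≤n)
             (≤-dist (x n) (x m) (close n m (ℕₚ.m⊔n≤o⇒n≤o K N ≤n) (ℕₚ.m⊔n≤o⇒n≤o K N ≤m)))
      where
      recip-close : ∀ {a b δ} → 0ℚ < d → 0ℚ < δ → d ≤ a → d ≤ b → b ≤ a + d * d * δ →
                    recip a ≤ recip b + δ
      recip-close {a} {b} {δ} 0<d 0<δ d≤a d≤b b≤ =
        *-cancelˡ-≤-pos (a * b) {{positive (*-pos 0<a 0<b)}}
          (subst₂ _≤_ (sym lhs) (sym rhs)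
            (≤-trans b≤ (+-monoʳ-≤ a (*-monoʳ-≤-nonNeg δ {{nonNegative (<⇒≤ 0<δ)}}
              (*-mono (<⇒≤ 0<d) (<⇒≤ 0<b) d≤a d≤b)))))
        where
        0<a : 0ℚ < a
        0<a = <-≤-trans 0<d d≤a
        0<b : 0ℚ < b
        0<b = <-≤-trans 0<d d≤b
        lhs : a * b * recip a ≡ b
        lhs = trans (solve 3 (λ a b r → a :* b :* r := a :* r :* b) refl a b (recip a))
          (trans (cong (_* b) (*-recip 0<a)) (*-identityˡ b))
        rhs : a * b * (recip b + δ) ≡ a + a * b * δ
        rhs = trans (solve 4 (λ a b r d → a :* b :* (r :+ d) := a :* (b :* r) :+ a :* b :* d)
                      refl a b (recip b) δ)
          (cong (_+ a * b * δ) (trans (cong (a *_) (*-recip 0<b)) (*-identityʳ a)))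

    sqrt-width : ∀ {B η} q k → 0ℚ < B → ∣ q ∣ ≤ B → halves k ≤ η →
                 halves k * ((q ⊔ 0ℚ) + 1ℚ) ≤ (B + 1ℚ) * η
    sqrt-width {B} {η} q k 0<B q≤B le =
      subst (halves k * ((q ⊔ 0ℚ) + 1ℚ) ≤_) (*-comm η (B + 1ℚ))
        (*-mono (<⇒≤ (halves-pos k)) (≤-trans (<⇒≤ 0<B) (p≤p+q (<⇒≤ (positive⁻¹ 1ℚ)))) le
          (+-monoˡ-≤ 1ℚ (⊔-lub (≤-trans (p≤∣p∣ q) q≤B) (<⇒≤ 0<B))))

    sqrt-cauchy : IsCauchy x → IsCauchy (λ m → sqrt m (x m ⊔ 0ℚ))
    sqrt-cauchy {x} cx = one-sided (λ m → sqrt m (x m ⊔ 0ℚ)) λ δ 0<δ →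
      let B , 0<B , M , x≤B = bounded cx
          0<B+1 = <-≤-trans 0<B (p≤p+q (<⇒≤ (positive⁻¹ 1ℚ)))
          η , 0<η , Bη≡ = scale 0<B+1 (half-pos 0<δ)
          K , small = halves-small 0<η
          N , close = modulus cx (½ * (δ * δ)) (half-pos (*-pos 0<δ 0<δ))
          MK = M ℕ.⊔ K
      in MK ℕ.⊔ N , λ m n ≤m ≤n →
        let N≤m = ℕₚ.m⊔n≤o⇒n≤o MK N ≤m
            N≤n = ℕₚ.m⊔n≤o⇒n≤o MK N ≤n
            MK≤n = ℕₚ.m⊔n≤o⇒m≤o MK N ≤n
            0≤⊔ : ∀ q → 0ℚ ≤ q ⊔ 0ℚ
            0≤⊔ q = p≤q⊔p q 0ℚ
        in root-close 0<δ (sqrt-nonNeg n (0≤⊔ (x n))) (sqrt-lower m (0≤⊔ (x m)))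
             (⊔-lub
               (≤-trans (≤-dist (x m) (x n) (close m n N≤m N≤n)) (+-monoˡ-≤ (½ * (δ * δ)) {x n} (p≤p⊔q (x n) 0ℚ)))
               (≤-trans (0≤⊔ (x n)) (p≤p+q (<⇒≤ (half-pos (*-pos 0<δ 0<δ))))))
             (sqrt-upper n (0≤⊔ (x n))
               (subst (halves n * ((x n ⊔ 0ℚ) + 1ℚ) ≤_) Bη≡
                 (sqrt-width (x n) n 0<B (x≤B n (ℕₚ.m⊔n≤o⇒m≤o M K MK≤n))
                   (small n (ℕₚ.m⊔n≤o⇒n≤o M K MK≤n)))))

    *-eventually-pos : ∀ {d e J K} → 0ℚ < d → 0ℚ < e →
      (∀ m → J ℕ.≤ m → d ≤ x m) → (∀ m → K ℕ.≤ m → e ≤ y m) →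
      ∀ m → J ℕ.⊔ K ℕ.≤ m → d * e ≤ x m * y m
    *-eventually-pos {y = y} {e = e} {J = J} {K} 0<d 0<e d≤x e≤y m JK≤m =
      *-mono (<⇒≤ 0<d) (≤-trans (<⇒≤ 0<e) e≤ym) (d≤x m (ℕₚ.m⊔n≤o⇒m≤o J K JK≤m)) e≤ym
      where
      e≤ym : e ≤ y m
      e≤ym = e≤y m (ℕₚ.m⊔n≤o⇒n≤o J K JK≤m)

    sqrt-eventually-pos : ∀ {d K} → 0ℚ < d → IsCauchy x → (∀ m → K ℕ.≤ m → d ≤ x m) →
      ∃ λ e → 0ℚ < e × ∃ λ N → ∀ m → N ℕ.≤ m → e ≤ sqrt m (x m ⊔ 0ℚ)
    sqrt-eventually-pos {x} {d} {K} 0<d cx d≤x =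
      let B , 0<B , M , x≤B = bounded cx
          0<B+1 = <-≤-trans 0<B (p≤p+q (<⇒≤ (positive⁻¹ 1ℚ)))
          η , 0<η , Bη≡ = scale 0<B+1 (half-pos 0<c)
          J , small = halves-small 0<η
          MJ = M ℕ.⊔ J
      in ½ * c , half-pos 0<c , MJ ℕ.⊔ K , λ m ≤m →
        let MJ≤m = ℕₚ.m⊔n≤o⇒m≤o MJ K ≤m
            0≤⊔ = p≤q⊔p (x m) 0ℚ
        in ≮⇒≥ λ s<½c → <-irrefl refl (≤-<-trans
             (≤-trans c²≤d (≤-trans (d≤x m (ℕₚ.m⊔n≤o⇒n≤o MJ K ≤m)) (p≤p⊔q (x m) 0ℚ)))
             (<-≤-trans (sqrt-upper m 0≤⊔
                 (subst (halves m * ((x m ⊔ 0ℚ) + 1ℚ) ≤_) Bη≡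
                   (sqrt-width (x m) m 0<B (x≤B m (ℕₚ.m⊔n≤o⇒m≤o M J MJ≤m))
                     (small m (ℕₚ.m⊔n≤o⇒n≤o M J MJ≤m)))))
               (sq-mono (≤-trans (sqrt-nonNeg m 0≤⊔) (p≤p+q (<⇒≤ (half-pos 0<c))))
                 (subst (sqrt m (x m ⊔ 0ℚ) + ½ * c ≤_) (½+½ c)
                   (+-monoˡ-≤ (½ * c) (<⇒≤ s<½c))))))
      where
      c : ℚ
      c = d ⊓ 1ℚ
      0<c : 0ℚ < c
      0<c with ≤-total d 1ℚ
      ... | inj₁ d≤1 = subst (0ℚ <_) (sym (p≤q⇒p⊓q≡p d≤1)) 0<d
      ... | inj₂ 1≤d = subst (0ℚ <_) (sym (p≥q⇒p⊓q≡q 1≤d)) (positive⁻¹ 1ℚ)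
      c²≤d : c * c ≤ d
      c²≤d = subst (c * c ≤_) (*-identityʳ d)
        (*-mono (<⇒≤ 0<c) (<⇒≤ (positive⁻¹ 1ℚ)) (p⊓q≤p d 1ℚ) (p⊓q≤q d 1ℚ))

module Real where

  open ℝ public
  open RealConstructions

  infix  4 _≤_ _<_
  infixl 6 _+_ _-_
  infixl 7 _*_ _/_
  infixr 8 _^_ _^[_/2]
  infix  9 √_

  _≤_ : ℝ → ℝ → Set
  x ≤ y = ∀ δ → 0ℚ ℚ.< δ → ∃ λ N → ∀ m → N ℕ.≤ m → seq x m ℚ.≤ seq y m ℚ.+ δ

  record _<_ (x y : ℝ) : Set where
    constructor separated
    field
      gap   : ℚ
      0<gap : 0ℚ ℚ.< gap
      from  : ℕ
      apart : ∀ m → from ℕ.≤ m → seq x m ℚ.+ gap ℚ.≤ seq y m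

  fromℚ : ℚ → ℝ
  fromℚ q .seq _  = q
  fromℚ q .cauchy = const-cauchy q

  fromℤ : ℤ → ℝ
  fromℤ z = fromℚ (z ℚ./ 1)

  fromℕ : ℕ → ℝ
  fromℕ n = fromℤ (+ n)

  _+_ _-_ _*_ : ℝ → ℝ → ℝ
  (x + y) .seq m  = seq x m ℚ.+ seq y m
  (x + y) .cauchy = +-cauchy (cauchy x) (cauchy y)
  (x - y) .seq m  = seq x m ℚ.- seq y m
  (x - y) .cauchy = +-cauchy (cauchy x) (neg-cauchy (cauchy y))
  (x * y) .seq m  = seq x m ℚ.* seq y m
  (x * y) .cauchy = *-cauchy (cauchy x) (cauchy y)

  eventually-pos : ∀ {y} (0<y : fromℕ 0 < y) →
                   ∀ m → _<_.from 0<y ℕ.≤ m → _<_.gap 0<y ℚ.≤ seq y m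
  eventually-pos 0<y m le = subst (ℚ._≤ _) (ℚₚ.+-identityˡ _) (_<_.apart 0<y m le)

  from-eventually-pos : ∀ {y d N} → 0ℚ ℚ.< d → (∀ m → N ℕ.≤ m → d ℚ.≤ seq y m) → fromℕ 0 < y
  from-eventually-pos {y} {d} {N} 0<d d≤y =
    separated d 0<d N λ m le → subst (ℚ._≤ seq y m) (sym (ℚₚ.+-identityˡ d)) (d≤y m le)

  _/_ : (x y : ℝ) → {{fromℕ 0 < y}} → ℝ
  (x / y) .seq m = seq x m ℚ.* Rational.recip (seq y m)
  _/_ x y {{0<y}} .cauchy = *-cauchy (cauchy x)
    (recip-cauchy (_<_.0<gap 0<y) (eventually-pos 0<y) (cauchy y))

  _^_ : ℝ → ℕ → ℝ
  x ^ zero  = fromℕ 1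
  x ^ suc k = x * x ^ k

  -- √ x is the square root of max(x, 0).
  √_ : ℝ → ℝ
  (√ x) .seq m  = Rational.sqrt m (seq x m ℚ.⊔ 0ℚ)
  (√ x) .cauchy = sqrt-cauchy (cauchy x)

  _^[_/2] : ℝ → ℕ → ℝ
  x ^[ k /2] = (√ x) ^ k

  fromℕ-suc-pos : ∀ k → fromℕ 0 < fromℕ (suc k)
  fromℕ-suc-pos k = from-eventually-pos {N = 0}
    (ℚₚ.positive⁻¹ (+ suc k ℚ./ 1) {{ℚₚ.normalize-pos (suc k) 1}}) λ _ _ → ℚₚ.≤-refl

  instance
    0<2 : fromℕ 0 < fromℕ 2
    0<2 = fromℕ-suc-pos 1

    0<4 : fromℕ 0 < fromℕ 4
    0<4 = fromℕ-suc-pos 3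

    *-pos : ∀ {x y} → {{fromℕ 0 < x}} → {{fromℕ 0 < y}} → fromℕ 0 < x * y
    *-pos {{0<x}} {{0<y}} = from-eventually-pos
      (Rational.*-pos (_<_.0<gap 0<x) (_<_.0<gap 0<y))
      (*-eventually-pos (_<_.0<gap 0<x) (_<_.0<gap 0<y)
        (eventually-pos 0<x) (eventually-pos 0<y))

    √-pos : ∀ {x} → {{fromℕ 0 < x}} → fromℕ 0 < √ x
    √-pos {x} {{0<x}} =
      let e , 0<e , N , e≤ = sqrt-eventually-pos (_<_.0<gap 0<x) (cauchy x) (eventually-pos 0<x)
      in from-eventually-pos 0<e e≤

  √2 : ℝ
  √2 = √ fromℕ 2

  c : ℝ
  c = fromℕ 2 * ((√2 - fromℕ 1) / (fromℕ 2 * √2)) ^[ 5 /2]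

record Edge (n : ℕ) : Set where
  constructor edge
  field
    lo hi  : Fin n
    .lo<hi : lo <ᶠ hi

open Edge public

join : ∀ {n} (i j : Fin n) → .(i ≢ j) → Edge n
join i j i≢j with <ᶠ-cmp i j
... | tri< i<j _ _ = edge i j i<j
... | tri≈ _ i≡j _ = ⊥-elim-irr (i≢j i≡j)
... | tri> _ _ j<i = edge j i j<i

allEdges : ∀ n → List (Edge n)
allEdges n = mapMaybe toEdge (cartesianProduct (allFin n) (allFin n))
  where
  toEdge : Fin n × Fin n → Maybe (Edge n)
  toEdge (i , j) = mapᴹ (λ i<j → edge i j i<j) (dec⇒maybe (i <ᶠ? j))

EdgeSet : ℕ → Set
EdgeSet n = Edge n → Bool

infix 4 _∈_ _⊆_

_∈_ : ∀ {n} → Edge n → EdgeSet n → Set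
e ∈ S = T (S e)

_⊆_ : ∀ {n} → EdgeSet n → EdgeSet n → Set
S ⊆ S′ = ∀ e → e ∈ S → e ∈ S′

∣_∣ : ∀ {n} → EdgeSet n → ℕ
∣_∣ {n} S = length (filterᵇ S (allEdges n))

record Graph : Set where
  field
    order : ℕ
    edges : EdgeSet order

open Graph public

complete : ℕ → Graph
complete m = record { order = m ; edges = λ _ → true }

K₅ : Graph
K₅ = complete 5

data ColorList : Set where
  ⟨r⟩ ⟨b⟩ ⟨rb⟩ : ColorList

ListColoring : ℕ → Set
ListColoring n = Edge n → ColorList

red blue : ∀ {n} → ListColoring n → EdgeSet n
red L e with L e
... | ⟨r⟩  = true
... | ⟨b⟩  = false
... | ⟨rb⟩ = true
blue L e with L e
... | ⟨r⟩  = false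
... | ⟨b⟩  = true
... | ⟨rb⟩ = true

image : ∀ {m n} (f : Fin m → Fin n) → Injective _≡_ _≡_ f → Edge m → Edge n
image f f-inj (edge i j i<j) = join (f i) (f j) (λ eq → <ᶠ⇒≢ i<j (f-inj eq))

record Copy (G : Graph) (n : ℕ) : Set where
  field
    embed     : Fin (order G) → Fin n
    injective : Injective _≡_ _≡_ embed

  _∈ᶜ : Edge n → Set
  e ∈ᶜ = Σ (Edge (order G)) λ e′ → e′ ∈ edges G × image embed injective e′ ≡ e

record BalancedCopy {n} (L : ListColoring n) (G : Graph) : Set where
  field
    copy : Copy G n
  open Copy copy
  field
    E₁ E₂    : EdgeSet n
    covers   : ∀ e → (e ∈ᶜ) ⇔ (e ∈ E₁ ⊎ e ∈ E₂)
    disjoint : ∀ e → ¬ (e ∈ E₁ × e ∈ E₂)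
    E₁⊆R     : E₁ ⊆ red L
    E₂⊆B     : E₂ ⊆ blue L
    balanced : ℕ.∣ ∣ E₁ ∣ - ∣ E₂ ∣ ∣ ℕ.≤ 1

Forces : ℕ → Graph → ℤ → Set
Forces n G k = (L : ListColoring n) →
  k ℤ.< + ∣ red L ∣ → k ℤ.< + ∣ blue L ∣ → BalancedCopy L G

-- IsLbal n G k says that lbal(n, G) is defined and equals k.
record IsLbal (n : ℕ) (G : Graph) (k : ℤ) : Set where
  field
    large  : order G ℕ.≤ n
    forces : Forces n G k
    least  : ∀ j → Forces n G j → k ℤ.≤ j

{-# OPTIONS --safe #-}
module Submission where

-- Upper bound. Five vertices spanning at least five bicolored edges carry a
-- balanced K₅, since then neither color is forced on more than five of the ten
-- edges. If there are no such five vertices, then for every bicolored edge uv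
-- almost all vertices within distance 2 are reached only once, so the sum of
-- the degrees of the neighbours of u and of v is at most n + O(d(u) + d(v)).
-- Summed over the bicolored edges this bounds Σ d(u) d(v) from above; AM-GM
-- bounds it from below in terms of the number of edges, which is therefore at
-- most (1 + o(1)) (n/2)^(3/2).
--
-- Lower bound. Color a clique on about n/√2 vertices red and all other edges
-- blue: a copy of K₅ has 0, 1, 3, 6 or 10 red edges, never 5. It stays
-- unbalanced when the edges of a C₄-free bipartite graph outside the clique
-- become bicolored. The points and lines (x, y), (α, b), x, α < s ≤ p, with
-- y = αx + b modulo a prime p give such a graph with s²p edges on 2sp vertices.
-- With β = (√2 − 1)/(2√2) a plane of order √(βn) would give β^(3/2) n^(3/2)
-- edges, while the constant c only asks for 4β^(5/2) n^(3/2); as 4β < 0.59, it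
-- is enough to find p in an interval around √(βn) whose ends have ratio 2.04,
-- which a Chebyshev estimate of the least common multiple of 1, …, N provides.

-- Below √(βn) a prime p is used with s = p and gives p³ edges. Above it, s is about βn/p, because
-- the clique leaves only 2βn vertices for the 2sp points and lines; this gives β²n²/p edges. Both
-- amounts reach 4β^(5/2) n^(3/2) exactly for p between (4β)^(1/3) and 1/(4β) times √(βn), which is
-- the origin of the ratio (4β)^(-4/3) ≈ 2.04. The bounds lcm(1, ..., N) ≥ 2^(N - 2) and
-- primorial(x) ≤ 4^x yield primes in intervals of any fixed ratio above 2, so they are just sharp
-- enough. Two obstacles come from working constructively. That lbal(n, K₅) exists is part of the
-- theorem: forcing quantifies over all colorings, so these are coded by a finite set, forcing
-- becomes decidable and the least forcing k is found by search. And reals are Cauchy sequences, so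
-- both estimates are proved in ℕ with explicit constants and then compared with the rational
-- approximations index by index.

-- Primes between 200v and 402v

module PrimeGaps where

  open import Data.Nat.Base
  open import Data.Nat.Properties
  open import Data.Nat.Divisibility
  open import Data.Nat.Primality
  open import Data.Nat.Tactic.RingSolver
  open import Data.Nat.Combinatorics using (k![n∸k]!∣n!)
  open import Data.Nat.Primality.Factorisation using (factorise; module PrimeFactorisation)
  open import Data.List.Base using ([]; _∷_)
  open import Data.List.Relation.Unary.All using (_∷_)
  open import Data.Nat.ListAction using (product)
  open import Data.Nat.Coprimality using (coprime-divisor)
  open import Data.Nat.Induction using (<-rec)
  open import Data.Nat.DivMod using (_/_; _%_; m≡m%n+[m/n]*n; m%n<n; /-monoˡ-≤)
  open import Data.Product.Base using (∃; _×_; _,_)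
  open import Data.Sum.Base using (inj₁; inj₂; [_,_]′)
  open import Relation.Binary.PropositionalEquality
  open import Relation.Nullary

  private variable
    m n k p : ℕ

  suc-prime-divides : .{{NonZero m}} → (∀ {q} → Prime q → q ∣ m → q ≤ suc k) →
    ¬ (suc k ∣ m × Prime (suc k)) → ∀ {q} → Prime q → q ∣ m → q ≤ k
  suc-prime-divides h ¬p {q} pq q∣m with m≤n⇒m<n∨m≡n (h pq q∣m)
  ... | inj₁ (s≤s q≤k) = q≤k
  ... | inj₂ refl = contradiction (q∣m , pq) ¬p

  record Stripped (p m : ℕ) : Set where
    constructor stripped
    field
      e cofactor : ℕ
      factored   : p ^ e * cofactor ≡ m
      coprime    : ¬ p ∣ cofactor

  strip : Prime p → ∀ m → .{{NonZero m}} → Stripped p m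
  strip {p} pp = <-rec (λ m → .{{NonZero m}} → Stripped p m) go
    where
    instance
      _ = prime⇒nonZero pp
      _ = prime⇒nonTrivial pp
    go : ∀ m → (∀ {k} → k < m → .{{NonZero k}} → Stripped p k) → .{{NonZero m}} → Stripped p m
    go m rec with p ∣? m
    ... | no p∤m = stripped 0 m (+-identityʳ m) p∤m
    ... | yes (divides q refl) =
      let instance
            q≢0 : NonZero q
            q≢0 = m*n≢0⇒m≢0 q
          stripped e c eq p∤c = rec (m<m*n q p (nonTrivial⇒n>1 p))
      in stripped (suc e) c (trans (*-assoc p (p ^ e) c) (trans (cong (p *_) eq) (*-comm p q))) p∤c

  pow-mono : ∀ p → .{{NonZero p}} → ∀ {a b} → a ≤ b → p ^ a ∣ p ^ b
  pow-mono p {a} {b} a≤b = divides (p ^ (b ∸ a)) (trans (cong (p ^_) (sym (m∸n+n≡m a≤b))) (^-distribˡ-+-* p (b ∸ a) a))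

  -- The largest power of p not exceeding N, searched below exponent j.
  maxExp : ℕ → ℕ → ℕ → ℕ
  maxExp N p zero = 0
  maxExp N p (suc j) with p ^ suc j ≤? N
  ... | yes _ = suc j
  ... | no  _ = maxExp N p j

  maxExp-≤ : ∀ {N} → 1 ≤ N → ∀ p j → p ^ maxExp N p j ≤ N
  maxExp-≤ 1≤N p zero = 1≤N
  maxExp-≤ {N} 1≤N p (suc j) with p ^ suc j ≤? N
  ... | yes le = le
  ... | no  _  = maxExp-≤ 1≤N p j

  maxExp-max : ∀ {N e} p j → p ^ e ≤ N → e ≤ j → e ≤ maxExp N p j
  maxExp-max p zero le e≤j = e≤j
  maxExp-max {N} p (suc j) le e≤j with p ^ suc j ≤? N
  ... | yes _ = e≤j
  ... | no ≰N with m≤n⇒m<n∨m≡n e≤j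
  ...   | inj₁ (s≤s e≤j′) = maxExp-max p j le e≤j′
  ...   | inj₂ refl = contradiction le ≰N

  n<p^n : 2 ≤ p → ∀ n → n < p ^ n
  n<p^n 2≤p zero = s≤s z≤n
  n<p^n {p} 2≤p (suc n) = begin-strict
    suc n        ≤⟨ n<p^n 2≤p n ⟩
    p ^ n        <⟨ m<m+n (p ^ n) (≤-trans (s≤s z≤n) (n<p^n 2≤p n)) ⟩
    p ^ n + p ^ n ≡⟨ solve-∀′ (p ^ n) ⟩
    2 * p ^ n    ≤⟨ *-monoˡ-≤ (p ^ n) 2≤p ⟩
    p * p ^ n    ∎
    where
    open ≤-Reasoning
    solve-∀′ : ∀ x → x + x ≡ 2 * x
    solve-∀′ = solve-∀

  -- For a prime p, the p-part of lcm(1, ..., N). Searching exponents up to N is enough because N <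
  -- p ^ N.
  maxPow : ℕ → ℕ → ℕ
  maxPow N p = p ^ maxExp N p N

  ^∣maxPow : ∀ {N e} p → 2 ≤ p → p ^ e ≤ N → p ^ e ∣ maxPow N p
  ^∣maxPow {N} {e} p@(suc _) 2≤p le =
    pow-mono p (maxExp-max p N le (<⇒≤ (<-≤-trans (n<p^n 2≤p e) le)))

  maxPow-single : ∀ {N} p → 2 ≤ p → N < p * p → maxPow N p ≤ p
  maxPow-single {zero} p 2≤p lt = ≤-trans (s≤s z≤n) 2≤p
  maxPow-single {N@(suc _)} p@(suc _) 2≤p lt with maxExp N p N in eq
  ... | 0 = ≤-trans (s≤s z≤n) 2≤p
  ... | 1 = ≤-reflexive (*-identityʳ p)
  ... | suc (suc e) = contradiction lt (≤⇒≯ (begin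
    p * p             ≡⟨ cong (p *_) (*-identityʳ p) ⟨
    p * (p * 1)       ≤⟨ *-monoʳ-≤ p (*-monoʳ-≤ p (m^n>0 p e)) ⟩
    p * (p * p ^ e)   ≡⟨ cong (p ^_) eq ⟨
    maxPow N p        ≤⟨ maxExp-≤ (s≤s z≤n) p N ⟩
    N                 ∎))
    where open ≤-Reasoning

  -- With h = `maxPow N` and k = N this is lcm(1, ..., N); with h the identity it is the primorial
  -- of k.
  primeProd : (ℕ → ℕ) → ℕ → ℕ
  primeProd h zero = 1
  primeProd h (suc k) with prime? (suc k)
  ... | yes _ = h (suc k) * primeProd h k
  ... | no  _ = primeProd h k

  prime>1 : Prime p → 2 ≤ p
  prime>1 {p} pp = nonTrivial⇒n>1 p {{prime⇒nonTrivial pp}}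

  primeDivisor : ∀ m → 2 ≤ m → ∃ λ q → Prime q × q ∣ m
  primeDivisor m@(suc _) 2≤m with factorise m
  ... | record { factors = [] ; isFactorisation = refl } = contradiction 2≤m λ { (s≤s ()) }
  ... | record { factors = q ∷ qs ; isFactorisation = eq ; factorsPrime = pq ∷ _ } =
    q , pq , divides (product qs) (trans eq (*-comm q _))

  -- Induction on k: if suc k is prime, its full power is stripped from m and divides the factor
  -- `maxPow N (suc k)`; the cofactor has only prime divisors up to k.
  ∣primeProd-maxPow : ∀ {N} k m → .{{NonZero m}} → m ≤ N → (∀ {q} → Prime q → q ∣ m → q ≤ k) →
    m ∣ primeProd (maxPow N) k
  ∣primeProd-maxPow zero 1 _ _ = 1∣ 1
  ∣primeProd-maxPow zero m@(suc (suc _)) _ h with primeDivisor m (s≤s (s≤s z≤n))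
  ... | q , pq , q∣m = contradiction (subst (2 ≤_) (n≤0⇒n≡0 (h pq q∣m)) (prime>1 pq)) λ ()
  ∣primeProd-maxPow {N} (suc k) m m≤N h with prime? (suc k)
  ... | no ¬p = ∣primeProd-maxPow k m m≤N (suc-prime-divides h (λ (_ , pp) → ¬p pp))
  ... | yes pp with strip pp m
  ...   | stripped e c refl p∤c = *-pres-∣ (^∣maxPow {N} {e} (suc k) (prime>1 pp) (≤-trans (m≤m*n (suc k ^ e) c) m≤N))
            (∣primeProd-maxPow k c (≤-trans (m≤n*m c (suc k ^ e)) m≤N)
              (suc-prime-divides (λ pq q∣c → h pq (∣n⇒∣m*n (suc k ^ e) q∣c)) (λ (d , _) → p∤c d)))
    where instance
      c≢0 : NonZero c
      c≢0 = m*n≢0⇒n≢0 (suc k ^ e)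
      pow≢0 : NonZero (suc k ^ e)
      pow≢0 = m^n≢0 (suc k) e

  primeProd-nonZero : ∀ k → NonZero (primeProd (λ p → p) k)
  primeProd-nonZero zero = _
  primeProd-nonZero (suc k) with prime? (suc k)
  ... | yes _ = m*n≢0 (suc k) _ {{_}} {{primeProd-nonZero k}}
  ... | no  _ = primeProd-nonZero k

  primeProd-maxPow≤ : ∀ {N} → 1 ≤ N → ∀ k → primeProd (maxPow N) k ≤ primeProd (λ p → p) k * N ^ k
  primeProd-maxPow≤ 1≤N zero = ≤-refl
  primeProd-maxPow≤ {N} 1≤N (suc k) with prime? (suc k)
  ... | yes pp = begin
    maxPow N (suc k) * primeProd (maxPow N) k  ≤⟨ *-mono-≤ (maxExp-≤ 1≤N (suc k) N) (primeProd-maxPow≤ 1≤N k) ⟩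
    N * (P * N ^ k)                            ≤⟨ m≤n*m _ (suc k) ⟩
    suc k * (N * (P * N ^ k))                  ≡⟨ rearrange (suc k) N P (N ^ k) ⟩
    suc k * P * (N * N ^ k)                    ∎
    where
    open ≤-Reasoning
    P = primeProd (λ p → p) k
    rearrange : ∀ a b c d → a * (b * (c * d)) ≡ a * c * (b * d)
    rearrange = solve-∀
  ... | no _ = ≤-trans (primeProd-maxPow≤ 1≤N k) (*-monoʳ-≤ (primeProd (λ p → p) k) (m≤n*m (N ^ k) N {{>-nonZero 1≤N}}))

  -- Passing from the primorial to the lcm costs at most N^√N: a prime above r occurs only to the
  -- first power, and each factor up to r is at most N.
  primeProd-maxPow-large≤ : ∀ {N r} → 1 ≤ N → N < suc r * suc r → ∀ k → r ≤ k →
    primeProd (maxPow N) k ≤ primeProd (λ p → p) k * N ^ r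
  primeProd-maxPow-large≤ {N} {r} 1≤N N<r² k r≤k with m≤n⇒m<n∨m≡n r≤k
  ... | inj₂ refl = primeProd-maxPow≤ 1≤N k
  ... | inj₁ (s≤s {n = k} r≤k′) with prime? (suc k)
  ...   | no _ = primeProd-maxPow-large≤ 1≤N N<r² k r≤k′
  ...   | yes pp = ≤-trans (*-mono-≤ (maxPow-single (suc k) (prime>1 pp) (<-≤-trans N<r² (*-mono-≤ (s≤s r≤k′) (s≤s r≤k′))))
                      (primeProd-maxPow-large≤ 1≤N N<r² k r≤k′))
                    (≤-reflexive (sym (*-assoc (suc k) (primeProd (λ p → p) k) (N ^ r))))

  primeProd-gap : ∀ {h y} d → (∀ p → y < p → p ≤ d + y → ¬ Prime p) → primeProd h (d + y) ≡ primeProd h y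
  primeProd-gap zero _ = refl
  primeProd-gap {y = y} (suc d) none with prime? (suc (d + y))
  ... | yes pp = contradiction pp (none _ (s≤s (m≤n+m y d)) ≤-refl)
  ... | no _   = primeProd-gap d λ p y<p p≤ → none p y<p (m≤n⇒m≤1+n p≤)

  -- The Leibniz harmonic triangle: the entries of each row are differences of
  -- entries of the row above, so a common multiple of 1, …, N clears the
  -- denominators (i + j + 1)! / (i! j!) of rows up to N.
  leibniz : ∀ {D N} → (∀ m → .{{NonZero m}} → m ≤ N → m ∣ D) →
    ∀ i j → suc (i + j) ≤ N → suc (i + j) ! ∣ D * (i ! * j !)
  leibniz {D} h zero j le = subst (suc j ! ∣_) (cong (D *_) (sym (*-identityˡ (j !)))) (*-monoˡ-∣ (j !) (h (suc j) le))
  leibniz {D} {N} h (suc i) j le with leibniz h i j (≤-trans (n≤1+n _) le) | leibniz h i (suc j) (subst (_≤ N) (cong suc (sym (+-suc i j))) le)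
  ... | divides z₁ eq₁ | divides z₂ eq₂ = divides (z₁ ∸ z₂) (begin-equality
    D * (suc i ! * j !)                      ≡⟨ assoc D (suc i) (i !) (j !) ⟩
    suc i * (D * (i ! * j !))                ≡⟨ cong (suc i *_) eq₁ ⟩
    suc i * (z₁ * F)                         ≡⟨ *-assoc (suc i) z₁ F ⟨
    suc i * z₁ * F                           ≡⟨ cong (_* F) diff ⟨
    (z₁ ∸ z₂) * suc (suc (i + j)) * F        ≡⟨ *-assoc (z₁ ∸ z₂) _ F ⟩
    (z₁ ∸ z₂) * suc (suc (i + j)) !          ∎)
    where
    open ≤-Reasoning
    F = suc (i + j) !
    assoc : ∀ a b c d → a * (b * c * d) ≡ b * (a * (c * d))
    assoc = solve-∀
    assoc′ : ∀ a b c d → b * (a * (c * d)) ≡ a * (c * (b * d))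
    assoc′ = solve-∀
    ratio : suc j * z₁ ≡ z₂ * suc (suc (i + j))
    ratio = *-cancelʳ-≡ _ _ F {{suc (i + j) !≢0}} (begin-equality
      suc j * z₁ * F                  ≡⟨ *-assoc (suc j) z₁ F ⟩
      suc j * (z₁ * F)                ≡⟨ cong (suc j *_) eq₁ ⟨
      suc j * (D * (i ! * j !))       ≡⟨ assoc′ D (suc j) (i !) (j !) ⟩
      D * (i ! * suc j !)             ≡⟨ eq₂ ⟩
      z₂ * suc (i + suc j) !          ≡⟨ cong (λ t → z₂ * suc t !) (+-suc i j) ⟩
      z₂ * suc (suc (i + j)) !        ≡⟨ *-assoc z₂ _ F ⟨
      z₂ * suc (suc (i + j)) * F      ∎)
    split : ∀ z i j → z * suc (suc (i + j)) ≡ suc i * z + suc j * z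
    split = solve-∀
    diff : (z₁ ∸ z₂) * suc (suc (i + j)) ≡ suc i * z₁
    diff = begin-equality
      (z₁ ∸ z₂) * suc (suc (i + j))                      ≡⟨ *-distribʳ-∸ (suc (suc (i + j))) z₁ z₂ ⟩
      z₁ * suc (suc (i + j)) ∸ z₂ * suc (suc (i + j))    ≡⟨ cong₂ _∸_ (split z₁ i j) (sym ratio) ⟩
      suc i * z₁ + suc j * z₁ ∸ suc j * z₁               ≡⟨ m+n∸n≡m (suc i * z₁) (suc j * z₁) ⟩
      suc i * z₁                                         ∎

  4^i*i!²≤ : ∀ i → 4 ^ i * (i ! * i !) ≤ suc (i + i) !
  4^i*i!²≤ zero = ≤-refl
  4^i*i!²≤ (suc i) = begin
    4 * 4 ^ i * (suc i * i ! * (suc i * i !))                ≡⟨ r₁ (4 ^ i) (suc i) (i !) ⟩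
    (2 * suc i) * (2 * suc i) * (4 ^ i * (i ! * i !))        ≤⟨ *-mono-≤ (*-mono-≤ (le i) (le′ i)) (4^i*i!²≤ i) ⟩
    suc (suc (suc (i + i))) * suc (suc (i + i)) * suc (i + i) !  ≡⟨ *-assoc (suc (suc (suc (i + i)))) (suc (suc (i + i))) (suc (i + i) !) ⟩
    suc (suc (suc (i + i))) !                                ≡⟨ cong (λ t → suc (suc t) !) (+-suc i i) ⟨
    suc (suc i + suc i) !                                    ∎
    where
    open ≤-Reasoning
    r₁ : ∀ a b c → 4 * a * (b * c * (b * c)) ≡ (2 * b) * (2 * b) * (a * (c * c))
    r₁ = solve-∀
    double : ∀ i → suc (suc (i + i)) ≡ 2 * suc i
    double = solve-∀
    le′ : ∀ i → 2 * suc i ≤ suc (suc (i + i))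
    le′ i = ≤-reflexive (sym (double i))
    le : ∀ i → 2 * suc i ≤ suc (suc (suc (i + i)))
    le i = m≤n⇒m≤1+n (le′ i)

  -- The central entry (2i + 1)!/(i!)² of the triangle divides lcm(1, ..., N) by `leibniz` and is at
  -- least 4^i by `4^i*i!²≤`.
  4^i≤primeProd : ∀ {N} i → suc (i + i) ≤ N → 4 ^ i ≤ primeProd (maxPow N) N
  4^i≤primeProd {N} i le = *-cancelʳ-≤ (4 ^ i) D (i ! * i !)
    (≤-trans (4^i*i!²≤ i) (∣⇒≤ (leibniz all i i le)))
    where
    D = primeProd (maxPow N) N
    primeProd≢0 : ∀ k → NonZero (primeProd (maxPow N) k)
    primeProd≢0 zero = _
    primeProd≢0 (suc k) with prime? (suc k)
    ... | yes _ = m*n≢0 _ _ {{m^n≢0 (suc k) (maxExp N (suc k) N)}} {{primeProd≢0 k}}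
    ... | no  _ = primeProd≢0 k
    instance
      i!²≢0 : NonZero (i ! * i !)
      i!²≢0 = m*n≢0 (i !) (i !) {{i !≢0}} {{i !≢0}}
      D≢0 : NonZero D
      D≢0 = primeProd≢0 N
      D*i!²≢0 : NonZero (D * (i ! * i !))
      D*i!²≢0 = m*n≢0 D (i ! * i !)
    all : ∀ m → .{{NonZero m}} → m ≤ N → m ∣ D
    all m m≤N = ∣primeProd-maxPow N m m≤N (λ _ q∣m → ≤-trans (∣⇒≤ q∣m) m≤N)

  ∤primeProd : Prime p → ∀ k → k < p → ¬ p ∣ primeProd (λ q → q) k
  ∤primeProd pp zero _ p∣1 = <⇒≱ (prime>1 pp) (∣⇒≤ p∣1)
  ∤primeProd {p} pp (suc k) k<p p∣ with prime? (suc k)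
  ... | no _  = ∤primeProd pp k (<⇒≤ k<p) p∣
  ... | yes _ = [ (λ d → <⇒≱ k<p (∣⇒≤ d)) , ∤primeProd pp k (<⇒≤ k<p) ]′ (euclidsLemma (suc k) _ pp p∣)

  prime*∣ : ∀ {a x} → Prime p → ¬ p ∣ a → p ∣ x → a ∣ x → p * a ∣ x
  prime*∣ {p} {a} pp p∤a p∣x (divides q refl) = *-monoˡ-∣ a
    (coprime-divisor coprime (subst (p ∣_) (*-comm q a) p∣x))
    where
    coprime : ∀ {d} → d ∣ p × d ∣ a → d ≡ 1
    coprime (d∣p , d∣a) with prime⇒irreducible pp d∣p
    ... | inj₁ eq   = eq
    ... | inj₂ refl = contradiction d∣a p∤a

  primeProd-∣ : ∀ {M y} d → (∀ p → Prime p → y < p → p ≤ d + y → p ∣ M) →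
    primeProd (λ p → p) (d + y) ∣ primeProd (λ p → p) y * M
  primeProd-∣ {M} zero _ = m∣m*n M
  primeProd-∣ {M} {y} (suc d) h with primeProd-∣ {M} {y} d (λ p pp lt le → h p pp lt (m≤n⇒m≤1+n le)) | prime? (suc (d + y))
  ... | ih | no _   = ih
  ... | ih | yes pp = prime*∣ pp (∤primeProd pp (d + y) ≤-refl) (∣n⇒∣m*n (primeProd (λ p → p) y) (h _ pp (s≤s (m≤n+m y d)) ≤-refl)) ih

  prime∣!⇒≤ : Prime p → ∀ k → p ∣ k ! → p ≤ k
  prime∣!⇒≤ pp zero p∣1 = contradiction (∣⇒≤ p∣1) (<⇒≱ (prime>1 pp))
  prime∣!⇒≤ pp (suc k) p∣ with euclidsLemma (suc k) (k !) pp p∣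
  ... | inj₁ d = ∣⇒≤ d
  ... | inj₂ d = m≤n⇒m≤1+n (prime∣!⇒≤ pp k d)

  n∣n! : ∀ n → .{{NonZero n}} → n ∣ n !
  n∣n! (suc n) = m∣m*n (n !)

  -- A bound for the binomial coefficient (2m + 1)!/(m! (m + 1)!): from m to m + 1 it grows by the
  -- factor (2m + 2)(2m + 3)/((m + 1)(m + 2)) < 4.
  [2m+1]!≤ : ∀ m → suc (m + m) ! ≤ 4 ^ m * (m ! * suc m !)
  [2m+1]!≤ zero = ≤-refl
  [2m+1]!≤ (suc m) = begin
    suc (suc m + suc m) !                                        ≡⟨ cong (λ t → suc (suc t) !) (+-suc m m) ⟩
    suc (suc (suc (m + m))) * (suc (suc (m + m)) * suc (m + m) !) ≤⟨ *-mono-≤ (le m) (*-monoʳ-≤ (suc (suc (m + m))) ([2m+1]!≤ m)) ⟩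
    2 * suc (suc m) * (suc (suc (m + m)) * (4 ^ m * (m ! * suc m !)))  ≡⟨ r m (4 ^ m) (m !) (suc m !) ⟩
    4 * 4 ^ m * (suc m * m ! * (suc (suc m) * suc m !))          ∎
    where
    open ≤-Reasoning
    r : ∀ m a b c → 2 * suc (suc m) * (suc (suc (m + m)) * (a * (b * c))) ≡ 4 * a * (suc m * b * (suc (suc m) * c))
    r = solve-∀
    four : ∀ m → suc (suc (suc (suc (m + m)))) ≡ 2 * suc (suc m)
    four = solve-∀
    le : ∀ m → suc (suc (suc (m + m))) ≤ 2 * suc (suc m)
    le m = ≤-trans (n≤1+n _) (≤-reflexive (four m))

  -- The primes in (m + 1, 2m + 1] divide the binomial coefficient (2m + 1 over m) ≤ 4^m.
  primorial-odd : ∀ m → primeProd (λ p → p) (suc m) ≤ 4 ^ suc m → primeProd (λ p → p) (suc (m + m)) ≤ 4 ^ suc (m + m)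
  primorial-odd m ih with k![n∸k]!∣n! {suc (m + m)} {m} (m≤n⇒m≤1+n (m≤m+n m m))
  ... | divides M eq = begin
    primeProd (λ p → p) (suc (m + m))       ≡⟨ cong (primeProd (λ p → p)) (+-suc m m) ⟨
    primeProd (λ p → p) (m + suc m)         ≤⟨ ∣⇒≤ {{nz}} (primeProd-∣ {M} {suc m} m divs) ⟩
    primeProd (λ p → p) (suc m) * M         ≤⟨ *-mono-≤ ih M≤ ⟩
    4 ^ suc m * 4 ^ m                       ≡⟨ ^-distribˡ-+-* 4 (suc m) m ⟨
    4 ^ suc (m + m)                         ∎
    where
    open ≤-Reasoning
    eq′ : suc (m + m) ! ≡ M * (m ! * suc m !)
    eq′ = trans eq (cong (λ t → M * (m ! * t !)) (trans (cong (_∸ m) (sym (+-suc m m))) (m+n∸m≡n m (suc m))))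
    instance
      f≢0 : NonZero (m ! * suc m !)
      f≢0 = m*n≢0 (m !) (suc m !) {{m !≢0}} {{suc m !≢0}}
    M≤ : M ≤ 4 ^ m
    M≤ = *-cancelʳ-≤ M (4 ^ m) (m ! * suc m !) (subst (_≤ 4 ^ m * (m ! * suc m !)) eq′ ([2m+1]!≤ m))
    M≢0 : NonZero M
    M≢0 = ≢-nonZero λ { refl → ≢-nonZero⁻¹ (suc (m + m) !) {{suc (m + m) !≢0}} eq′ }
    nz : NonZero (primeProd (λ p → p) (suc m) * M)
    nz = m*n≢0 (primeProd (λ p → p) (suc m)) M {{primeProd-nonZero (suc m)}} {{M≢0}}
    divs : ∀ p → Prime p → suc m < p → p ≤ m + suc m → p ∣ M
    divs p pp lt le with euclidsLemma M _ pp (subst (p ∣_) eq′ (∣-trans (n∣n! p {{prime⇒nonZero pp}})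
                          (m≤n⇒m!∣n! (subst (p ≤_) (+-suc m m) le))))
    ... | inj₁ d = d
    ... | inj₂ d with euclidsLemma (m !) (suc m !) pp d
    ...   | inj₁ d′ = contradiction (prime∣!⇒≤ pp m d′) (<⇒≱ (<⇒≤ lt))
    ...   | inj₂ d′ = contradiction (prime∣!⇒≤ pp (suc m) d′) (<⇒≱ lt)

  data Halved : ℕ → Set where
    even : ∀ m → Halved (m + m)
    odd  : ∀ m → Halved (suc (m + m))

  halve : ∀ n → Halved n
  halve zero = even 0
  halve (suc n) with halve n
  ... | even m = odd m
  ... | odd m  = subst Halved (cong suc (+-suc m m)) (even (suc m))

  -- Erdős's induction: an even number above 2 is not prime and adds no factor, an odd one 2m + 1 is
  -- reduced to m + 1 by `primorial-odd`.
  primorial≤ : ∀ k → primeProd (λ p → p) k ≤ 4 ^ k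
  primorial≤ = <-rec (λ k → primeProd (λ p → p) k ≤ 4 ^ k) go
    where
    go : ∀ k → (∀ {j} → j < k → primeProd (λ p → p) j ≤ 4 ^ j) → primeProd (λ p → p) k ≤ 4 ^ k
    go k rec with halve k
    ... | even 0 = ≤-refl
    ... | even 1 = ≤ᵇ⇒≤ 2 16 _
    ... | odd 0  = s≤s z≤n
    ... | odd (suc m) = primorial-odd (suc m) (rec (s≤s (s≤s (m≤n+m (suc m) m))))
    ... | even (suc (suc m)) with prime? (suc (suc (m + suc (suc m))))
    ...   | no _ = ≤-trans (rec ≤-refl) (m≤n*m (4 ^ suc (m + suc (suc m))) 4)
    ...   | yes pp with prime⇒irreducible pp (divides (suc (suc m)) (dbl m))
      where
      dbl : ∀ m → suc (suc (m + suc (suc m))) ≡ suc (suc m) * 2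
      dbl = solve-∀
    ...     | inj₁ ()
    ...     | inj₂ eq = contradiction (sym (trans (suc-injective (suc-injective eq)) (+-suc m (suc m)))) 1+n≢0

  isqrt : ∀ n → ∃ λ r → r * r ≤ n × n < suc r * suc r
  isqrt zero = 0 , z≤n , s≤s z≤n
  isqrt (suc n) with isqrt n
  ... | r , lo , hi with suc r * suc r ≤? suc n
  ...   | no  ≰ = r , m≤n⇒m≤1+n lo , ≰⇒> ≰
  ...   | yes le = suc r , le , ≤-<-trans hi (*-mono-< (n<1+n (suc r)) (n<1+n (suc r)))

  404[t+1]≤2^t : ∀ t → 13 ≤ t → 404 * suc t ≤ 2 ^ t
  404[t+1]≤2^t t 13≤t = subst (λ t → 404 * suc t ≤ 2 ^ t) (m∸n+n≡m 13≤t) (go (t ∸ 13))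
    where
    open ≤-Reasoning
    double : ∀ x → suc x + suc x ≡ 2 * suc x
    double = solve-∀
    swap : ∀ x → 404 * (2 * x) ≡ 2 * (404 * x)
    swap = solve-∀
    go : ∀ d → 404 * suc (d + 13) ≤ 2 ^ (d + 13)
    go zero = ≤ᵇ⇒≤ 5656 8192 _
    go (suc d) = begin
      404 * suc (suc d + 13)         ≤⟨ *-monoʳ-≤ 404 (s≤s (m≤n+m (suc (d + 13)) (d + 13))) ⟩
      404 * (suc (d + 13) + suc (d + 13))  ≡⟨ cong (404 *_) (double (d + 13)) ⟩
      404 * (2 * suc (d + 13))       ≡⟨ swap (suc (d + 13)) ⟩
      2 * (404 * suc (d + 13))       ≤⟨ *-monoʳ-≤ 2 (go d) ⟩
      2 * 2 ^ (d + 13)               ∎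

  -- Let t = r / 403. Then r + 1 < 2^t, so 402(v + 1) < (r + 1)² turns the r-th power into less than
  -- 4^(tr), and 403tr ≤ r² ≤ 402(v + 1) leaves tr ≤ v. The bound 70000 makes r exceed 5240 and
  -- hence t ≥ 13, from where on 2^t exceeds 404(t + 1) > r + 1.
  power-gap : ∀ v → 70000 ≤ suc v → ∀ r → r * r ≤ 402 * suc v → 402 * suc v < suc r * suc r → (402 * suc v) ^ r < 4 ^ v
  power-gap v big r lo hi = begin-strict
    (402 * suc v) ^ r            ≤⟨ ^-monoˡ-≤ r (<⇒≤ hi) ⟩
    (suc r * suc r) ^ r          <⟨ ^-monoˡ-< r {{r≢0}} (*-mono-< r<2^t r<2^t) ⟩
    (2 ^ t * 2 ^ t) ^ r          ≡⟨ cong (_^ r) 2^t² ⟩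
    (4 ^ t) ^ r                  ≡⟨ ^-*-assoc 4 t r ⟩
    4 ^ (t * r)                  ≤⟨ ^-monoʳ-≤ 4 tr≤v ⟩
    4 ^ v                        ∎
    where
    open ≤-Reasoning
    t = r / 403
    5240<r : 5240 < r
    5240<r = ≰⇒> λ r≤ → <⇒≱ hi (begin
      suc r * suc r    ≤⟨ *-mono-≤ (s≤s r≤) (s≤s r≤) ⟩
      5241 * 5241      ≤⟨ ≤ᵇ⇒≤ (5241 * 5241) (402 * 70000) _ ⟩
      402 * 70000      ≤⟨ *-monoʳ-≤ 402 big ⟩
      402 * suc v      ∎)
    r≢0 : NonZero r
    r≢0 = >-nonZero (≤-<-trans z≤n 5240<r)
    r≡ : r ≡ r % 403 + t * 403
    r≡ = m≡m%n+[m/n]*n r 403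
    13≤t : 13 ≤ t
    13≤t = /-monoˡ-≤ 403 (≤-trans (≤ᵇ⇒≤ 5239 5241 _) 5240<r)
    r<2^t : suc r < 2 ^ t
    r<2^t = begin-strict
      suc r                        ≡⟨ cong suc r≡ ⟩
      suc (r % 403) + t * 403      ≤⟨ +-monoˡ-≤ (t * 403) (m%n<n r 403) ⟩
      403 + t * 403                <⟨ n<1+n _ ⟩
      404 + t * 403                ≤⟨ +-monoʳ-≤ 404 (*-monoʳ-≤ t (n≤1+n 403)) ⟩
      404 + t * 404                ≡⟨ *-comm (suc t) 404 ⟩
      404 * suc t                  ≤⟨ 404[t+1]≤2^t t 13≤t ⟩
      2 ^ t                        ∎
    2^t² : 2 ^ t * 2 ^ t ≡ 4 ^ t
    2^t² = trans (sym (^-distribˡ-+-* 2 t t)) (trans (cong (2 ^_) (cong (t +_) (sym (+-identityʳ t)))) (sym (^-*-assoc 2 2 t)))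
    r1 : ∀ a b t r → a * (b * (t * r)) ≡ b * (t * a * r)
    r1 = solve-∀
    tr≤v : t * r ≤ v
    tr≤v = s≤s⁻¹ (*-cancelˡ-< 402 _ _ (*-cancelˡ-< 403 _ _ (begin-strict
      403 * (402 * (t * r))         ≡⟨ r1 403 402 t r ⟩
      402 * (t * 403 * r)           ≤⟨ *-monoʳ-≤ 402 (*-monoˡ-≤ r (subst (t * 403 ≤_) (sym r≡) (m≤n+m (t * 403) (r % 403)))) ⟩
      402 * (r * r)                 <⟨ *-monoʳ-< 402 (≤-<-trans lo (n<1+n _)) ⟩
      402 * suc (402 * suc v)       ≡⟨ *-suc 402 (402 * suc v) ⟩
      402 + 402 * (402 * suc v)     ≤⟨ +-monoˡ-≤ (402 * (402 * suc v)) (m≤m*n 402 (suc v)) ⟩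
      403 * (402 * suc v)           ∎)))

  -- Without such a prime, lcm(1, ..., 402v) would have the prime factors of numbers up to 200v
  -- only, and be at most 4^(200v) times an N^√N. But it is at least about 4^(201v), and the surplus
  -- of about 4^v beats N^√N by `power-gap`.
  prime-between : ∀ v → 70000 ≤ v → ∃ λ p → Prime p × 200 * v < p × p ≤ 402 * v
  prime-between (suc v) big with anyUpTo? (λ k → prime? (k + suc (200 * suc v))) (202 * suc v)
  ... | yes (k , k< , pp) = k + suc (200 * suc v) , pp , m≤n+m _ k ,
          subst₂ _≤_ (sym (+-suc k (200 * suc v))) (sym (r (suc v))) (+-monoˡ-≤ (200 * suc v) k<)
    where
    r : ∀ x → 402 * x ≡ 202 * x + 200 * x
    r = solve-∀
  ... | no none with isqrt (402 * suc v)
  ...   | r , lo , hi = contradiction bad (<⇒≱ (power-gap v big r lo hi))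
    where
    open ≤-Reasoning
    N = 402 * suc v
    y = 200 * suc v
    N≡ : ∀ x → 402 * x ≡ 202 * x + 200 * x
    N≡ = solve-∀
    2i≡ : ∀ v → suc (suc (200 * suc v + v + (200 * suc v + v))) ≡ 402 * suc v
    2i≡ = solve-∀
    gap : ∀ p → y < p → p ≤ 202 * suc v + y → ¬ Prime p
    gap p y<p p≤ pp = none (p ∸ suc y , +-cancelʳ-≤ y _ _ (subst (_≤ 202 * suc v + y) (trans (sym (m∸n+n≡m y<p)) (+-suc (p ∸ suc y) y)) p≤) ,
      subst Prime (sym (m∸n+n≡m y<p)) pp)
    sq : ∀ a x → a * x * (a * x) ≡ a * a * (x * x)
    sq = solve-∀
    r≤y : r ≤ y
    r≤y = ≮⇒≥ λ y<r → <⇒≱ (begin-strict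
      402 * suc v        <⟨ *-monoˡ-< (suc v) (≤ᵇ⇒≤ 403 40000 _) ⟩
      40000 * suc v      ≤⟨ *-monoʳ-≤ 40000 (m≤m*n (suc v) (suc v)) ⟩
      40000 * (suc v * suc v)  ≡⟨ sq 200 (suc v) ⟨
      y * y              ∎) (≤-trans (*-mono-≤ (<⇒≤ y<r) (<⇒≤ y<r)) lo)
    bad : 4 ^ v ≤ N ^ r
    bad = *-cancelˡ-≤ (4 ^ y) {{m^n≢0 4 y}} (begin
      4 ^ y * 4 ^ v                             ≡⟨ ^-distribˡ-+-* 4 y v ⟨
      4 ^ (y + v)                               ≤⟨ 4^i≤primeProd {N} (y + v) (≤-trans (n≤1+n _) (≤-reflexive (2i≡ v))) ⟩
      primeProd (maxPow N) N                    ≡⟨ cong (primeProd (maxPow N)) (N≡ (suc v)) ⟩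
      primeProd (maxPow N) (202 * suc v + y)    ≡⟨ primeProd-gap (202 * suc v) gap ⟩
      primeProd (maxPow N) y                    ≤⟨ primeProd-maxPow-large≤ (s≤s z≤n) hi y r≤y ⟩
      primeProd (λ p → p) y * N ^ r             ≤⟨ *-monoˡ-≤ (N ^ r) (primorial≤ y) ⟩
      4 ^ y * N ^ r                             ∎)

-- Sizes of edge sets as sums over pairs of vertices

module EdgeCounting where

  open import Defs
  open import Data.Bool.Base using (Bool; true; false; T; _∧_)
  open import Data.Fin.Base using (Fin; zero; suc; toℕ) renaming (_<_ to _<ᶠ_)
  open import Data.Fin.Properties using () renaming (_≟_ to _≟ᶠ_; _<?_ to _<ᶠ?_; <-cmp to <ᶠ-cmp)
  open import Data.List.Base using (List; []; _∷_; _++_; length; filterᵇ; mapMaybe; tabulate; map; cartesianProduct)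
  open import Data.Maybe.Base using (Maybe; just; nothing; maybe) renaming (map to mapᴹ)
  open import Data.Nat.Base
  open import Data.Nat.Properties
  open import Data.Nat.Combinatorics using (_C_; nCk+nC[k+1]≡[n+1]C[k+1]; nC1≡n)
  open import Data.Nat.Tactic.RingSolver
  open import Data.Product.Base using (∃; _×_; _,_)
  open import Data.Unit.Base using (tt)
  open import Function.Base using (_∘_)
  open import Function.Definitions using (Injective)
  open import Relation.Binary.Definitions using (tri<; tri≈; tri>)
  open import Relation.Binary.PropositionalEquality
  open import Relation.Nullary
  open import Relation.Nullary.Decidable.Core using (dec⇒maybe)
  open import Relation.Nullary.Negation using (contradiction-irr)
  open import Algebra.Properties.Semiring.Sum +-*-semiring public
    using (sum; sum-cong-≗; ∑-distrib-+; ∑-comm; *-distribˡ-sum; *-distribʳ-sum)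

  private variable
    n k : ℕ

  infixr 2 ∑-syntax

  ∑-syntax : ∀ n → (Fin n → ℕ) → ℕ
  ∑-syntax _ = sum

  syntax ∑-syntax n (λ i → x) = ∑[ i < n ] x

  ⟦_⟧ : Bool → ℕ
  ⟦ true  ⟧ = 1
  ⟦ false ⟧ = 0

  ⟦⟧≤1 : ∀ b → ⟦ b ⟧ ≤ 1
  ⟦⟧≤1 true  = ≤-refl
  ⟦⟧≤1 false = z≤n

  sum-mono : ∀ {f g : Fin n → ℕ} → (∀ i → f i ≤ g i) → sum f ≤ sum g
  sum-mono {zero}  h = z≤n
  sum-mono {suc n} h = +-mono-≤ (h zero) (sum-mono (h ∘ suc))

  sum-const : ∀ n c → sum {n} (λ _ → c) ≡ n * c
  sum-const zero c = refl
  sum-const (suc n) c = cong (c +_) (sum-const n c)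

  sum-zero : ∀ {f : Fin n → ℕ} → (∀ i → f i ≡ 0) → sum f ≡ 0
  sum-zero {n} h = trans (sum-cong-≗ h) (trans (sum-const n 0) (*-zeroʳ n))

  ≤sum : ∀ (f : Fin n → ℕ) i → f i ≤ sum f
  ≤sum f zero = m≤m+n _ _
  ≤sum f (suc i) = ≤-trans (≤sum (f ∘ suc) i) (m≤n+m _ (f zero))

  sum≤1 : ∀ (f : Fin n → ℕ) → (∀ i → f i ≤ 1) → (∀ i j → 1 ≤ f i → 1 ≤ f j → i ≡ j) → sum f ≤ 1
  sum≤1 {zero} f _ _ = z≤n
  sum≤1 {suc n} f f≤1 unique with f zero in eq
  ... | zero = sum≤1 (f ∘ suc) (f≤1 ∘ suc) λ i j p q → suc-inj (unique (suc i) (suc j) p q)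
    where
    suc-inj : ∀ {m} {i j : Fin m} → suc i ≡ suc j → i ≡ j
    suc-inj refl = refl
  ... | suc f₀ = subst (_≤ 1) (sym (trans (cong (suc f₀ +_) (sum-zero rest)) (+-identityʳ _))) (subst (_≤ 1) eq (f≤1 zero))
    where
    rest : ∀ i → f (suc i) ≡ 0
    rest i with f (suc i) in eq′
    ... | zero = refl
    ... | suc _ with () ← unique zero (suc i) (subst (1 ≤_) (sym eq) (s≤s z≤n)) (subst (1 ≤_) (sym eq′) (s≤s z≤n))

  δ : Fin n → Fin n → ℕ
  δ u i = ⟦ does (u ≟ᶠ i) ⟧

  δ-refl : ∀ (u : Fin n) → δ u u ≡ 1
  δ-refl u with u ≟ᶠ u
  ... | yes _ = refl
  ... | no ¬p = contradiction refl ¬p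

  δ-≢ : ∀ {u i : Fin n} → u ≢ i → δ u i ≡ 0
  δ-≢ {u = u} {i} u≢i with u ≟ᶠ i
  ... | yes p = contradiction p u≢i
  ... | no _ = refl

  sum-δ : ∀ (u : Fin n) (f : Fin n → ℕ) → (∑[ i < n ] δ u i * f i) ≡ f u
  sum-δ zero f = trans (cong (f zero + 0 +_) (sum-zero {f = λ i → 0 * f (suc i)} λ i → refl)) (trans (+-identityʳ _) (+-identityʳ _))
  sum-δ (suc u) f = sum-δ u (f ∘ suc)

  sum-δ₁ : ∀ (u : Fin n) → (∑[ i < n ] δ u i) ≡ 1
  sum-δ₁ u = trans (sum-cong-≗ λ i → sym (*-identityʳ (δ u i))) (sum-δ u (λ _ → 1))

  mask : Fin n → (Fin n → ℕ) → Fin n → ℕ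
  mask u f i with u ≟ᶠ i
  ... | yes _ = 0
  ... | no _  = f i

  mask-≢ : ∀ (u : Fin n) (f : Fin n → ℕ) {i} → 1 ≤ mask u f i → u ≢ i × mask u f i ≡ f i
  mask-≢ u f {i} h with u ≟ᶠ i
  mask-≢ u f {i} () | yes _
  mask-≢ u f {i} h  | no u≢i = u≢i , refl

  mask-≤ : ∀ (u : Fin n) (f : Fin n → ℕ) i → mask u f i ≤ f i
  mask-≤ u f i with u ≟ᶠ i
  ... | yes _ = z≤n
  ... | no _  = ≤-refl

  sum-mask : ∀ (u : Fin n) (f : Fin n → ℕ) → sum f ≤ f u + sum (mask u f)
  sum-mask {n} u f = begin
    sum f                                      ≤⟨ sum-mono le ⟩
    (∑[ i < n ] (δ u i * f i + mask u f i))    ≡⟨ ∑-distrib-+ (λ i → δ u i * f i) (mask u f) ⟩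
    (∑[ i < n ] δ u i * f i) + sum (mask u f)  ≡⟨ cong (_+ sum (mask u f)) (sum-δ u f) ⟩
    f u + sum (mask u f)                       ∎
    where
    open ≤-Reasoning
    le : ∀ i → f i ≤ δ u i * f i + mask u f i
    le i with u ≟ᶠ i
    ... | yes _ = ≤-reflexive (sym (trans (+-identityʳ _) (+-identityʳ _)))
    ... | no _  = ≤-refl

  module _ {A : Set} (S : A → Bool) where

    count : List A → ℕ
    count xs = length (filterᵇ S xs)

    count-mapMaybe : ∀ {B : Set} (f : B → Maybe A) x xs →
      count (mapMaybe f (x ∷ xs)) ≡ maybe (⟦_⟧ ∘ S) 0 (f x) + count (mapMaybe f xs)
    count-mapMaybe f x xs with f x
    ... | nothing = refl
    ... | just a with S a
    ...   | true  = refl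
    ...   | false = refl

    count-row : ∀ {B C : Set} {m} (f : B × C → Maybe A) b (g : Fin m → C) rest →
      count (mapMaybe f (map (b ,_) (tabulate g) ++ rest)) ≡
      (∑[ j < m ] maybe (⟦_⟧ ∘ S) 0 (f (b , g j))) + count (mapMaybe f rest)
    count-row {m = zero} f b g rest = refl
    count-row {m = suc m} f b g rest = trans
      (count-mapMaybe f (b , g zero) (map (b ,_) (tabulate (g ∘ suc)) ++ rest))
      (trans (cong (maybe (⟦_⟧ ∘ S) 0 (f (b , g zero)) +_) (count-row f b (g ∘ suc) rest))
        (sym (+-assoc (maybe (⟦_⟧ ∘ S) 0 (f (b , g zero))) _ _)))

    count-grid : ∀ {B C : Set} {l m} (f : B × C → Maybe A) (h : Fin l → B) (g : Fin m → C) →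
      count (mapMaybe f (cartesianProduct (tabulate h) (tabulate g))) ≡
      (∑[ i < l ] ∑[ j < m ] maybe (⟦_⟧ ∘ S) 0 (f (h i , g j)))
    count-grid {l = zero} f h g = refl
    count-grid {l = suc l} f h g = trans
      (count-row f (h zero) g (cartesianProduct (tabulate (h ∘ suc)) (tabulate g)))
      (cong (_ +_) (count-grid f (h ∘ suc) g))

  -- The weight is a function of the decision itself, so that `∣∣≡sum` can generalize over the `Dec`
  -- inside the definition of `allEdges`.
  upper : EdgeSet n → Fin n → Fin n → ℕ
  upper S i j = weight (i <ᶠ? j)
    module Upper where
    weight : Dec (i <ᶠ j) → ℕ
    weight (yes i<j) = ⟦ S (edge i j i<j) ⟧
    weight (no  _)   = 0

  ∣∣≡sum : ∀ (S : EdgeSet n) → ∣ S ∣ ≡ (∑[ i < n ] ∑[ j < n ] upper S i j)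
  ∣∣≡sum {n} S = trans (count-grid S {l = n} {m = n} _ (λ i → i) (λ j → j))
    (sum-cong-≗ λ i → sum-cong-≗ λ j → entry i j)
    where
    entry′ : ∀ i j (d : Dec (i <ᶠ j)) →
      maybe (⟦_⟧ ∘ S) 0 (mapᴹ (λ i<j → edge i j i<j) (dec⇒maybe d)) ≡ Upper.weight S i j d
    entry′ i j (yes _) = refl
    entry′ i j (no _)  = refl
    entry : ∀ i j → _ ≡ upper S i j
    entry i j = entry′ i j (i <ᶠ? j)

  upper-< : ∀ (S : EdgeSet n) {i j} (i<j : i <ᶠ j) → upper S i j ≡ ⟦ S (edge i j i<j) ⟧
  upper-< S {i} {j} i<j with i <ᶠ? j
  ... | yes _ = refl
  ... | no ≮  = contradiction i<j ≮

  upper-edge : ∀ (S : EdgeSet n) e → upper S (lo e) (hi e) ≡ ⟦ S e ⟧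
  upper-edge S (edge i j i<j) with i <ᶠ? j
  ... | yes _ = refl
  ... | no ≮  = contradiction-irr i<j ≮

  upper-≮ : ∀ (S : EdgeSet n) {i j} → ¬ i <ᶠ j → upper S i j ≡ 0
  upper-≮ S {i} {j} ≮ with i <ᶠ? j
  ... | yes i<j = contradiction i<j ≮
  ... | no _    = refl

  -- The symmetric adjacency matrix, with the same case split as `join`, so that `adj-join` follows
  -- case by case.
  adj : EdgeSet n → Fin n → Fin n → ℕ
  adj S i j with <ᶠ-cmp i j
  ... | tri< i<j _ _ = ⟦ S (edge i j i<j) ⟧
  ... | tri≈ _ _ _   = 0
  ... | tri> _ _ j<i = ⟦ S (edge j i j<i) ⟧

  adj≡upper : ∀ (S : EdgeSet n) i j → adj S i j ≡ upper S i j + upper S j i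
  adj≡upper S i j with <ᶠ-cmp i j
  ... | tri< i<j _ ≯ = sym (trans (cong₂ _+_ (upper-< S i<j) (upper-≮ S ≯)) (+-identityʳ _))
  ... | tri≈ ≮ _ ≯   = sym (cong₂ _+_ (upper-≮ S ≮) (upper-≮ S ≯))
  ... | tri> ≮ _ j<i = sym (cong₂ _+_ (upper-≮ S ≮) (upper-< S j<i))

  adj-sym : ∀ (S : EdgeSet n) i j → adj S i j ≡ adj S j i
  adj-sym S i j = trans (adj≡upper S i j) (trans (+-comm (upper S i j) _) (sym (adj≡upper S j i)))

  adj-join : ∀ (S : EdgeSet n) {i j} (i≢j : i ≢ j) → adj S i j ≡ ⟦ S (join i j i≢j) ⟧
  adj-join S {i} {j} i≢j with <ᶠ-cmp i j
  ... | tri< _ _ _   = refl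
  ... | tri≈ _ i≡j _ = contradiction i≡j i≢j
  ... | tri> _ _ _   = refl

  adj≤1 : ∀ (S : EdgeSet n) i j → adj S i j ≤ 1
  adj≤1 S i j with <ᶠ-cmp i j
  ... | tri< i<j _ _ = ⟦⟧≤1 (S (edge i j i<j))
  ... | tri≈ _ _ _   = z≤n
  ... | tri> _ _ j<i = ⟦⟧≤1 (S (edge j i j<i))

  adj⇒≢ : ∀ (S : EdgeSet n) {i j} → 1 ≤ adj S i j → i ≢ j
  adj⇒≢ S {i} {j} h i≡j with <ᶠ-cmp i j
  ... | tri< _ i≢j _ = i≢j i≡j
  ... | tri> _ i≢j _ = i≢j i≡j
  adj⇒≢ S {i} {j} () _ | tri≈ _ _ _

  handshake : ∀ (S : EdgeSet n) → (∑[ i < n ] ∑[ j < n ] adj S i j) ≡ ∣ S ∣ + ∣ S ∣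
  handshake {n} S = begin-equality
    (∑[ i < n ] ∑[ j < n ] adj S i j)                                ≡⟨ (sum-cong-≗ λ i → trans (sum-cong-≗ (adj≡upper S i)) (∑-distrib-+ (upper S i) (λ j → upper S j i))) ⟩
    (∑[ i < n ] (sum (upper S i) + (∑[ j < n ] upper S j i)))        ≡⟨ ∑-distrib-+ (λ i → sum (upper S i)) _ ⟩
    U + (∑[ i < n ] ∑[ j < n ] upper S j i)                          ≡⟨ cong (U +_) (∑-comm (λ i j → upper S j i)) ⟩
    U + U                                                            ≡⟨ cong₂ _+_ (∣∣≡sum S) (∣∣≡sum S) ⟨
    ∣ S ∣ + ∣ S ∣                                                    ∎
    where
    open ≤-Reasoning
    U = ∑[ i < n ] ∑[ j < n ] upper S i j

  sum-δδ : ∀ (u v : Fin n) → (∑[ i < n ] ∑[ j < n ] δ u i * δ v j) ≡ 1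
  sum-δδ {n} u v = trans (sum-cong-≗ λ i → sym (*-distribˡ-sum (δ u i) (δ v)))
    (trans (sum-cong-≗ λ i → cong (δ u i *_) (sum-δ₁ v)) (sum-δ u (λ _ → 1)))

  ∑∑-mono : ∀ {f g : Fin n → Fin n → ℕ} → (∀ i j → f i j ≤ g i j) →
    (∑[ i < n ] ∑[ j < n ] f i j) ≤ (∑[ i < n ] ∑[ j < n ] g i j)
  ∑∑-mono h = sum-mono λ i → sum-mono (h i)

  edge-ext : ∀ {e e′ : Edge n} → lo e ≡ lo e′ → hi e ≡ hi e′ → e ≡ e′
  edge-ext refl refl = refl

  -- Double counting the incidences between edges and the selected members of a family.
  module _ (h : Fin k → Edge n) (χ : Fin k → Bool) where

    private
      hits : Fin n → Fin n → Fin k → ℕ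
      hits i j t = ⟦ χ t ⟧ * (δ (lo (h t)) i * δ (hi (h t)) j)

      total : (∑[ i < n ] ∑[ j < n ] ∑[ t < k ] hits i j t) ≡ (∑[ t < k ] ⟦ χ t ⟧)
      total = trans (sum-cong-≗ λ i → ∑-comm (hits i))
        (trans (∑-comm (λ i t → ∑[ j < n ] hits i j t))
          (sum-cong-≗ λ t → trans (sum-cong-≗ λ i → sym (*-distribˡ-sum ⟦ χ t ⟧ (λ j → δ (lo (h t)) i * δ (hi (h t)) j)))
            (trans (sym (*-distribˡ-sum ⟦ χ t ⟧ (λ i → ∑[ j < n ] δ (lo (h t)) i * δ (hi (h t)) j)))
              (trans (cong (⟦ χ t ⟧ *_) (sum-δδ (lo (h t)) (hi (h t)))) (*-identityʳ ⟦ χ t ⟧)))))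

      hit : ∀ {i j t} → 1 ≤ hits i j t → T (χ t) × lo (h t) ≡ i × hi (h t) ≡ j
      hit {i} {j} {t} le with χ t | lo (h t) ≟ᶠ i | hi (h t) ≟ᶠ j
      ... | true | yes p | yes q = tt , p , q
      hit () | true | yes _ | no _
      hit () | true | no _  | _
      hit () | false | _ | _

      T⇒1 : ∀ {b} → T b → ⟦ b ⟧ ≡ 1
      T⇒1 {true} _ = refl

    count-≤ : ∀ {S} → (∀ e → e ∈ S → ∃ λ t → T (χ t) × h t ≡ e) → ∣ S ∣ ≤ (∑[ t < k ] ⟦ χ t ⟧)
    count-≤ {S} covered = begin
      ∣ S ∣                                         ≡⟨ ∣∣≡sum S ⟩
      (∑[ i < n ] ∑[ j < n ] upper S i j)           ≤⟨ ∑∑-mono le ⟩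
      (∑[ i < n ] ∑[ j < n ] ∑[ t < k ] hits i j t) ≡⟨ total ⟩
      (∑[ t < k ] ⟦ χ t ⟧)                          ∎
      where
      open ≤-Reasoning
      le : ∀ i j → upper S i j ≤ (∑[ t < k ] hits i j t)
      le i j with i <ᶠ? j
      ... | no _ = z≤n
      ... | yes i<j with S (edge i j i<j) in eq
      ...   | false = z≤n
      ...   | true with covered (edge i j i<j) (subst T (sym eq) tt)
      ...     | t , χt , refl = ≤-trans (≤-reflexive (sym (cong₂ _*_ (T⇒1 χt) (cong₂ _*_ (δ-refl i) (δ-refl j))))) (≤sum (hits i j) t)

    count-≥ : ∀ {S} → Injective _≡_ _≡_ h → (∀ t → T (χ t) → h t ∈ S) → (∑[ t < k ] ⟦ χ t ⟧) ≤ ∣ S ∣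
    count-≥ {S} inj inside = begin
      (∑[ t < k ] ⟦ χ t ⟧)                          ≡⟨ total ⟨
      (∑[ i < n ] ∑[ j < n ] ∑[ t < k ] hits i j t) ≤⟨ ∑∑-mono le ⟩
      (∑[ i < n ] ∑[ j < n ] upper S i j)           ≡⟨ ∣∣≡sum S ⟨
      ∣ S ∣                                         ∎
      where
      open ≤-Reasoning
      hits≤1 : ∀ i j t → hits i j t ≤ 1
      hits≤1 i j t = *-mono-≤ (⟦⟧≤1 (χ t)) (*-mono-≤ (⟦⟧≤1 (does (lo (h t) ≟ᶠ i))) (⟦⟧≤1 (does (hi (h t) ≟ᶠ j))))
      unique : ∀ i j t t′ → 1 ≤ hits i j t → 1 ≤ hits i j t′ → t ≡ t′
      unique i j t t′ p q with hit {i} {j} {t} p | hit {i} {j} {t′} q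
      ... | _ , lo≡ , hi≡ | _ , lo≡′ , hi≡′ = inj (edge-ext (trans lo≡ (sym lo≡′)) (trans hi≡ (sym hi≡′)))
      le : ∀ i j → (∑[ t < k ] hits i j t) ≤ upper S i j
      le i j with upper S i j in eq
      ... | suc _ = ≤-trans (sum≤1 (hits i j) (hits≤1 i j) (unique i j)) (s≤s z≤n)
      ... | zero = ≤-reflexive (sum-zero λ t → n<1⇒n≡0 (≰⇒> λ p → none t (hit {i} {j} {t} p)))
        where
        none : ∀ t → ¬ (T (χ t) × lo (h t) ≡ i × hi (h t) ≡ j)
        none t (χt , refl , refl) = contradiction (trans (sym (trans (upper-edge S (h t)) (T⇒1 (inside t χt)))) eq) λ ()

  count-+ : ∀ {A : Set} (p q r s : A → Bool) → (∀ x → ⟦ p x ⟧ + ⟦ q x ⟧ ≡ ⟦ r x ⟧ + ⟦ s x ⟧) →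
    ∀ xs → count p xs + count q xs ≡ count r xs + count s xs
  count-+ p q r s h [] = refl
  count-+ p q r s h (x ∷ xs) = trans (cong₂ _+_ (step p) (step q)) (trans (shuffle ⟦ p x ⟧ ⟦ q x ⟧ (count p xs) (count q xs))
      (trans (cong₂ _+_ (h x) (count-+ p q r s h xs)) (trans (sym (shuffle ⟦ r x ⟧ ⟦ s x ⟧ (count r xs) (count s xs))) (sym (cong₂ _+_ (step r) (step s))))))
    where
    step : ∀ t → count t (x ∷ xs) ≡ ⟦ t x ⟧ + count t xs
    step t with t x
    ... | true  = refl
    ... | false = refl
    shuffle : ∀ a b c d → (a + c) + (b + d) ≡ (a + b) + (c + d)
    shuffle = solve-∀

  ∣∣-+ : ∀ (p q r s : EdgeSet n) → (∀ e → ⟦ p e ⟧ + ⟦ q e ⟧ ≡ ⟦ r e ⟧ + ⟦ s e ⟧) → ∣ p ∣ + ∣ q ∣ ≡ ∣ r ∣ + ∣ s ∣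
  ∣∣-+ p q r s h = count-+ p q r s h (allEdges _)

  ∣∣-cong : ∀ {p q : EdgeSet n} → (∀ e → p e ≡ q e) → ∣ p ∣ ≡ ∣ q ∣
  ∣∣-cong {p = p} {q} h = *-cancelʳ-≡ _ _ 2 (trans (dbl ∣ p ∣) (trans (∣∣-+ p p q q λ e → cong₂ _+_ (cong ⟦_⟧ (h e)) (cong ⟦_⟧ (h e))) (sym (dbl ∣ q ∣))))
    where
    dbl : ∀ x → x * 2 ≡ x + x
    dbl = solve-∀

  everything : EdgeSet n
  everything _ = true

  inside : ℕ → EdgeSet n
  inside a e = (toℕ (lo e) <ᵇ a) ∧ (toℕ (hi e) <ᵇ a)

  sum-<ᵇ : ∀ n a → a ≤ n → (∑[ i < n ] ⟦ toℕ i <ᵇ a ⟧) ≡ a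
  sum-<ᵇ n zero _ = sum-zero {n} λ i → refl
  sum-<ᵇ (suc n) (suc a) (s≤s le) = cong suc (sum-<ᵇ n a le)

  -- The adjacency matrix of the clique plus its diagonal is the rank-one matrix w i * w j; summing
  -- all entries gives a * a. The form avoids both halving and subtraction.
  ∣inside∣ : ∀ n a → a ≤ n → ∣ inside {n} a ∣ + ∣ inside {n} a ∣ + a ≡ a * a
  ∣inside∣ n a a≤n = begin-equality
    ∣ I ∣ + ∣ I ∣ + a                                            ≡⟨ cong₂ _+_ (handshake I) (sum-<ᵇ n a a≤n) ⟨
    (∑[ i < n ] ∑[ j < n ] adj I i j) + (∑[ i < n ] w i)         ≡⟨ ∑-distrib-+ (λ i → ∑[ j < n ] adj I i j) w ⟨
    (∑[ i < n ] ((∑[ j < n ] adj I i j) + w i))                  ≡⟨ sum-cong-≗ row ⟩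
    (∑[ i < n ] w i * sum w)                                     ≡⟨ *-distribʳ-sum (sum w) w ⟨
    sum w * sum w                                                ≡⟨ cong₂ _*_ (sum-<ᵇ n a a≤n) (sum-<ᵇ n a a≤n) ⟩
    a * a                                                        ∎
    where
    open ≤-Reasoning
    I : EdgeSet n
    I = inside a
    w : Fin n → ℕ
    w i = ⟦ toℕ i <ᵇ a ⟧
    ⟦∧⟧ : ∀ b c → ⟦ b ∧ c ⟧ ≡ ⟦ b ⟧ * ⟦ c ⟧
    ⟦∧⟧ true  c = sym (+-identityʳ _)
    ⟦∧⟧ false c = refl
    idem : ∀ b → ⟦ b ⟧ ≡ ⟦ b ⟧ * ⟦ b ⟧
    idem true  = refl
    idem false = refl
    entry : ∀ i j → adj I i j + δ i j * w j ≡ w i * w j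
    entry i j with <ᶠ-cmp i j
    ... | tri< _ i≢j _ = trans (cong₂ _+_ (⟦∧⟧ (toℕ i <ᵇ a) (toℕ j <ᵇ a)) (cong (_* w j) (δ-≢ i≢j))) (+-identityʳ _)
    ... | tri> _ i≢j _ = trans (cong₂ _+_ (trans (⟦∧⟧ (toℕ j <ᵇ a) (toℕ i <ᵇ a)) (*-comm (w j) _)) (cong (_* w j) (δ-≢ i≢j))) (+-identityʳ _)
    ... | tri≈ _ refl _ = trans (cong (_* w i) (δ-refl i)) (trans (+-identityʳ _) (idem (toℕ i <ᵇ a)))
    row : ∀ i → (∑[ j < n ] adj I i j) + w i ≡ w i * sum w
    row i = trans (cong ((∑[ j < n ] adj I i j) +_) (sym (sum-δ i w)))
      (trans (sym (∑-distrib-+ (adj I i) (λ j → δ i j * w j)))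
        (trans (sum-cong-≗ (entry i)) (sym (*-distribˡ-sum (w i) w))))

  2*nC2 : ∀ n → (n C 2) + (n C 2) + n ≡ n * n
  2*nC2 zero = refl
  2*nC2 (suc n) = begin-equality
    (suc n C 2) + (suc n C 2) + suc n        ≡⟨ cong (λ t → t + t + suc n) (trans (sym (nCk+nC[k+1]≡[n+1]C[k+1] n 1)) (cong (_+ (n C 2)) (nC1≡n n))) ⟩
    n + (n C 2) + (n + (n C 2)) + suc n      ≡⟨ r n (n C 2) ⟩
    (n C 2) + (n C 2) + n + suc (n + n)      ≡⟨ cong (_+ suc (n + n)) (2*nC2 n) ⟩
    n * n + suc (n + n)                      ≡⟨ r′ n ⟩
    suc n * suc n                            ∎
    where
    open ≤-Reasoning
    r : ∀ n c → n + c + (n + c) + suc n ≡ c + c + n + suc (n + n)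
    r = solve-∀
    r′ : ∀ n → n * n + suc (n + n) ≡ suc n * suc n
    r′ = solve-∀

  ∣everything∣ : ∀ n → ∣ everything {n} ∣ ≡ n C 2
  ∣everything∣ n = halve-≡ (+-cancelʳ-≡ n _ _ (trans (trans (cong (λ t → t + t + n) (∣∣-cong all)) (∣inside∣ n n ≤-refl)) (sym (2*nC2 n))))
    where
    halve-≡ : ∀ {a b} → a + a ≡ b + b → a ≡ b
    halve-≡ {a} {b} eq = *-cancelʳ-≡ a b 2 (trans (dbl a) (trans eq (sym (dbl b))))
      where
      dbl : ∀ x → x * 2 ≡ x + x
      dbl = solve-∀
    all : ∀ e → true ≡ inside n e
    all e with toℕ (lo e) <ᵇ n | toℕ<ᵇ (lo e) | toℕ (hi e) <ᵇ n | toℕ<ᵇ (hi e)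
      where
      open import Data.Fin.Properties using (toℕ<n)
      toℕ<ᵇ : ∀ (i : Fin n) → T (toℕ i <ᵇ n)
      toℕ<ᵇ i = <⇒<ᵇ (toℕ<n i)
    ... | true | _ | true | _ = refl

-- Graphs in which any five vertices span at most four edges

module SparseGraphs where

  open import Data.Empty using (⊥)
  open import Data.Fin.Base using (Fin; zero; suc)
  open import Data.Fin.Properties using (any?) renaming (_≟_ to _≟ᶠ_)
  open import Data.Nat.Base
  open import Data.Nat.Properties
  open import Data.Nat.Divisibility
  open import Data.Nat.Tactic.RingSolver
  open import Data.Product.Base using (∃; _×_; _,_; proj₁; proj₂)
  open import Data.Sum.Base using (_⊎_; inj₁; inj₂)
  open import Data.Vec.Base using (Vec; []; _∷_)
  open import Data.Vec.Relation.Unary.Unique.Propositional using (Unique; []; _∷_)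
  open import Data.Vec.Relation.Unary.All using ([]; _∷_)
  open import Relation.Binary.PropositionalEquality
  open import Relation.Nullary
  open EdgeCounting

  private
    -- Once s, x, y are ordered and written as the smallest plus increments, the difference of the
    -- two sides is a polynomial with nonnegative coefficients, except for x ≤ s ≤ y: there a term
    -- -x²αβ remains, which x²(α² + β²) outweighs.
    amgm-ordered : ∀ s x y → x ≤ y → 3 * (s * s * (x * y)) ≤ x * y * (x * y) + s * s * s * (x + y)
    amgm-ordered s x y x≤y with ≤-total s x | ≤-total s y
    ... | inj₁ s≤x | _ = subst₂ P (m+[n∸m]≡n s≤x) (m+[n∸m]≡n (≤-trans s≤x x≤y)) (go s (x ∸ s) (y ∸ s))
      where
      P : ℕ → ℕ → Set
      P x y = 3 * (s * s * (x * y)) ≤ x * y * (x * y) + s * s * s * (x + y)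
      identity : ∀ s α β → (s + α) * (s + β) * ((s + α) * (s + β)) + s * s * s * ((s + α) + (s + β)) ≡
        3 * (s * s * ((s + α) * (s + β))) +
        (s * s * (α * α + α * β + β * β) + 2 * s * (α * β) * (α + β) + α * α * (β * β))
      identity = solve-∀
      go : ∀ s α β → 3 * (s * s * ((s + α) * (s + β))) ≤ (s + α) * (s + β) * ((s + α) * (s + β)) + s * s * s * ((s + α) + (s + β))
      go s α β = subst (3 * (s * s * ((s + α) * (s + β))) ≤_) (sym (identity s α β)) (m≤m+n _ _)
    ... | inj₂ x≤s | inj₂ y≤s = subst₂ P (m+[n∸m]≡n x≤y) (trans (cong (_+ (s ∸ y)) (m+[n∸m]≡n x≤y)) (m+[n∸m]≡n y≤s)) (go x (y ∸ x) (s ∸ y))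
      where
      P : ℕ → ℕ → Set
      P y s = 3 * (s * s * (x * y)) ≤ x * y * (x * y) + s * s * s * (x + y)
      identity : ∀ x γ β → x * (x + γ) * (x * (x + γ)) + (x + γ + β) * (x + γ + β) * (x + γ + β) * (x + (x + γ)) ≡
        3 * ((x + γ + β) * (x + γ + β) * (x * (x + γ))) +
        (x * x * (γ * γ + 3 * (γ * β) + 3 * (β * β)) + (2 * x + γ) * ((γ + β) * (γ + β) * (γ + β)))
      identity = solve-∀
      go : ∀ x γ β → 3 * ((x + γ + β) * (x + γ + β) * (x * (x + γ))) ≤
        x * (x + γ) * (x * (x + γ)) + (x + γ + β) * (x + γ + β) * (x + γ + β) * (x + (x + γ))
      go x γ β = subst (3 * ((x + γ + β) * (x + γ + β) * (x * (x + γ))) ≤_) (sym (identity x γ β)) (m≤m+n _ _)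
    ... | inj₂ x≤s | inj₁ s≤y = subst₂ P (m+[n∸m]≡n x≤s) (trans (cong (_+ (y ∸ s)) (m+[n∸m]≡n x≤s)) (m+[n∸m]≡n s≤y)) (go x (s ∸ x) (y ∸ s))
      where
      P : ℕ → ℕ → Set
      P s y = 3 * (s * s * (x * y)) ≤ x * y * (x * y) + s * s * s * (x + y)
      identity : ∀ x β α → (x * (x + β + α) * (x * (x + β + α)) + (x + β) * (x + β) * (x + β) * (x + (x + β + α))) + x * x * (α * β) ≡
        (3 * ((x + β) * (x + β) * (x * (x + β + α))) + (β * β * β * (β + 2 * x + α))) + x * x * (α * α + β * β)
      identity = solve-∀
      αβ≤ : ∀ α β → α * β ≤ α * α + β * β
      αβ≤ α β with ≤-total α β
      ... | inj₁ α≤β = ≤-trans (*-monoˡ-≤ β α≤β) (m≤n+m (β * β) (α * α))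
      ... | inj₂ β≤α = ≤-trans (*-monoʳ-≤ α β≤α) (m≤m+n (α * α) (β * β))
      go : ∀ x β α → 3 * ((x + β) * (x + β) * (x * (x + β + α))) ≤
        x * (x + β + α) * (x * (x + β + α)) + (x + β) * (x + β) * (x + β) * (x + (x + β + α))
      go x β α = +-cancelʳ-≤ (x * x * (α * β)) _ _ (begin
        L + x * x * (α * β)                                  ≤⟨ +-mono-≤ (m≤m+n L Q) (*-monoʳ-≤ (x * x) (αβ≤ α β)) ⟩
        L + Q + x * x * (α * α + β * β)                      ≡⟨ identity x β α ⟨
        _                                                    ∎)
        where
        open ≤-Reasoning
        L = 3 * ((x + β) * (x + β) * (x * (x + β + α)))
        Q = β * β * β * (β + 2 * x + α)

  -- AM-GM for xy·xy, s³x, s³y; equality at x = y = s.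
  amgm : ∀ s x y → 3 * (s * s * (x * y)) ≤ x * y * (x * y) + s * s * s * (x + y)
  amgm s x y with ≤-total x y
  ... | inj₁ x≤y = amgm-ordered s x y x≤y
  ... | inj₂ y≤x = subst₂ (λ p q → 3 * (s * s * p) ≤ p * p + s * s * s * q) (*-comm y x) (+-comm y x) (amgm-ordered s y x y≤x)

  -- This is `amgm` divided by xy, that is 3s² ≤ xy + s³(1/x + 1/y), multiplied by a common
  -- denominator F; X and Y are F/x and F/y.
  amgm-recip : ∀ s x y {F X Y} → 1 ≤ x → 1 ≤ y → X * x ≡ F → Y * y ≡ F →
    3 * (s * s * F) ≤ F * (x * y) + s * s * s * (X + Y)
  amgm-recip s x@(suc _) y@(suc _) {F} {X} {Y} _ _ X≡ Y≡ = *-cancelʳ-≤ _ _ (x * y) (begin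
    3 * (s * s * F) * (x * y)                              ≡⟨ r₁ s F (x * y) ⟩
    F * (3 * (s * s * (x * y)))                            ≤⟨ *-monoʳ-≤ F (amgm s x y) ⟩
    F * (x * y * (x * y) + s * s * s * (x + y))            ≡⟨ r₂ F (x * y) (s * s * s) x y ⟩
    F * (x * y) * (x * y) + s * s * s * (F * y + F * x)    ≡⟨ cong (λ t → F * (x * y) * (x * y) + s * s * s * t) (cong₂ _+_ (cong (_* y) (sym X≡)) (cong (_* x) (sym Y≡))) ⟩
    F * (x * y) * (x * y) + s * s * s * (X * x * y + Y * y * x)  ≡⟨ r₃ F (s * s * s) X Y x y ⟩
    (F * (x * y) + s * s * s * (X + Y)) * (x * y)          ∎)
    where
    open ≤-Reasoning
    r₁ : ∀ s F p → 3 * (s * s * F) * p ≡ F * (3 * (s * s * p))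
    r₁ = solve-∀
    r₂ : ∀ F p c x y → F * (p * p + c * (x + y)) ≡ F * p * p + c * (F * y + F * x)
    r₂ = solve-∀
    r₃ : ∀ F c X Y x y → F * (x * y) * (x * y) + c * (X * x * y + Y * y * x) ≡ (F * (x * y) + c * (X + Y)) * (x * y)
    r₃ = solve-∀

  -- Written in the order and bracketing of `sum-pair`, so that the two agree by computation.
  pairs₅ : ∀ {n} → (Fin n → Fin n → ℕ) → Vec (Fin n) 5 → ℕ
  pairs₅ a (p ∷ q ∷ x ∷ y ∷ z ∷ []) =
    a p q + (a p x + (a p y + (a p z + (a q x + (a q y + (a q z + (a x y + (a x z + (a y z + 0)))))))))

  module SparseGraph {n : ℕ} (a : Fin n → Fin n → ℕ)
    (a-sym : ∀ i j → a i j ≡ a j i) (a≤1 : ∀ i j → a i j ≤ 1) (a-irr : ∀ {i j} → 1 ≤ a i j → i ≢ j)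
    (sparse : ∀ vs → Unique vs → pairs₅ a vs ≤ 4) where

    d : Fin n → ℕ
    d u = sum (a u)

    D₂ : Fin n → ℕ
    D₂ u = ∑[ w < n ] a u w * d w

    private
      flip-a : ∀ {i j} → 1 ≤ a i j → 1 ≤ a j i
      flip-a {i} {j} = subst (1 ≤_) (a-sym i j)

      either : Fin n → Fin n → Fin n → ℕ
      either u v w = a u w ⊔ a v w

      either≤1 : ∀ u v w → either u v w ≤ 1
      either≤1 u v w = ⊔-lub (a≤1 u w) (a≤1 v w)

      either-cases : ∀ u v w → 1 ≤ either u v w → 1 ≤ a u w ⊎ 1 ≤ a v w
      either-cases u v w h with ⊔-sel (a u w) (a v w)
      ... | inj₁ eq = inj₁ (subst (1 ≤_) eq h)
      ... | inj₂ eq = inj₂ (subst (1 ≤_) eq h)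

      +≡⊔+* : ∀ x y → x ≤ 1 → y ≤ 1 → x + y ≡ x ⊔ y + x * y
      +≡⊔+* 0 0 _ _ = refl
      +≡⊔+* 0 1 _ _ = refl
      +≡⊔+* 1 0 _ _ = refl
      +≡⊔+* 1 1 _ _ = refl
      +≡⊔+* (suc (suc _)) _ (s≤s ()) _
      +≡⊔+* 0 (suc (suc _)) _ (s≤s ())
      +≡⊔+* 1 (suc (suc _)) _ (s≤s ())

      1≤*ˡ : ∀ {x y} → 1 ≤ x * y → 1 ≤ x
      1≤*ˡ {suc x} _ = s≤s z≤n

      1≤*ʳ : ∀ {x y} → 1 ≤ x * y → 1 ≤ y
      1≤*ʳ {x} {y} h = 1≤*ˡ {y} {x} (subst (1 ≤_) (*-comm x y) h)

      infixr 6 _⊕_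
      _⊕_ : ∀ {i j k l} → i ≤ j → k ≤ l → i + k ≤ j + l
      _⊕_ = +-mono-≤

      0≤ : ∀ x → 0 ≤ x
      0≤ _ = z≤n

      five≰4 : ¬ 5 ≤ 4
      five≰4 (s≤s (s≤s (s≤s (s≤s ()))))

    -- u, v, x, w, w′ would span the five edges uv, xw, xw′ and one edge from each of w, w′ to {u, v}.
    no-five : ∀ {u v x w w′} → 1 ≤ a u v → x ≢ u → x ≢ v → w ≢ u → w ≢ v → w′ ≢ u → w′ ≢ v → w ≢ w′ →
      1 ≤ either u v w → 1 ≤ a w x → 1 ≤ either u v w′ → 1 ≤ a w′ x → ⊥
    no-five {u} {v} {x} {w} {w′} uv x≢u x≢v w≢u w≢v w′≢u w′≢v w≢w′ ew wx ew′ w′x =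
      contradiction (≤-trans five (sparse (u ∷ v ∷ x ∷ w ∷ w′ ∷ []) distinct)) five≰4
      where
      distinct : Unique (u ∷ v ∷ x ∷ w ∷ w′ ∷ [])
      distinct = (a-irr uv ∷ ≢-sym x≢u ∷ ≢-sym w≢u ∷ ≢-sym w′≢u ∷ []) ∷
        (≢-sym x≢v ∷ ≢-sym w≢v ∷ ≢-sym w′≢v ∷ []) ∷
        (≢-sym (a-irr wx) ∷ ≢-sym (a-irr w′x) ∷ []) ∷ (w≢w′ ∷ []) ∷ [] ∷ []
      five : 5 ≤ pairs₅ a (u ∷ v ∷ x ∷ w ∷ w′ ∷ [])
      five with either-cases u v w ew | either-cases u v w′ ew′
      ... | inj₁ p | inj₁ q = uv ⊕ 0≤ (a u x) ⊕ p ⊕ q ⊕ 0≤ (a v x) ⊕ 0≤ (a v w) ⊕ 0≤ (a v w′) ⊕ flip-a wx ⊕ flip-a w′x ⊕ z≤n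
      ... | inj₁ p | inj₂ q = uv ⊕ 0≤ (a u x) ⊕ p ⊕ 0≤ (a u w′) ⊕ 0≤ (a v x) ⊕ 0≤ (a v w) ⊕ q ⊕ flip-a wx ⊕ flip-a w′x ⊕ z≤n
      ... | inj₂ p | inj₁ q = uv ⊕ 0≤ (a u x) ⊕ 0≤ (a u w) ⊕ q ⊕ 0≤ (a v x) ⊕ p ⊕ 0≤ (a v w′) ⊕ flip-a wx ⊕ flip-a w′x ⊕ z≤n
      ... | inj₂ p | inj₂ q = uv ⊕ 0≤ (a u x) ⊕ 0≤ (a u w) ⊕ 0≤ (a u w′) ⊕ 0≤ (a v x) ⊕ p ⊕ q ⊕ flip-a wx ⊕ flip-a w′x ⊕ z≤n

    -- A triangle with two pendant edges at one corner has five edges on five vertices. Hence a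
    -- common neighbor of u and v has degree at most 3, see `apex-≤`.
    no-five-triangle : ∀ {u v w x x′} → 1 ≤ a u v → 1 ≤ a u w → 1 ≤ a v w → 1 ≤ a w x → 1 ≤ a w x′ →
      x ≢ u → x ≢ v → x′ ≢ u → x′ ≢ v → x ≢ x′ → ⊥
    no-five-triangle {u} {v} {w} {x} {x′} uv uw vw wx wx′ x≢u x≢v x′≢u x′≢v x≢x′ =
      contradiction (≤-trans (uv ⊕ uw ⊕ 0≤ (a u x) ⊕ 0≤ (a u x′) ⊕ vw ⊕ 0≤ (a v x) ⊕ 0≤ (a v x′) ⊕ wx ⊕ wx′ ⊕ z≤n)
        (sparse (u ∷ v ∷ w ∷ x ∷ x′ ∷ []) distinct)) five≰4
      where
      distinct : Unique (u ∷ v ∷ w ∷ x ∷ x′ ∷ [])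
      distinct = (a-irr uv ∷ a-irr uw ∷ ≢-sym x≢u ∷ ≢-sym x′≢u ∷ []) ∷
        (a-irr vw ∷ ≢-sym x≢v ∷ ≢-sym x′≢v ∷ []) ∷
        (a-irr wx ∷ a-irr wx′ ∷ []) ∷ (x≢x′ ∷ []) ∷ [] ∷ []

    sum-mask₂ : ∀ u v (f : Fin n → ℕ) → sum f ≤ f u + (f v + sum (mask v (mask u f)))
    sum-mask₂ u v f = ≤-trans (sum-mask u f) (+-monoʳ-≤ (f u)
      (≤-trans (sum-mask v (mask u f)) (+-monoˡ-≤ _ (mask-≤ u f v))))

    mask₂-≢ : ∀ u v (f : Fin n → ℕ) {i} → 1 ≤ mask v (mask u f) i → i ≢ u × i ≢ v × 1 ≤ f i
    mask₂-≢ u v f {i} h with mask-≢ v (mask u f) h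
    ... | v≢i , eq with mask-≢ u f (subst (1 ≤_) eq h)
    ...   | u≢i , eq′ = ≢-sym u≢i , ≢-sym v≢i , subst (1 ≤_) (trans eq eq′) h

    mask₂-≤ : ∀ u v (f : Fin n → ℕ) i → mask v (mask u f) i ≤ f i
    mask₂-≤ u v f i = ≤-trans (mask-≤ v (mask u f) i) (mask-≤ u f i)

    sum-mask₂≤1 : ∀ u v (f : Fin n → ℕ) → (∀ i → f i ≤ 1) →
      (∀ {i j} → i ≢ u → i ≢ v → j ≢ u → j ≢ v → 1 ≤ f i → 1 ≤ f j → i ≢ j → ⊥) →
      sum f ≤ f u + (f v + 1)
    sum-mask₂≤1 u v f f≤1 unique = ≤-trans (sum-mask₂ u v f) (+-monoʳ-≤ (f u) (+-monoʳ-≤ (f v)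
      (sum≤1 (mask v (mask u f)) (λ i → ≤-trans (mask₂-≤ u v f i) (f≤1 i)) unique′)))
      where
      unique′ : ∀ i j → 1 ≤ mask v (mask u f) i → 1 ≤ mask v (mask u f) j → i ≡ j
      unique′ i j p q with i ≟ᶠ j | mask₂-≢ u v f p | mask₂-≢ u v f q
      ... | yes eq | _ | _ = eq
      ... | no ≢ | i≢u , i≢v , fi | j≢u , j≢v , fj = contradiction fj (λ fj → unique i≢u i≢v j≢u j≢v fi fj ≢)

    *≤ʳ : ∀ {x} y → x ≤ 1 → x * y ≤ y
    *≤ʳ y x≤1 = ≤-trans (*-monoˡ-≤ y x≤1) (≤-reflexive (+-identityʳ y))

    -- The terms w = u and w = v account for a u x and a v x; two further ones would give the five
    -- edges excluded by `no-five`.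
    common-≤ : ∀ {u v x} → 1 ≤ a u v → x ≢ u → x ≢ v →
      (∑[ w < n ] either u v w * a w x) ≤ a u x + (a v x + 1)
    common-≤ {u} {v} {x} uv x≢u x≢v = ≤-trans
      (sum-mask₂≤1 u v (λ w → either u v w * a w x) (λ w → *-mono-≤ (either≤1 u v w) (a≤1 w x))
        λ i≢u i≢v j≢u j≢v fi fj i≢j → no-five uv x≢u x≢v i≢u i≢v j≢u j≢v i≢j
          (1≤*ˡ fi) (1≤*ʳ {either u v _} fi) (1≤*ˡ fj) (1≤*ʳ {either u v _} fj))
      (+-mono-≤ (*≤ʳ (a u x) (either≤1 u v u)) (+-monoˡ-≤ 1 (*≤ʳ (a v x) (either≤1 u v v))))

    apex-≤ : ∀ {u v} w → 1 ≤ a u v → a u w * a v w * d w ≤ 3 * a u w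
    apex-≤ {u} {v} w uv with a u w in equ | a v w in eqv
    ... | zero  | _ = z≤n
    ... | suc m | zero = ≤-trans (≤-reflexive (cong (_* d w) (*-zeroʳ m))) z≤n
    ... | suc m | suc l = begin
      suc m * suc l * d w     ≤⟨ *≤ʳ (d w) (*-mono-≤ (subst (_≤ 1) equ (a≤1 u w)) (subst (_≤ 1) eqv (a≤1 v w))) ⟩
      d w                     ≤⟨ sum-mask₂≤1 u v (a w) (a≤1 w) (λ x≢u x≢v x′≢u x′≢v wx wx′ → no-five-triangle uv uw vw wx wx′ x≢u x≢v x′≢u x′≢v) ⟩
      a w u + (a w v + 1)     ≤⟨ +-mono-≤ (a≤1 w u) (+-monoˡ-≤ 1 (a≤1 w v)) ⟩
      3                       ≤⟨ *-monoʳ-≤ 3 (s≤s (z≤n {m})) ⟩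
      3 * suc m               ∎
      where
      open ≤-Reasoning
      uw : 1 ≤ a u w
      uw = subst (1 ≤_) (sym equ) (s≤s z≤n)
      vw : 1 ≤ a v w
      vw = subst (1 ≤_) (sym eqv) (s≤s z≤n)

    -- Common neighbors of u and v are counted twice on the left; the second count is split off and
    -- costs 3 d(u), as they have degree at most 3. What is left counts paths w x with w next to u
    -- or v, sorted by their end x: one for each x up to the corrections a u x + a v x, and at most
    -- d(u) and d(v) for x = u and x = v.
    edge-bound : ∀ {u v} → 1 ≤ a u v → D₂ u + D₂ v ≤ n + 5 * (d u + d v)
    edge-bound {u} {v} uv = begin
      D₂ u + D₂ v                                                      ≡⟨ ∑-distrib-+ (λ w → a u w * d w) (λ w → a v w * d w) ⟨
      (∑[ w < n ] (a u w * d w + a v w * d w))                         ≡⟨ sum-cong-≗ (λ w → trans (sym (*-distribʳ-+ (d w) (a u w) (a v w)))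
                                                                            (trans (cong (_* d w) (+≡⊔+* (a u w) (a v w) (a≤1 u w) (a≤1 v w)))
                                                                              (*-distribʳ-+ (d w) (either u v w) (a u w * a v w)))) ⟩
      (∑[ w < n ] (either u v w * d w + a u w * a v w * d w))          ≡⟨ ∑-distrib-+ (λ w → either u v w * d w) (λ w → a u w * a v w * d w) ⟩
      (∑[ w < n ] either u v w * d w) + (∑[ w < n ] a u w * a v w * d w) ≤⟨ +-mono-≤ reach (≤-trans (sum-mono λ w → apex-≤ w uv) (≤-reflexive (sym (*-distribˡ-sum 3 (a u))))) ⟩
      d u + (d v + (d u + (d v + n))) + 3 * d u                        ≤⟨ m≤m+n _ (3 * d v) ⟩
      d u + (d v + (d u + (d v + n))) + 3 * d u + 3 * d v              ≡⟨ collect n (d u) (d v) ⟩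
      n + 5 * (d u + d v)                                              ∎
      where
      open ≤-Reasoning
      collect : ∀ n x y → x + (y + (x + (y + n))) + 3 * x + 3 * y ≡ n + 5 * (x + y)
      collect = solve-∀
      g : Fin n → ℕ
      g x = ∑[ w < n ] either u v w * a w x
      g≤d : ∀ x → g x ≤ d x
      g≤d x = sum-mono λ w → ≤-trans (*≤ʳ (a w x) (either≤1 u v w)) (≤-reflexive (a-sym w x))
      g-masked : ∀ x → mask v (mask u g) x ≤ a u x + (a v x + 1)
      g-masked x with mask v (mask u g) x in eq
      ... | zero = z≤n
      ... | suc m = let x≢u , x≢v , _ = mask₂-≢ u v g (subst (1 ≤_) (sym eq) (s≤s z≤n))
                    in subst (_≤ a u x + (a v x + 1)) eq (≤-trans (mask₂-≤ u v g x) (common-≤ uv x≢u x≢v))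
      reach : (∑[ w < n ] either u v w * d w) ≤ d u + (d v + (d u + (d v + n)))
      reach = begin
        (∑[ w < n ] either u v w * d w)                  ≡⟨ sum-cong-≗ (λ w → *-distribˡ-sum (either u v w) (a w)) ⟩
        (∑[ w < n ] ∑[ x < n ] either u v w * a w x)     ≡⟨ ∑-comm (λ w x → either u v w * a w x) ⟩
        sum g                                            ≤⟨ sum-mask₂ u v g ⟩
        g u + (g v + sum (mask v (mask u g)))            ≤⟨ +-mono-≤ (g≤d u) (+-mono-≤ (g≤d v) (sum-mono g-masked)) ⟩
        d u + (d v + (∑[ x < n ] (a u x + (a v x + 1))))  ≡⟨ cong (λ t → d u + (d v + t)) (trans (∑-distrib-+ (a u) (λ x → a v x + 1))
                                                              (cong (d u +_) (trans (∑-distrib-+ (a v) (λ _ → 1)) (cong (d v +_) (trans (sum-const n 1) (*-identityʳ n)))))) ⟩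
        d u + (d v + (d u + (d v + n)))                  ∎

    d≤n : ∀ u → d u ≤ n
    d≤n u = ≤-trans (sum-mono (a≤1 u)) (≤-reflexive (trans (sum-const n 1) (*-identityʳ n)))

    D₂≤ : ∀ u → D₂ u ≤ 11 * n
    D₂≤ u with any? (λ v → 1 ≤? a u v)
    ... | yes (v , uv) = begin
      D₂ u                      ≤⟨ m≤m+n (D₂ u) (D₂ v) ⟩
      D₂ u + D₂ v               ≤⟨ edge-bound uv ⟩
      n + 5 * (d u + d v)       ≤⟨ +-monoʳ-≤ n (*-monoʳ-≤ 5 (+-mono-≤ (d≤n u) (d≤n v))) ⟩
      n + 5 * (n + n)           ≡⟨ collect n ⟩
      11 * n                    ∎
      where
      open ≤-Reasoning
      collect : ∀ n → n + 5 * (n + n) ≡ 11 * n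
      collect = solve-∀
    ... | no isolated = subst (_≤ 11 * n) (sym (sum-zero λ w →
            cong (_* d w) (n<1⇒n≡0 (≰⇒> λ uw → isolated (w , uw))))) z≤n

    sum-D₂ : sum D₂ ≡ (∑[ w < n ] d w * d w)
    sum-D₂ = trans (∑-comm (λ u w → a u w * d w)) (sum-cong-≗ λ w →
      trans (sym (*-distribʳ-sum (d w) (λ u → a u w))) (cong (_* d w) (sum-cong-≗ λ u → a-sym u w)))

    -- Crude, but of lower order than the product n * m next to which it appears when m is near
    -- n^(3/2). Both Σ d² and Σ D₂ count walks of length two.
    sum-d² : (∑[ w < n ] d w * d w) ≤ n * (11 * n)
    sum-d² = ≤-trans (≤-reflexive (sym sum-D₂)) (≤-trans (sum-mono D₂≤) (≤-reflexive (sum-const n (11 * n))))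

    -- The sum of d(u) d(v) over ordered adjacent pairs, which is the number of walks of length
    -- three.
    W : ℕ
    W = ∑[ u < n ] d u * D₂ u

    -- Twice the number of edges.
    m : ℕ
    m = sum d

    edge-sum : ∀ (f : Fin n → ℕ) → (∑[ u < n ] ∑[ v < n ] a u v * (f u + f v)) ≡ (∑[ u < n ] d u * f u) + (∑[ u < n ] d u * f u)
    edge-sum f = begin-equality
      (∑[ u < n ] ∑[ v < n ] a u v * (f u + f v))                  ≡⟨ sum-cong-≗ (λ u → trans (sum-cong-≗ λ v → *-distribˡ-+ (a u v) (f u) (f v)) (∑-distrib-+ (λ v → a u v * f u) (λ v → a u v * f v))) ⟩
      (∑[ u < n ] ((∑[ v < n ] a u v * f u) + (∑[ v < n ] a u v * f v)))  ≡⟨ ∑-distrib-+ (λ u → ∑[ v < n ] a u v * f u) (λ u → ∑[ v < n ] a u v * f v) ⟩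
      (∑[ u < n ] ∑[ v < n ] a u v * f u) + (∑[ u < n ] ∑[ v < n ] a u v * f v)
        ≡⟨ cong₂ _+_ (sum-cong-≗ λ u → sym (*-distribʳ-sum (f u) (a u)))
            (trans (∑-comm (λ u v → a u v * f v)) (sum-cong-≗ λ v → trans (sym (*-distribʳ-sum (f v) (λ u → a u v))) (cong (_* f v) (sum-cong-≗ λ u → a-sym u v)))) ⟩
      (∑[ u < n ] d u * f u) + (∑[ u < n ] d u * f u)                ∎
      where open ≤-Reasoning

    a*-mono : ∀ u v {x y} → (1 ≤ a u v → x ≤ y) → a u v * x ≤ a u v * y
    a*-mono u v h with a u v
    ... | zero  = z≤n
    ... | suc k = *-monoʳ-≤ (suc k) (h (s≤s z≤n))

    pull : ∀ c (f : Fin n → Fin n → ℕ) → (∑[ u < n ] ∑[ v < n ] c * f u v) ≡ c * (∑[ u < n ] ∑[ v < n ] f u v)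
    pull c f = trans (sum-cong-≗ λ u → sym (*-distribˡ-sum c (f u))) (sym (*-distribˡ-sum c (λ u → sum (f u))))

    walks-≤ : W + W ≤ n * m + 110 * (n * n)
    walks-≤ = begin
      W + W                                                        ≡⟨ edge-sum D₂ ⟨
      (∑[ u < n ] ∑[ v < n ] a u v * (D₂ u + D₂ v))                ≤⟨ ∑∑-mono (λ u v → a*-mono u v edge-bound) ⟩
      (∑[ u < n ] ∑[ v < n ] a u v * (n + 5 * (d u + d v)))        ≡⟨ sum-cong-≗ (λ u → trans (sum-cong-≗ λ v → split (a u v) n (d u) (d v)) (∑-distrib-+ (λ v → n * a u v) (λ v → 5 * (a u v * (d u + d v))))) ⟩
      (∑[ u < n ] ((∑[ v < n ] n * a u v) + (∑[ v < n ] 5 * (a u v * (d u + d v)))))  ≡⟨ ∑-distrib-+ (λ u → ∑[ v < n ] n * a u v) (λ u → ∑[ v < n ] 5 * (a u v * (d u + d v))) ⟩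
      (∑[ u < n ] ∑[ v < n ] n * a u v) + (∑[ u < n ] ∑[ v < n ] 5 * (a u v * (d u + d v)))
        ≡⟨ cong₂ _+_ (pull n a) (trans (pull 5 (λ u v → a u v * (d u + d v))) (cong (5 *_) (edge-sum d))) ⟩
      n * m + 5 * ((∑[ u < n ] d u * d u) + (∑[ u < n ] d u * d u))  ≤⟨ +-monoʳ-≤ (n * m) (*-monoʳ-≤ 5 (+-mono-≤ sum-d² sum-d²)) ⟩
      n * m + 5 * (n * (11 * n) + n * (11 * n))                    ≡⟨ cong (n * m +_) (collect n) ⟩
      n * m + 110 * (n * n)                                        ∎
      where
      open ≤-Reasoning
      split : ∀ a n x y → a * (n + 5 * (x + y)) ≡ n * a + 5 * (a * (x + y))
      split = solve-∀
      collect : ∀ n → 5 * (n * (11 * n) + n * (11 * n)) ≡ 110 * (n * n)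
      collect = solve-∀

    -- n! stands in for 1, so that n!/d is a natural number.
    recip-d : ∀ k → k ≤ n → ∃ λ q → (1 ≤ k → q * k ≡ n !) × k * q ≤ n !
    recip-d zero _ = 0 , (λ ()) , z≤n
    recip-d (suc k) k<n with ∣-trans (m∣m*n {suc k} (k !)) (m≤n⇒m!∣n! k<n)
    ... | divides q eq = q , (λ _ → sym eq) , ≤-reflexive (trans (*-comm (suc k) q) (sym eq))

    q : Fin n → ℕ
    q u = proj₁ (recip-d (d u) (d≤n u))

    -- `amgm-recip` summed over ordered adjacent pairs with F = n!. In the sum of 1/d(u) + 1/d(v)
    -- every vertex of positive degree contributes 2, in total at most 2n.
    walks-≥ : ∀ s → 3 * (s * s * m) ≤ W + s * s * s * (n + n)
    walks-≥ s = *-cancelˡ-≤ (n !) {{n !≢0}} (begin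
      n ! * (3 * (s * s * m))                                       ≡⟨ r₁ (n !) (s * s) m ⟩
      3 * (s * s * n !) * m                                         ≡⟨ pull (3 * (s * s * n !)) a ⟨
      (∑[ u < n ] ∑[ v < n ] 3 * (s * s * n !) * a u v)             ≡⟨ sum-cong-≗ (λ u → sum-cong-≗ λ v → *-comm (3 * (s * s * n !)) (a u v)) ⟩
      (∑[ u < n ] ∑[ v < n ] a u v * (3 * (s * s * n !)))           ≤⟨ ∑∑-mono (λ u v → a*-mono u v λ uv → amgm-recip s (d u) (d v) {n !} {q u} {q v} (≤-trans uv (≤sum (a u) v)) (≤-trans (flip-a uv) (≤sum (a v) u))
                                                                         (proj₁ (proj₂ (recip-d (d u) (d≤n u))) (≤-trans uv (≤sum (a u) v)))
                                                                         (proj₁ (proj₂ (recip-d (d v) (d≤n v))) (≤-trans (flip-a uv) (≤sum (a v) u)))) ⟩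
      (∑[ u < n ] ∑[ v < n ] a u v * (n ! * (d u * d v) + s * s * s * (q u + q v)))
        ≡⟨ sum-cong-≗ (λ u → trans (sum-cong-≗ λ v → r₂ (a u v) (n !) (d u) (d v) (s * s * s) (q u + q v))
             (∑-distrib-+ (λ v → n ! * (d u * (a u v * d v))) (λ v → s * s * s * (a u v * (q u + q v))))) ⟩
      (∑[ u < n ] ((∑[ v < n ] n ! * (d u * (a u v * d v))) + (∑[ v < n ] s * s * s * (a u v * (q u + q v)))))
        ≡⟨ ∑-distrib-+ (λ u → ∑[ v < n ] n ! * (d u * (a u v * d v))) (λ u → ∑[ v < n ] s * s * s * (a u v * (q u + q v))) ⟩
      (∑[ u < n ] ∑[ v < n ] n ! * (d u * (a u v * d v))) + (∑[ u < n ] ∑[ v < n ] s * s * s * (a u v * (q u + q v)))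
        ≡⟨ cong₂ _+_ (trans (pull (n !) (λ u v → d u * (a u v * d v))) (cong (n ! *_) (sum-cong-≗ λ u → sym (*-distribˡ-sum (d u) (λ v → a u v * d v)))))
             (trans (pull (s * s * s) (λ u v → a u v * (q u + q v))) (cong (s * s * s *_) (edge-sum q))) ⟩
      n ! * W + s * s * s * ((∑[ u < n ] d u * q u) + (∑[ u < n ] d u * q u))  ≤⟨ +-monoʳ-≤ (n ! * W) (*-monoʳ-≤ (s * s * s) (+-mono-≤ dq dq)) ⟩
      n ! * W + s * s * s * (n * n ! + n * n !)                     ≡⟨ r₃ (n !) W (s * s * s) n ⟩
      n ! * (W + s * s * s * (n + n))                               ∎)
      where
      open ≤-Reasoning
      r₁ : ∀ F s m → F * (3 * (s * m)) ≡ 3 * (s * F) * m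
      r₁ = solve-∀
      r₂ : ∀ a F x y c z → a * (F * (x * y) + c * z) ≡ F * (x * (a * y)) + c * (a * z)
      r₂ = solve-∀
      r₃ : ∀ F W c n → F * W + c * (n * F + n * F) ≡ F * (W + c * (n + n))
      r₃ = solve-∀
      dq : (∑[ u < n ] d u * q u) ≤ n * n !
      dq = ≤-trans (sum-mono λ u → proj₂ (proj₂ (recip-d (d u) (d≤n u)))) (≤-reflexive (sum-const n (n !)))

    -- For s near √(n/2), the degree at which AM-GM is tight. Twice `walks-≥` against `walks-≤`
    -- gives 6s²m ≤ nm + 110n² + 4s³n; by n ≤ 2s² the term nm is absorbed on the left, and 110n² ≤
    -- 4s² · 55n is the origin of 55.
    degree-sum-≤ : ∀ s → n ≤ 2 * (s * s) → m ≤ n * (s + 55)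
    degree-sum-≤ zero n≤ rewrite n≤0⇒n≡0 n≤ = z≤n
    degree-sum-≤ s@(suc _) n≤ = *-cancelˡ-≤ (4 * (s * s)) (+-cancelˡ-≤ (2 * (s * s) * m) _ _ (begin
      2 * (s * s) * m + 4 * (s * s) * m                              ≡⟨ r₁ (s * s) m ⟩
      3 * (s * s * m) + 3 * (s * s * m)                              ≤⟨ +-mono-≤ (walks-≥ s) (walks-≥ s) ⟩
      (W + s * s * s * (n + n)) + (W + s * s * s * (n + n))          ≡⟨ r₂ W (s * s * s) n ⟩
      (W + W) + 4 * (s * s * s) * n                                  ≤⟨ +-monoˡ-≤ (4 * (s * s * s) * n) walks-≤ ⟩
      n * m + 110 * (n * n) + 4 * (s * s * s) * n                    ≤⟨ +-monoˡ-≤ (4 * (s * s * s) * n) (+-mono-≤ (*-monoˡ-≤ m n≤) (*-monoʳ-≤ 110 (*-monoʳ-≤ n n≤))) ⟩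
      2 * (s * s) * m + 110 * (n * (2 * (s * s))) + 4 * (s * s * s) * n  ≡⟨ r₃ s m n ⟩
      2 * (s * s) * m + 4 * (s * s) * (n * (s + 55))                 ∎))
      where
      open ≤-Reasoning
      r₁ : ∀ s m → 2 * s * m + 4 * s * m ≡ 3 * (s * m) + 3 * (s * m)
      r₁ = solve-∀
      r₂ : ∀ W c n → (W + c * (n + n)) + (W + c * (n + n)) ≡ (W + W) + 4 * c * n
      r₂ = solve-∀
      r₃ : ∀ s m n → 2 * (s * s) * m + 110 * (n * (2 * (s * s))) + 4 * (s * s * s) * n ≡ 2 * (s * s) * m + 4 * (s * s) * (n * (s + 55))
      r₃ = solve-∀

-- Balanced copies of K₅ as embeddings with few forced edges

module BalancedCopies where

  open import Defs
  open import Data.Bool.Base using (Bool; true; false; T; _∧_; not)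
  open import Data.Bool.Properties using (T?)
  open import Data.Empty using (⊥-elim-irr)
  open import Data.Fin.Base using (Fin; zero; suc) renaming (_<_ to _<ᶠ_)
  open import Data.Fin.Properties using (any?; all?) renaming (<⇒≢ to <ᶠ⇒≢; _≟_ to _≟ᶠ_; _<?_ to _<ᶠ?_; <-cmp to <ᶠ-cmp; <-asym to <ᶠ-asym)
  open import Data.Fin.Patterns using (0F; 1F; 2F; 3F; 4F)
  open import Data.Integer.Base as ℤ using (+_)
  import Data.Integer.Properties as ℤₚ
  open import Data.Nat.Base renaming (∣_-_∣ to dist)
  open import Data.Nat.Properties
  open import Data.Product.Base using (∃; _×_; _,_)
  open import Data.Sum.Base using (_⊎_; inj₁; inj₂)
  open import Data.Unit.Base using (tt)
  open import Data.Vec.Base using ([]; _∷_; lookup)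
  open import Function.Base using (_∘_)
  open import Function.Bundles using (_⇔_; mk⇔; Equivalence)
  open import Function.Definitions using (Injective)
  open import Relation.Binary.Definitions using (tri<; tri≈; tri>)
  open import Relation.Binary.PropositionalEquality
  open import Relation.Nullary
  open import Relation.Nullary.Decidable using (_×-dec_; _→-dec_; map′; toWitness; fromWitness; True; ⌊_⌋)
  open import Relation.Nullary.Negation using (contradiction-irr)
  open EdgeCounting

  private variable
    n : ℕ

  _≟ᵉ_ : (e e′ : Edge n) → Dec (e ≡ e′)
  e ≟ᵉ e′ = map′ (λ (p , q) → edge-ext p q) (λ { refl → refl , refl }) (lo e ≟ᶠ lo e′ ×-dec hi e ≟ᶠ hi e′)

  abstract

    -- Abstract, so that goals about embeddings do not unfold into ten concrete edges; the lemmas of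
    -- this block are the interface, and `sum-pair` fixes the order.
    pair : Fin 10 → Edge 5
    pair = lookup (e 0F 1F ∷ e 0F 2F ∷ e 0F 3F ∷ e 0F 4F ∷ e 1F 2F ∷
                   e 1F 3F ∷ e 1F 4F ∷ e 2F 3F ∷ e 2F 4F ∷ e 3F 4F ∷ [])
      where
      e : ∀ (i j : Fin 5) {i<j : True (i <ᶠ? j)} → Edge 5
      e i j {i<j} = edge i j (toWitness i<j)

    pair-surjective : ∀ e → ∃ λ t → pair t ≡ e
    pair-surjective (edge i j i<j) with i <ᶠ? j
    ... | no ≮ = contradiction-irr i<j ≮
    ... | yes lt with toWitness {a? = all? λ i → all? λ j → i <ᶠ? j →-dec any? (λ t → lo (pair t) ≟ᶠ i ×-dec hi (pair t) ≟ᶠ j)} _ i j lt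
    ...   | t , p , q = t , edge-ext p q

    pair-injective : Injective _≡_ _≡_ pair
    pair-injective {t} {t′} eq = toWitness {a? = all? λ t → all? λ t′ → (pair t ≟ᵉ pair t′) →-dec (t ≟ᶠ t′)} _ t t′ eq

    pair-< : ∀ t → lo (pair t) <ᶠ hi (pair t)
    pair-< = toWitness {a? = all? λ t → lo (pair t) <ᶠ? hi (pair t)} _

    sum-pair : ∀ (g : Fin 5 → Fin 5 → ℕ) → (∑[ t < 10 ] g (lo (pair t)) (hi (pair t))) ≡
      g 0F 1F + (g 0F 2F + (g 0F 3F + (g 0F 4F + (g 1F 2F + (g 1F 3F + (g 1F 4F + (g 2F 3F + (g 2F 4F + (g 3F 4F + 0)))))))))
    sum-pair g = refl

  join-injective : ∀ {i j i′ j′ : Fin n} .(i≢j : i ≢ j) .(i′≢j′ : i′ ≢ j′) → join i j i≢j ≡ join i′ j′ i′≢j′ →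
    (i ≡ i′ × j ≡ j′) ⊎ (i ≡ j′ × j ≡ i′)
  join-injective {i = i} {j} {i′} {j′} i≢j i′≢j′ eq with <ᶠ-cmp i j | <ᶠ-cmp i′ j′
  ... | tri≈ _ i≡j _ | _ = ⊥-elim-irr (i≢j i≡j)
  ... | _ | tri≈ _ i≡j _ = ⊥-elim-irr (i′≢j′ i≡j)
  ... | tri< _ _ _ | tri< _ _ _ = inj₁ (cong lo eq , cong hi eq)
  ... | tri< _ _ _ | tri> _ _ _ = inj₂ (cong lo eq , cong hi eq)
  ... | tri> _ _ _ | tri< _ _ _ = inj₂ (cong hi eq , cong lo eq)
  ... | tri> _ _ _ | tri> _ _ _ = inj₁ (cong hi eq , cong lo eq)

  image-injective : ∀ {m} {f : Fin m → Fin n} (inj : Injective _≡_ _≡_ f) → Injective _≡_ _≡_ (image f inj)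
  image-injective {f = f} inj {edge i j i<j} {edge i′ j′ i′<j′} eq with join-injective (λ p → <ᶠ⇒≢ i<j (inj p)) (λ p → <ᶠ⇒≢ i′<j′ (inj p)) eq
  ... | inj₁ (p , q) = edge-ext (inj p) (inj q)
  ... | inj₂ (p , q) with inj p | inj q
  -- The reversed match contradicts the two orders. Their proofs are irrelevant, so i < j is decided
  -- anew.
  ...   | refl | refl with i <ᶠ? j
  ...     | yes lt = contradiction-irr i′<j′ (<ᶠ-asym lt)
  ...     | no ≮  = contradiction-irr i<j ≮

  -- No list is empty, so an edge that is not blue is red and nothing else.
  redOnly blueOnly both : ListColoring n → EdgeSet n
  redOnly L e  = not (blue L e)
  blueOnly L e = not (red L e)
  both L e     = red L e ∧ blue L e

  within : EdgeSet n → (Fin 5 → Fin n) → ℕ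
  within S f = ∑[ t < 10 ] adj S (f (lo (pair t))) (f (hi (pair t)))

  -- Ten edges divided with difference at most 1 are divided five and five. The two lemmas below
  -- show that an embedding with these bounds exists exactly when a balanced copy does, and the
  -- former can be decided by searching through f.
  record Good (L : ListColoring n) (f : Fin 5 → Fin n) : Set where
    constructor good
    field
      injective : Injective _≡_ _≡_ f
      redOnly≤  : within (redOnly L) f ≤ 5
      blueOnly≤ : within (blueOnly L) f ≤ 5

  within-image : ∀ (S : EdgeSet n) f (inj : Injective _≡_ _≡_ f) →
    within S f ≡ (∑[ t < 10 ] ⟦ S (image f inj (pair t)) ⟧)
  within-image S f inj = sum-cong-≗ λ t → adj-join S {f (lo (pair t))} {f (hi (pair t))} (neq t)
    where
    neq : ∀ t → f (lo (pair t)) ≢ f (hi (pair t))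
    neq t eq = <ᶠ⇒≢ (pair-< t) (inj eq)

  tally : ∀ {k} → (ColorList → Bool) → (Fin k → ColorList) → ℕ
  tally p c = sum (⟦_⟧ ∘ p ∘ c)

  onlyR onlyB : ColorList → Bool
  onlyR ⟨r⟩  = true
  onlyR ⟨b⟩  = false
  onlyR ⟨rb⟩ = false
  onlyB ⟨r⟩  = false
  onlyB ⟨b⟩  = true
  onlyB ⟨rb⟩ = false

  only-disjoint : ∀ {k} (c : Fin k → ColorList) → tally onlyR c + tally onlyB c ≤ k
  only-disjoint {k} c = begin
    tally onlyR c + tally onlyB c                       ≡⟨ ∑-distrib-+ (⟦_⟧ ∘ onlyR ∘ c) (⟦_⟧ ∘ onlyB ∘ c) ⟨
    (∑[ t < k ] (⟦ onlyR (c t) ⟧ + ⟦ onlyB (c t) ⟧))    ≤⟨ sum-mono (λ t → le (c t)) ⟩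
    (∑[ t < k ] 1)                                      ≡⟨ trans (sum-const k 1) (*-identityʳ k) ⟩
    k                                                   ∎
    where
    open ≤-Reasoning
    le : ∀ x → ⟦ onlyR x ⟧ + ⟦ onlyB x ⟧ ≤ 1
    le ⟨r⟩  = ≤-refl
    le ⟨b⟩  = ≤-refl
    le ⟨rb⟩ = z≤n

  data Allowed : ColorList → Bool → Set where
    r-red   : Allowed ⟨r⟩ true
    b-blue  : Allowed ⟨b⟩ false
    rb-red  : Allowed ⟨rb⟩ true
    rb-blue : Allowed ⟨rb⟩ false

  -- Greedy choice, one edge at a time: an edge with both colors becomes blue if the forced red
  -- edges after it already number r, and red otherwise. In the first case the bound on blue edges
  -- is `only-disjoint`.
  choose : ∀ {k} (c : Fin k → ColorList) r → tally onlyR c ≤ r → r + tally onlyB c ≤ k →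
    ∃ λ (χ : Fin k → Bool) → (∀ t → Allowed (c t) (χ t)) × sum (⟦_⟧ ∘ χ) ≡ r
  choose {zero} c zero _ _ = (λ ()) , (λ ()) , refl
  choose {suc k} c r R≤ ≤B with c zero in eq
  ... | ⟨r⟩ = first r R≤ ≤B
    where
    first : ∀ r → suc (tally onlyR (c ∘ suc)) ≤ r → r + tally onlyB (c ∘ suc) ≤ suc k →
      ∃ λ (χ : Fin (suc k) → Bool) → (∀ t → Allowed (c t) (χ t)) × sum (⟦_⟧ ∘ χ) ≡ r
    first (suc r) (s≤s R≤) (s≤s ≤B) with choose (c ∘ suc) r R≤ ≤B
    ... | χ , ok , sum≡ = (λ { zero → true ; (suc t) → χ t }) ,
      (λ { zero → subst (λ x → Allowed x true) (sym eq) r-red ; (suc t) → ok t }) , cong suc sum≡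
  ... | ⟨b⟩ with choose (c ∘ suc) r R≤ (s≤s⁻¹ (subst (_≤ suc k) (+-suc r _) ≤B))
  ...   | χ , ok , sum≡ = (λ { zero → false ; (suc t) → χ t }) ,
      (λ { zero → subst (λ x → Allowed x false) (sym eq) b-blue ; (suc t) → ok t }) , sum≡
  choose {suc k} c r R≤ ≤B | ⟨rb⟩ with tally onlyR (c ∘ suc) ≟ r
  ... | yes refl with choose (c ∘ suc) r ≤-refl (only-disjoint (c ∘ suc))
  ...   | χ , ok , sum≡ = (λ { zero → false ; (suc t) → χ t }) ,
      (λ { zero → subst (λ x → Allowed x false) (sym eq) rb-blue ; (suc t) → ok t }) , sum≡
  choose {suc k} c zero R≤ ≤B | ⟨rb⟩ | no ≢r = contradiction (n≤0⇒n≡0 R≤) ≢r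
  choose {suc k} c (suc r) R≤ ≤B | ⟨rb⟩ | no ≢r with choose (c ∘ suc) r (s≤s⁻¹ (≤∧≢⇒< R≤ ≢r)) (s≤s⁻¹ ≤B)
  ... | χ , ok , sum≡ = (λ { zero → true ; (suc t) → χ t }) ,
      (λ { zero → subst (λ x → Allowed x true) (sym eq) rb-red ; (suc t) → ok t }) , cong suc sum≡

  T-not : ∀ {b} → T b → T (not b) → ∀ {A : Set} → A
  T-not {true} _ ()

  abstract

    selected : ∀ {k} → (Fin k → Edge n) → (Fin k → Bool) → EdgeSet n
    selected h χ e = ⌊ any? (λ t → T? (χ t) ×-dec (h t ≟ᵉ e)) ⌋

    selected⁻ : ∀ {k} (h : Fin k → Edge n) χ e → e ∈ selected h χ → ∃ λ t → T (χ t) × h t ≡ e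
    selected⁻ h χ e = toWitness {a? = any? λ t → T? (χ t) ×-dec (h t ≟ᵉ e)}

    selected⁺ : ∀ {k} (h : Fin k → Edge n) χ e → (∃ λ t → T (χ t) × h t ≡ e) → e ∈ selected h χ
    selected⁺ h χ e = fromWitness {a? = any? λ t → T? (χ t) ×-dec (h t ≟ᵉ e)}

  Good⇒Balanced : ∀ {L : ListColoring n} {f} → Good L f → BalancedCopy L K₅
  Good⇒Balanced {n} {L} {f} (good inj R≤ B≤) = build (choose c 5 R≤′ B≤′)
    where
    h : Fin 10 → Edge n
    h = image f inj ∘ pair
    h-inj : Injective _≡_ _≡_ h
    h-inj {t} {t′} eq = pair-injective {t} {t′} (image-injective inj eq)
    c : Fin 10 → ColorList
    c = L ∘ h
    not-blue : ∀ e → ⟦ redOnly L e ⟧ ≡ ⟦ onlyR (L e) ⟧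
    not-blue e with L e
    ... | ⟨r⟩  = refl
    ... | ⟨b⟩  = refl
    ... | ⟨rb⟩ = refl
    not-red : ∀ e → ⟦ blueOnly L e ⟧ ≡ ⟦ onlyB (L e) ⟧
    not-red e with L e
    ... | ⟨r⟩  = refl
    ... | ⟨b⟩  = refl
    ... | ⟨rb⟩ = refl
    R≤′ : tally onlyR c ≤ 5
    R≤′ = subst (_≤ 5) (trans (within-image (redOnly L) f inj) (sum-cong-≗ λ t → not-blue (h t))) R≤
    B≤′ : 5 + tally onlyB c ≤ 10
    B≤′ = +-monoʳ-≤ 5 (subst (_≤ 5) (trans (within-image (blueOnly L) f inj) (sum-cong-≗ λ t → not-red (h t))) B≤)
    module _ (χ : Fin 10 → Bool) where
      chosen : EdgeSet n
      chosen = selected h χ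
      ∣chosen∣ : ∣ chosen ∣ ≡ sum (⟦_⟧ ∘ χ)
      ∣chosen∣ = ≤-antisym (count-≤ h χ (selected⁻ h χ))
        (count-≥ h χ h-inj λ t χt → selected⁺ h χ (h t) (t , χt , refl))
    build : (∃ λ (χ : Fin 10 → Bool) → (∀ t → Allowed (c t) (χ t)) × sum (⟦_⟧ ∘ χ) ≡ 5) → BalancedCopy L K₅
    build (χ , ok , sum≡) = record
      { copy     = record { embed = f ; injective = inj }
      ; E₁       = chosen χ
      ; E₂       = chosen (not ∘ χ)
      ; covers   = λ e → mk⇔ (to e) (from e)
      ; disjoint = λ e (p , q) → apart e (selected⁻ h χ e p) (selected⁻ h (not ∘ χ) e q)
      ; E₁⊆R     = λ e p → ⊆R e (selected⁻ h χ e p)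
      ; E₂⊆B     = λ e p → ⊆B e (selected⁻ h (not ∘ χ) e p)
      ; balanced = subst₂ (λ x y → dist x y ≤ 1) (sym (trans (∣chosen∣ χ) sum≡)) (sym (trans (∣chosen∣ (not ∘ χ)) rest)) z≤n
      }
      where
      to : ∀ e → (∃ λ e′ → T true × image f inj e′ ≡ e) → e ∈ chosen χ ⊎ e ∈ chosen (not ∘ χ)
      to e (e′ , _ , eq) with pair-surjective e′
      ... | t , refl with χ t in χt
      ...   | true  = inj₁ (selected⁺ h χ e (t , subst T (sym χt) tt , eq))
      ...   | false = inj₂ (selected⁺ h (not ∘ χ) e (t , subst (T ∘ not) (sym χt) tt , eq))
      from : ∀ e → e ∈ chosen χ ⊎ e ∈ chosen (not ∘ χ) → ∃ λ e′ → T true × image f inj e′ ≡ e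
      from e (inj₁ p) with selected⁻ h χ e p
      ... | t , _ , eq = pair t , tt , eq
      from e (inj₂ p) with selected⁻ h (not ∘ χ) e p
      ... | t , _ , eq = pair t , tt , eq
      apart : ∀ e → (∃ λ t → T (χ t) × h t ≡ e) → ¬ (∃ λ t → T (not (χ t)) × h t ≡ e)
      apart e (t , χt , eq) (t′ , ¬χt , eq′) with h-inj {t} {t′} (trans eq (sym eq′))
      ... | refl = T-not χt ¬χt
      ⊆R : ∀ e → (∃ λ t → T (χ t) × h t ≡ e) → e ∈ red L
      ⊆R _ (t , χt , refl) with L (h t) | χ t | ok t
      ... | ⟨r⟩  | _ | _ = tt
      ... | ⟨rb⟩ | _ | _ = tt
      ... | ⟨b⟩  | false | b-blue = χt
      ⊆B : ∀ e → (∃ λ t → T (not (χ t)) × h t ≡ e) → e ∈ blue L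
      ⊆B _ (t , χt , refl) with L (h t) | χ t | ok t
      ... | ⟨b⟩  | _ | _ = tt
      ... | ⟨rb⟩ | _ | _ = tt
      ... | ⟨r⟩  | true | r-red = χt
      rest : sum (⟦_⟧ ∘ not ∘ χ) ≡ 5
      rest = +-cancelˡ-≡ (sum (⟦_⟧ ∘ χ)) _ _ (trans (sym (∑-distrib-+ (⟦_⟧ ∘ χ) (⟦_⟧ ∘ not ∘ χ)))
        (trans (sum-cong-≗ λ t → one (χ t)) (cong (_+ 5) (sym sum≡))))
        where
        one : ∀ b → ⟦ b ⟧ + ⟦ not b ⟧ ≡ 1
        one true  = refl
        one false = refl

  -- An edge of the copy without blue lies in E₁, since E₂ is blue, and symmetrically. Both parts
  -- have at most five edges: with six in one, at most four are left for the other, a difference of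
  -- 2.
  Balanced⇒Good : ∀ {L : ListColoring n} → BalancedCopy L K₅ → ∃ (Good L)
  Balanced⇒Good {n} {L} copyL = f , good inj R≤ B≤
    where
    open BalancedCopy copyL
    open Copy copy renaming (embed to f; injective to inj)
    h : Fin 10 → Edge n
    h = image f inj ∘ pair
    h-inj : Injective _≡_ _≡_ h
    h-inj {t} {t′} eq = pair-injective {t} {t′} (image-injective inj eq)
    cover : ∀ e → e ∈ᶜ → ∃ λ t → h t ≡ e
    cover e (e′ , _ , eq) with pair-surjective e′
    ... | t , refl = t , eq
    size : ∀ {E : EdgeSet n} → (∀ e → e ∈ E → e ∈ᶜ) → ∣ E ∣ ≤ (∑[ t < 10 ] ⟦ E (h t) ⟧)
    size {E} sub = count-≤ h (E ∘ h) λ e inE → let t , eq = cover e (sub e inE) in t , subst (T ∘ E) (sym eq) inE , eq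
    sizes : ∣ E₁ ∣ + ∣ E₂ ∣ ≤ 10
    sizes = begin
      ∣ E₁ ∣ + ∣ E₂ ∣                                             ≤⟨ +-mono-≤ (size λ e p → Equivalence.from (covers e) (inj₁ p)) (size λ e p → Equivalence.from (covers e) (inj₂ p)) ⟩
      (∑[ t < 10 ] ⟦ E₁ (h t) ⟧) + (∑[ t < 10 ] ⟦ E₂ (h t) ⟧)     ≡⟨ ∑-distrib-+ (λ t → ⟦ E₁ (h t) ⟧) (λ t → ⟦ E₂ (h t) ⟧) ⟨
      (∑[ t < 10 ] (⟦ E₁ (h t) ⟧ + ⟦ E₂ (h t) ⟧))                 ≤⟨ sum-mono (λ t → one (disjoint (h t))) ⟩
      10                                                          ∎
      where
      open ≤-Reasoning
      one : ∀ {x y} → ¬ (T x × T y) → ⟦ x ⟧ + ⟦ y ⟧ ≤ 1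
      one {true}  {true}  h = contradiction (tt , tt) h
      one {true}  {false} h = ≤-refl
      one {false} {y}     h = ⟦⟧≤1 y
    small : ∀ x y → x + y ≤ 10 → dist x y ≤ 1 → x ≤ 5
    small x y le bal = ≮⇒≥ λ 5<x → <⇒≱ (s≤s bal) (begin
      2                ≤⟨ m≤n⇒m∸n≤0′ x y 5<x le ⟩
      x ∸ y            ≤⟨ m∸n≤∣m-n∣ x y ⟩
      dist x y         ∎)
      where
      open ≤-Reasoning
      m≤n⇒m∸n≤0′ : ∀ x y → 5 < x → x + y ≤ 10 → 2 ≤ x ∸ y
      m≤n⇒m∸n≤0′ x y 5<x le = m+n≤o⇒m≤o∸n 2 (≤-trans (+-monoʳ-≤ 2 {y} {4} (+-cancelˡ-≤ 6 y 4 (≤-trans (+-monoˡ-≤ y 5<x) le))) 5<x)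
    within≤ : ∀ {S E : EdgeSet n} → (∀ t → T (S (h t)) → h t ∈ E) → ∣ E ∣ ≤ 5 → within S f ≤ 5
    within≤ {S} sub le = ≤-trans (≤-reflexive (within-image S f inj)) (≤-trans (count-≥ h (S ∘ h) h-inj sub) le)
    R≤ : within (redOnly L) f ≤ 5
    R≤ = within≤ in₁ (small ∣ E₁ ∣ ∣ E₂ ∣ sizes balanced)
      where
      in₁ : ∀ t → T (not (blue L (h t))) → h t ∈ E₁
      in₁ t p with Equivalence.to (covers (h t)) (pair t , tt , refl)
      ... | inj₁ q = q
      ... | inj₂ q = T-not (E₂⊆B (h t) q) p
    B≤ : within (blueOnly L) f ≤ 5
    B≤ = within≤ in₂ (small ∣ E₂ ∣ ∣ E₁ ∣ (subst (_≤ 10) (+-comm ∣ E₁ ∣ _) sizes) (subst (_≤ 1) (∣-∣-comm ∣ E₁ ∣ ∣ E₂ ∣) balanced))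
      where
      in₂ : ∀ t → T (not (red L (h t))) → h t ∈ E₂
      in₂ t p with Equivalence.to (covers (h t)) (pair t , tt , refl)
      ... | inj₂ q = q
      ... | inj₁ q = T-not (E₁⊆R (h t) q) p

-- Existence of lbal(n, K₅), and its upper bound in ℕ

module ForcingThreshold where

  open import Defs
  open import Data.Bool.Base using (not)
  open import Data.Fin.Base using (Fin; zero; suc; finToFun; funToFin; combine; remQuot)
  open import Data.Fin.Patterns using (0F; 1F; 2F)
  open import Data.Fin.Properties using (any?; all?; finToFun-funToFin; remQuot-combine) renaming (_≟_ to _≟ᶠ_; <-cmp to <ᶠ-cmp)
  open import Data.Integer.Base as ℤ using (ℤ; +_; -[1+_])
  import Data.Integer.Properties as ℤₚ
  open import Data.Nat.Base
  open import Data.Nat.Properties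
  open import Data.Nat.Combinatorics using (_C_)
  open import Data.Nat.Tactic.RingSolver
  open import Data.Product.Base using (∃; _×_; _,_)
  open import Data.Vec.Base using ([]; _∷_; lookup)
  open import Data.Vec.Relation.Unary.Unique.Propositional using (Unique)
  open import Data.Vec.Relation.Unary.Unique.Propositional.Properties using (lookup-injective)
  open import Function.Base using (_∘_)
  open import Function.Definitions using (Injective)
  open import Relation.Binary.Definitions using (tri<; tri≈; tri>)
  open import Relation.Binary.PropositionalEquality
  open import Relation.Nullary
  open import Relation.Nullary.Negation using (contradiction-irr)
  open import Relation.Nullary.Decidable using (_×-dec_; _→-dec_; map′)
  open EdgeCounting
  open SparseGraphs
  open BalancedCopies

  private variable
    n : ℕ

  adj-cong : ∀ {S S′ : EdgeSet n} → (∀ e → S e ≡ S′ e) → ∀ i j → adj S i j ≡ adj S′ i j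
  adj-cong S≗ i j with <ᶠ-cmp i j
  ... | tri< i<j _ _ = cong ⟦_⟧ (S≗ (edge i j i<j))
  ... | tri≈ _ _ _   = refl
  ... | tri> _ _ j<i = cong ⟦_⟧ (S≗ (edge j i j<i))

  red-cong : ∀ {L L′ : ListColoring n} e → L e ≡ L′ e → red L e ≡ red L′ e
  red-cong {L = L} {L′} e eq with L e | L′ e
  red-cong e refl | ⟨r⟩  | _ = refl
  red-cong e refl | ⟨b⟩  | _ = refl
  red-cong e refl | ⟨rb⟩ | _ = refl

  blue-cong : ∀ {L L′ : ListColoring n} e → L e ≡ L′ e → blue L e ≡ blue L′ e
  blue-cong {L = L} {L′} e eq with L e | L′ e
  blue-cong e refl | ⟨r⟩  | _ = refl
  blue-cong e refl | ⟨b⟩  | _ = refl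
  blue-cong e refl | ⟨rb⟩ | _ = refl

  within-cong : ∀ {S S′ : EdgeSet n} {f f′} → (∀ e → S e ≡ S′ e) → (∀ i → f i ≡ f′ i) → within S f ≡ within S′ f′
  within-cong {S = S} {S′} {f} {f′} S≗ f≗ = sum-cong-≗ {10} λ t → trans (adj-cong S≗ (f (lo (pair t))) (f (hi (pair t))))
    (cong₂ (adj S′) (f≗ (lo (pair t))) (f≗ (hi (pair t))))

  -- Decoding a number returns a coloring or an embedding only up to pointwise equality, which
  -- `Good` therefore has to respect.
  Good-cong : ∀ {L L′ : ListColoring n} {f f′} → (∀ e → L e ≡ L′ e) → (∀ i → f i ≡ f′ i) → Good L f → Good L′ f′
  Good-cong {L = L} {L′} {f} {f′} L≗ f≗ (good inj R≤ B≤) = good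
    (λ {i} {j} eq → inj (trans (f≗ i) (trans eq (sym (f≗ j)))))
    (subst (_≤ 5) (within-cong {S = redOnly L} {redOnly L′} (λ e → cong not (blue-cong {L = L} {L′} e (L≗ e))) f≗) R≤)
    (subst (_≤ 5) (within-cong {S = blueOnly L} {blueOnly L′} (λ e → cong not (red-cong {L = L} {L′} e (L≗ e))) f≗) B≤)

  abstract

    good? : ∀ (L : ListColoring n) f → Dec (Good L f)
    good? L f = map′ (λ (inj , R≤ , B≤) → good (λ {i} {j} → inj i j) R≤ B≤)
      (λ (good inj R≤ B≤) → (λ i j → inj) , R≤ , B≤)
      ((all? λ i → all? λ j → (f i ≟ᶠ f j) →-dec (i ≟ᶠ j)) ×-dec
       (within (redOnly L) f ≤? 5) ×-dec (within (blueOnly L) f ≤? 5))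

    ∃good? : ∀ (L : ListColoring n) → Dec (∃ (Good L))
    ∃good? {n} L = map′ (λ (c , g) → finToFun c , g)
      (λ (f , g) → funToFin f , Good-cong (λ _ → refl) (λ i → sym (finToFun-funToFin f i)) g)
      (any? {n = n ^ 5} λ c → good? L (finToFun c))

  encode : ColorList → Fin 3
  encode ⟨r⟩  = 0F
  encode ⟨b⟩  = 1F
  encode ⟨rb⟩ = 2F

  decode : Fin 3 → ColorList
  decode 0F = ⟨r⟩
  decode 1F = ⟨b⟩
  decode 2F = ⟨rb⟩

  decode-encode : ∀ c → decode (encode c) ≡ c
  decode-encode ⟨r⟩  = refl
  decode-encode ⟨b⟩  = refl
  decode-encode ⟨rb⟩ = refl

  coloring : ∀ n → Fin (3 ^ (n * n)) → ListColoring n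
  coloring n c e = decode (finToFun c (combine (lo e) (hi e)))

  code : (L : ListColoring n) → ∃ λ c → ∀ e → coloring n c e ≡ L e
  code {n} L = funToFin table , eq
    where
    entry : Fin n × Fin n → Fin 3
    entry (i , j) with <ᶠ-cmp i j
    ... | tri< i<j _ _ = encode (L (edge i j i<j))
    -- The table has an entry for every ordered pair; those with i ≥ j belong to no edge and get a
    -- dummy value.
    ... | tri≈ _ _ _   = 0F
    ... | tri> _ _ _   = 0F
    table : Fin (n * n) → Fin 3
    table = entry ∘ remQuot n
    entry-edge : ∀ e → entry (lo e , hi e) ≡ encode (L e)
    entry-edge (edge i j i<j) with <ᶠ-cmp i j
    ... | tri< _ _ _ = refl
    ... | tri≈ ≮ _ _ = contradiction-irr i<j ≮
    ... | tri> ≮ _ _ = contradiction-irr i<j ≮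
    eq : ∀ e → coloring n (funToFin table) e ≡ L e
    eq e = trans (cong decode (trans (finToFun-funToFin table (combine (lo e) (hi e)))
      (trans (cong entry (remQuot-combine (lo e) (hi e))) (entry-edge e)))) (decode-encode (L e))

  abstract

    -- Searches through codes of all colorings and, for each, of all maps from five vertices;
    -- `abstract` keeps this search from ever being evaluated.
    forces? : ∀ n k → Dec (Forces n K₅ (+ k))
    forces? n k = map′ to from (all? {n = 3 ^ (n * n)} λ c →
        (k <? ∣ red (coloring n c) ∣) →-dec ((k <? ∣ blue (coloring n c) ∣) →-dec ∃good? (coloring n c)))
      where
      to : (∀ c → k < ∣ red (coloring n c) ∣ → k < ∣ blue (coloring n c) ∣ → ∃ (Good (coloring n c))) → Forces n K₅ (+ k)
      to h L (ℤ.+<+ k<R) (ℤ.+<+ k<B) with code L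
      ... | c , eq with h c (subst (k <_) (∣∣-cong (λ e → sym (red-cong {L = coloring n c} {L} e (eq e)))) k<R)
                           (subst (k <_) (∣∣-cong (λ e → sym (blue-cong {L = coloring n c} {L} e (eq e)))) k<B)
      ...   | f , g = Good⇒Balanced (Good-cong eq (λ _ → refl) g)
      from : Forces n K₅ (+ k) → ∀ c → k < ∣ red (coloring n c) ∣ → k < ∣ blue (coloring n c) ∣ → ∃ (Good (coloring n c))
      from F c k<R k<B = Balanced⇒Good (F (coloring n c) (ℤ.+<+ k<R) (ℤ.+<+ k<B))

  least : ∀ {P : ℕ → Set} → (∀ k → Dec (P k)) → ∀ k → P k → ∃ λ m → P m × m ≤ k × (∀ j → P j → m ≤ j)
  least {P} P? zero p = zero , p , z≤n , λ _ _ → z≤n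
  least {P} P? (suc k) p with P? zero
  ... | yes p₀ = zero , p₀ , z≤n , λ _ _ → z≤n
  ... | no ¬p₀ with least (P? ∘ suc) k p
  ...   | m , pm , m≤k , min = suc m , pm , s≤s m≤k , λ { zero p₀ → contradiction p₀ ¬p₀ ; (suc j) pj → s≤s (min j pj) }

  -- The unbalanced L serves twice. No k below both of its class sizes is forcing; and for a
  -- negative threshold the size conditions are void, so forcing there would give L a balanced copy.
  -- This reduces the minimum over ℤ to a search in ℕ.
  lbal-between : ∀ {n k₀} → 5 ≤ n → (L : ListColoring n) → ¬ BalancedCopy L K₅ → Forces n K₅ (+ k₀) →
    ∃ λ k → IsLbal n K₅ (+ k) × k ≤ k₀ × (∀ M → M ≤ ∣ red L ∣ → M ≤ ∣ blue L ∣ → M ≤ k)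
  lbal-between {n} {k₀} 5≤n L unbalanced F₀ with least (forces? n) k₀ F₀
  ... | k , F , k≤k₀ , min = k ,
    record { large = 5≤n ; forces = F ; least = λ
      { (+ j) Fj → ℤ.+≤+ (min j Fj)
      ; -[1+ j ] Fj → contradiction (Fj L ℤ.-<+ ℤ.-<+) unbalanced } } ,
    k≤k₀ , λ M M≤R M≤B → ≮⇒≥ λ k<M → unbalanced (F L (ℤ.+<+ (<-≤-trans k<M M≤R)) (ℤ.+<+ (<-≤-trans k<M M≤B)))

  ∣red∣+∣blue∣ : ∀ (L : ListColoring n) → ∣ red L ∣ + ∣ blue L ∣ ≡ n C 2 + ∣ both L ∣
  ∣red∣+∣blue∣ {n} L = trans (∣∣-+ (red L) (blue L) everything (both L) pointwise) (cong (_+ ∣ both L ∣) (∣everything∣ n))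
    where
    pointwise : ∀ e → ⟦ red L e ⟧ + ⟦ blue L e ⟧ ≡ 1 + ⟦ both L e ⟧
    pointwise e with L e
    ... | ⟨r⟩  = refl
    ... | ⟨b⟩  = refl
    ... | ⟨rb⟩ = refl

  within-total : ∀ (L : ListColoring n) f → Injective _≡_ _≡_ f →
    within (redOnly L) f + within (blueOnly L) f + within (both L) f ≡ 10
  within-total L f inj = trans (cong₂ _+_ (cong₂ _+_ (within-image (redOnly L) f inj) (within-image (blueOnly L) f inj)) (within-image (both L) f inj))
    (trans (cong (_+ sum (λ t → ⟦ both L (h t) ⟧)) (sym (∑-distrib-+ (λ t → ⟦ redOnly L (h t) ⟧) (λ t → ⟦ blueOnly L (h t) ⟧))))
      (trans (sym (∑-distrib-+ (λ t → ⟦ redOnly L (h t) ⟧ + ⟦ blueOnly L (h t) ⟧) (λ t → ⟦ both L (h t) ⟧)))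
        (sum-cong-≗ {10} λ t → pointwise (h t))))
    where
    h : Fin 10 → Edge _
    h t = image f inj (pair t)
    pointwise : ∀ e → ⟦ redOnly L e ⟧ + ⟦ blueOnly L e ⟧ + ⟦ both L e ⟧ ≡ 1
    pointwise e with L e
    ... | ⟨r⟩  = refl
    ... | ⟨b⟩  = refl
    ... | ⟨rb⟩ = refl

  -- The sum |R| + |B| exceeds the number of edges by the number of bicolored ones, whose degree sum
  -- `degree-sum-≤` bounds. Five vertices with five bicolored edges leave at most five forced ones,
  -- so without a good embedding that graph is sparse.
  forces-upper : ∀ n s k → n ≤ 2 * (s * s) → 2 * (n C 2) + n * (s + 55) < 4 * suc k → Forces n K₅ (+ k)
  forces-upper n s k n≤ k> L (ℤ.+<+ k<R) (ℤ.+<+ k<B) with ∃good? L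
  ... | yes (f , g) = Good⇒Balanced g
  ... | no none = contradiction k> (≤⇒≯ (begin
      4 * suc k                                     ≡⟨ r₁ (suc k) ⟩
      2 * (suc k + suc k)                           ≤⟨ *-monoʳ-≤ 2 (+-mono-≤ k<R k<B) ⟩
      2 * (∣ red L ∣ + ∣ blue L ∣)                  ≡⟨ cong (2 *_) (∣red∣+∣blue∣ L) ⟩
      2 * (n C 2 + ∣ both L ∣)                      ≡⟨ r₂ (n C 2) ∣ both L ∣ ⟩
      2 * (n C 2) + (∣ both L ∣ + ∣ both L ∣)       ≡⟨ cong (λ t → 2 * (n C 2) + t) (handshake (both L)) ⟨
      2 * (n C 2) + SG.m                            ≤⟨ +-monoʳ-≤ (2 * (n C 2)) (SG.degree-sum-≤ s n≤) ⟩
      2 * (n C 2) + n * (s + 55)                    ∎))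
    where
    open ≤-Reasoning
    r₁ : ∀ x → 4 * x ≡ 2 * (x + x)
    r₁ = solve-∀
    r₂ : ∀ x y → 2 * (x + y) ≡ 2 * x + (y + y)
    r₂ = solve-∀
    sparse : ∀ vs → Unique vs → pairs₅ (adj (both L)) vs ≤ 4
    sparse vs@(p ∷ q ∷ x ∷ y ∷ z ∷ []) uniq = ≮⇒≥ λ 4< → none (f , good inj
        (+-cancelʳ-≤ 5 _ 5 (bound 4< (m≤m+n (within (redOnly L) f) (within (blueOnly L) f))))
        (+-cancelʳ-≤ 5 _ 5 (bound 4< (m≤n+m (within (blueOnly L) f) (within (redOnly L) f)))))
      where
      f : Fin 5 → Fin n
      f = lookup vs
      inj : Injective _≡_ _≡_ f
      inj {i} {j} = lookup-injective uniq i j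
      a = adj (both L)
      pairs≡ : within (both L) f ≡ pairs₅ a vs
      pairs≡ = sum-pair (λ i j → a (f i) (f j))
      bound : ∀ {w} → 4 < pairs₅ a vs → w ≤ within (redOnly L) f + within (blueOnly L) f → w + 5 ≤ 10
      bound 4< w≤ = ≤-trans (+-mono-≤ w≤ (subst (5 ≤_) (sym pairs≡) 4<)) (≤-reflexive (within-total L f inj))
    module SG = SparseGraph (adj (both L)) (adj-sym (both L)) (adj≤1 (both L)) (adj⇒≢ (both L)) sparse

-- The red clique beside a point-line incidence graph

module IncidenceColoring where

  open import Defs
  open import Data.Bool.Base using (Bool; true; false; T; _∧_; _∨_; not; if_then_else_)
  open import Data.Bool.ListAction using (or)
  open import Data.Bool.Properties using (T-∧; T-∨; ∨-comm; ∧-comm)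
  open import Data.Empty using (⊥-elim)
  open import Data.Fin.Base using (Fin; zero; suc; toℕ; fromℕ<; splitAt; combine; remQuot; _↑ˡ_; _↑ʳ_) renaming (_<_ to _<ᶠ_)
  open import Data.Fin.Patterns using (0F; 1F; 2F; 3F; 4F)
  open import Data.Fin.Properties using (toℕ<n; toℕ-injective; toℕ-fromℕ<; toℕ-↑ˡ; toℕ-↑ʳ; splitAt-↑ˡ; splitAt-↑ʳ; splitAt⁻¹-↑ˡ; splitAt⁻¹-↑ʳ; splitAt-<; remQuot-combine; combine-remQuot) renaming (_≟_ to _≟ᶠ_; _<?_ to _<ᶠ?_; <-cmp to <ᶠ-cmp)
  open import Data.List.Base using (List; []; _∷_)
  open import Data.List.Relation.Unary.All using (All; []; _∷_)
  open import Data.Nat.Base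
  open import Data.Nat.Combinatorics using (_C_)
  open import Data.Nat.DivMod using (_/_; _%_; m≡m%n+[m/n]*n; m%n<n; %-distribˡ-+)
  open import Data.Nat.Divisibility using (_∣_; divides; ∣⇒≤)
  open import Data.Nat.Primality using (Prime; euclidsLemma; prime⇒nonZero)
  open import Data.Nat.Properties
  open import Data.Nat.Tactic.RingSolver
  open import Data.Product.Base using (∃; _×_; _,_; proj₁; proj₂; uncurry)
  open import Data.Sum.Base using (_⊎_; inj₁; inj₂; [_,_]′)
  open import Data.Unit.Base using (tt)
  open import Function.Base using (_∘_; const)
  open import Function.Bundles using (Equivalence)
  open import Function.Definitions using (Injective)
  open import Relation.Binary.Definitions using (tri<; tri≈; tri>)
  open import Relation.Binary.PropositionalEquality
  open import Relation.Nullary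
  open import Relation.Nullary.Decidable using (False; toWitnessFalse)
  open EdgeCounting
  open BalancedCopies

  -- `A` is the clique, `Q` the lines, and `P` the points together with the leftover vertices, which
  -- may join them because they have no incidences.
  data Kind : Set where
    A P Q : Kind

  -- Proof by reflection: a claim about all kinds and incidences of five vertices is checked by evaluating it.
  data Claim : Set where
    all-kinds : (Kind → Claim) → Claim
    guarded   : Bool → (Bool → Claim) → Claim
    leaf      : Bool → Claim

  -- A bit whose guard fails is tried as false only, which restricts the evaluation of `claim` to
  -- incidences between a `P` and a `Q`.
  eval : Claim → Bool
  eval (all-kinds f) = eval (f A) ∧ eval (f P) ∧ eval (f Q)
  eval (guarded g f) = eval (f false) ∧ (if g then eval (f true) else true)
  eval (leaf b)      = b

  Meaning : Claim → Set
  Meaning (all-kinds f) = ∀ k → Meaning (f k)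
  Meaning (guarded g f) = ∀ b → (T b → T g) → Meaning (f b)
  Meaning (leaf b)      = T b

  sound : ∀ c → T (eval c) → Meaning c
  sound (all-kinds f) h k with eval (f A) in eA | eval (f P) in eP | eval (f Q) in eQ
  sound (all-kinds f) h A | true | true | true = sound (f A) (subst T (sym eA) tt)
  sound (all-kinds f) h P | true | true | true = sound (f P) (subst T (sym eP) tt)
  sound (all-kinds f) h Q | true | true | true = sound (f Q) (subst T (sym eQ) tt)
  sound (guarded g f) h false _ = sound (f false) (proj₁ (Equivalence.to T-∧ h))
  sound (guarded true f) h true _ = sound (f true) (proj₂ (Equivalence.to (T-∧ {eval (f false)}) h))
  sound (guarded false f) h true ok = ⊥-elim (ok tt)
  sound (leaf b) h = h

  isA : Kind → Bool
  isA A = true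
  isA P = false
  isA Q = false

  linked : Kind → Kind → Bool
  linked P Q = true
  linked Q P = true
  linked _ _ = false

  red₁ : Kind → Kind → ℕ
  red₁ k l = ⟦ isA k ∧ isA l ⟧

  blue₁ : Kind → Kind → Bool → ℕ
  blue₁ k l g = ⟦ not (isA k ∧ isA l) ∧ not g ⟧

  -- The 15 four-cycles of K₅, each given by its two pairs of opposite vertices.
  fourCycles : (g01 g02 g03 g04 g12 g13 g14 g23 g24 g34 : Bool) → List Bool
  fourCycles g01 g02 g03 g04 g12 g13 g14 g23 g24 g34 =
    (g02 ∧ g03 ∧ g12 ∧ g13) ∷
    (g02 ∧ g04 ∧ g12 ∧ g14) ∷
    (g03 ∧ g04 ∧ g13 ∧ g14) ∷
    (g01 ∧ g03 ∧ g12 ∧ g23) ∷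
    (g01 ∧ g04 ∧ g12 ∧ g24) ∷
    (g03 ∧ g04 ∧ g23 ∧ g24) ∷
    (g01 ∧ g02 ∧ g13 ∧ g23) ∷
    (g01 ∧ g04 ∧ g13 ∧ g34) ∷
    (g02 ∧ g04 ∧ g23 ∧ g34) ∷
    (g01 ∧ g02 ∧ g14 ∧ g24) ∷
    (g01 ∧ g03 ∧ g14 ∧ g34) ∷
    (g02 ∧ g03 ∧ g24 ∧ g34) ∷
    (g13 ∧ g14 ∧ g23 ∧ g24) ∷
    (g12 ∧ g14 ∧ g23 ∧ g34) ∷
    (g12 ∧ g13 ∧ g24 ∧ g34) ∷ []

  redCount : (k0 k1 k2 k3 k4 : Kind) → ℕ
  redCount k0 k1 k2 k3 k4 =
    red₁ k0 k1 + (red₁ k0 k2 + (red₁ k0 k3 + (red₁ k0 k4 + (red₁ k1 k2 + (red₁ k1 k3 + (red₁ k1 k4 + (red₁ k2 k3 + (red₁ k2 k4 + (red₁ k3 k4 + 0)))))))))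

  blueCount : (k0 k1 k2 k3 k4 : Kind) (g01 g02 g03 g04 g12 g13 g14 g23 g24 g34 : Bool) → ℕ
  blueCount k0 k1 k2 k3 k4 g01 g02 g03 g04 g12 g13 g14 g23 g24 g34 =
    blue₁ k0 k1 g01 + (blue₁ k0 k2 g02 + (blue₁ k0 k3 g03 + (blue₁ k0 k4 g04 + (blue₁ k1 k2 g12 + (blue₁ k1 k3 g13 + (blue₁ k1 k4 g14 + (blue₁ k2 k3 g23 + (blue₁ k2 k4 g24 + (blue₁ k3 k4 g34 + 0)))))))))

  -- By hand: four vertices in the clique span six red edges. With three, two, one or none there,
  -- the remaining vertices span at most 1, 2, 3 or 4 bicolored edges, being bipartite without a
  -- four-cycle; next to 3, 1, 0 or 0 red edges at least six edges are only blue.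
  claim : Claim
  claim =
    all-kinds λ k0 →
    all-kinds λ k1 → guarded (linked k0 k1) λ g01 →
    all-kinds λ k2 → guarded (linked k0 k2) λ g02 → guarded (linked k1 k2) λ g12 →
    all-kinds λ k3 → guarded (linked k0 k3) λ g03 → guarded (linked k1 k3) λ g13 → guarded (linked k2 k3) λ g23 →
    all-kinds λ k4 → guarded (linked k0 k4) λ g04 → guarded (linked k1 k4) λ g14 → guarded (linked k2 k4) λ g24 → guarded (linked k3 k4) λ g34 →
    leaf (or (fourCycles g01 g02 g03 g04 g12 g13 g14 g23 g24 g34) ∨
      ((6 ≤ᵇ redCount k0 k1 k2 k3 k4) ∨ (6 ≤ᵇ blueCount k0 k1 k2 k3 k4 g01 g02 g03 g04 g12 g13 g14 g23 g24 g34)))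

  claim-holds : Meaning claim
  claim-holds = sound claim tt

  mod-cancel : ∀ {p} .{{_ : NonZero p}} M k → (M + k) % p ≡ M % p → p ∣ k
  mod-cancel {p} M k eq = divides ((M + k) / p ∸ M / p) (begin-equality
    k                                                        ≡⟨ m+n∸m≡n M k ⟨
    M + k ∸ M                                                ≡⟨ cong₂ _∸_ (m≡m%n+[m/n]*n (M + k) p) (m≡m%n+[m/n]*n M p) ⟩
    ((M + k) % p + (M + k) / p * p) ∸ (M % p + M / p * p)    ≡⟨ cong (λ t → (t + (M + k) / p * p) ∸ (M % p + M / p * p)) eq ⟩
    (M % p + (M + k) / p * p) ∸ (M % p + M / p * p)          ≡⟨ [m+n]∸[m+o]≡n∸o (M % p) _ _ ⟩
    (M + k) / p * p ∸ M / p * p                              ≡⟨ *-distribʳ-∸ p ((M + k) / p) (M / p) ⟨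
    ((M + k) / p ∸ M / p) * p                                ∎)
    where open ≤-Reasoning

  small-multiple : ∀ {p k} → k < p → p ∣ k → k ≡ 0
  small-multiple {k = zero}  _   _   = refl
  small-multiple {k = suc k} k<p p∣k = contradiction (∣⇒≤ p∣k) (<⇒≱ k<p)

  private
    module _ {p : ℕ} (pp : Prime p) where

      instance
        p≢0 : NonZero p
        p≢0 = prime⇒nonZero pp

      %-+-cong : ∀ {a b c d} → a % p ≡ b % p → c % p ≡ d % p → (a + c) % p ≡ (b + d) % p
      %-+-cong {a} {b} {c} {d} e f = trans (%-distribˡ-+ a c p) (trans (cong₂ (λ x y → (x + y) % p) e f) (sym (%-distribˡ-+ b d p)))

      -- The two lines agree at x and at x + f, so the mixed difference ef of the product αx
      -- vanishes modulo p. The congruences are added crosswise, which isolates e * f without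
      -- subtraction.
      rectangle-ordered : ∀ {α x b b′} e f → α + e < p → x + f < p →
        (α * x + b) % p ≡ ((α + e) * x + b′) % p → (α * (x + f) + b) % p ≡ ((α + e) * (x + f) + b′) % p →
        e ≡ 0 ⊎ f ≡ 0
      rectangle-ordered {α} {x} {b} {b′} e f e< f< H₁ H₂ with euclidsLemma e f pp (mod-cancel M (e * f) eq)
        where
        M = (α + e) * x + b′ + (α * (x + f) + b)
        identity : ∀ α x b b′ e f → (α * x + b) + ((α + e) * (x + f) + b′) ≡ (α + e) * x + b′ + (α * (x + f) + b) + e * f
        identity = solve-∀
        eq : (M + e * f) % p ≡ M % p
        eq = trans (cong (_% p) (sym (identity α x b b′ e f))) (%-+-cong {α * x + b} H₁ (sym H₂))
      ... | inj₁ p∣e = inj₁ (small-multiple (≤-<-trans (m≤n+m e α) e<) p∣e)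
      ... | inj₂ p∣f = inj₂ (small-multiple (≤-<-trans (m≤n+m f x) f<) p∣f)

      rectangle-sorted : ∀ {α α′ x x′ b b′} → α ≤ α′ → x ≤ x′ → α′ < p → x′ < p →
        (α * x + b) % p ≡ (α′ * x + b′) % p → (α * x′ + b) % p ≡ (α′ * x′ + b′) % p → α ≡ α′ ⊎ x ≡ x′
      rectangle-sorted {α} {α′} {x} {x′} α≤ x≤ α< x< H₁ H₂ with α′ ∸ α | x′ ∸ x | m+[n∸m]≡n α≤ | m+[n∸m]≡n x≤
      ... | e | f | refl | refl with rectangle-ordered e f α< x< H₁ H₂
      ...   | inj₁ refl = inj₁ (sym (+-identityʳ α))
      ...   | inj₂ refl = inj₂ (sym (+-identityʳ x))

      rectangle : ∀ {α α′ x x′ b b′} → α < p → α′ < p → x < p → x′ < p →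
        (α * x + b) % p ≡ (α′ * x + b′) % p → (α * x′ + b) % p ≡ (α′ * x′ + b′) % p → α ≡ α′ ⊎ x ≡ x′
      rectangle {α} {α′} {x} {x′} α< α′< x< x′< H₁ H₂ with ≤-total α α′ | ≤-total x x′
      ... | inj₁ α≤ | inj₁ x≤ = rectangle-sorted α≤ x≤ α′< x′< H₁ H₂
      ... | inj₁ α≤ | inj₂ x≥ = [ inj₁ , inj₂ ∘ sym ]′ (rectangle-sorted α≤ x≥ α′< x< H₂ H₁)
      ... | inj₂ α≥ | inj₁ x≤ = [ inj₁ ∘ sym , inj₂ ]′ (rectangle-sorted α≥ x≤ α< x′< (sym H₁) (sym H₂))
      ... | inj₂ α≥ | inj₂ x≥ = [ inj₁ ∘ sym , inj₂ ∘ sym ]′ (rectangle-sorted α≥ x≥ α< x< (sym H₂) (sym H₁))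

      +-%-cancel-ordered : ∀ M {b b′} → b ≤ b′ → b′ < p → (M + b′) % p ≡ (M + b) % p → b ≡ b′
      +-%-cancel-ordered M {b} {b′} b≤ b′< H with b′ ∸ b | m+[n∸m]≡n b≤
      ... | k | refl rewrite small-multiple (≤-<-trans (m≤n+m k b) b′<) (mod-cancel (M + b) k (trans (cong (_% p) (+-assoc M b k)) H)) = sym (+-identityʳ b)

      +-%-cancel : ∀ M {b b′} → b < p → b′ < p → (M + b) % p ≡ (M + b′) % p → b ≡ b′
      +-%-cancel M {b} {b′} b< b′< H with ≤-total b b′
      ... | inj₁ b≤ = +-%-cancel-ordered M b≤ b′< (sym H)
      ... | inj₂ b≥ = sym (+-%-cancel-ordered M b≥ b< H)

  -- The first a vertices form a red clique; then come s·p points (x, y) and s·p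
  -- lines (α, b), x, α < s, with bicolored edges where y = αx + b modulo p; all
  -- other edges are blue.
  module Construction (a s p r : ℕ) (pp : Prime p) (s≤p : s ≤ p) where

    n : ℕ
    n = a + (s * p + (s * p + r))

    private
      instance
        p≢0′ : NonZero p
        p≢0′ = prime⇒nonZero pp

    data Role : Set where
      none  : Role
      point : Fin s → Fin p → Role
      line  : Fin s → Fin p → Role

    role₃ : Fin (s * p + r) → Role
    role₃ = [ uncurry line ∘ remQuot p , const none ]′ ∘ splitAt (s * p)

    role₂ : Fin (s * p + (s * p + r)) → Role
    role₂ = [ uncurry point ∘ remQuot p , role₃ ]′ ∘ splitAt (s * p)

    role : Fin n → Role
    role = [ const none , role₂ ]′ ∘ splitAt a

    pointV lineV : Fin s → Fin p → Fin n
    pointV x y = a ↑ʳ (combine x y ↑ˡ (s * p + r))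
    lineV α b  = a ↑ʳ (s * p ↑ʳ (combine α b ↑ˡ r))

    role-pointV : ∀ x y → role (pointV x y) ≡ point x y
    role-pointV x y = trans (cong [ const none , role₂ ]′ (splitAt-↑ʳ a _ (combine x y ↑ˡ (s * p + r))))
      (trans (cong [ uncurry point ∘ remQuot p , role₃ ]′ (splitAt-↑ˡ (s * p) (combine x y) (s * p + r)))
        (cong (uncurry point) (remQuot-combine x y)))

    role-lineV : ∀ α b → role (lineV α b) ≡ line α b
    role-lineV α b = trans (cong [ const none , role₂ ]′ (splitAt-↑ʳ a _ (s * p ↑ʳ (combine α b ↑ˡ r))))
      (trans (cong [ uncurry point ∘ remQuot p , role₃ ]′ (splitAt-↑ʳ (s * p) _ (combine α b ↑ˡ r)))
        (trans (cong [ uncurry line ∘ remQuot p , const none ]′ (splitAt-↑ˡ (s * p) (combine α b) r))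
          (cong (uncurry line) (remQuot-combine α b))))

    role-point⁻ : ∀ u {x y} → role u ≡ point x y → u ≡ pointV x y
    role-point⁻ u eq with splitAt a u in eq₁
    ... | inj₂ v with splitAt (s * p) v in eq₂
    role-point⁻ u refl | inj₂ v | inj₁ w = trans (sym (splitAt⁻¹-↑ʳ eq₁)) (cong (a ↑ʳ_)
      (trans (sym (splitAt⁻¹-↑ˡ eq₂)) (cong (_↑ˡ (s * p + r)) (sym (combine-remQuot {s} p w)))))
    role-point⁻ u eq | inj₂ v | inj₂ w with splitAt (s * p) w
    role-point⁻ u () | inj₂ v | inj₂ w | inj₁ _
    role-point⁻ u () | inj₂ v | inj₂ w | inj₂ _

    role-line⁻ : ∀ u {α b} → role u ≡ line α b → u ≡ lineV α b
    role-line⁻ u eq with splitAt a u in eq₁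
    ... | inj₂ v with splitAt (s * p) v in eq₂
    role-line⁻ u () | inj₂ v | inj₁ w
    role-line⁻ u eq | inj₂ v | inj₂ w with splitAt (s * p) w in eq₃
    role-line⁻ u refl | inj₂ v | inj₂ w | inj₁ z = trans (sym (splitAt⁻¹-↑ʳ eq₁)) (cong (a ↑ʳ_)
      (trans (sym (splitAt⁻¹-↑ʳ eq₂)) (cong (s * p ↑ʳ_)
        (trans (sym (splitAt⁻¹-↑ˡ eq₃)) (cong (_↑ˡ r) (sym (combine-remQuot {s} p z)))))))
    role-line⁻ u () | inj₂ v | inj₂ w | inj₂ _

    low : Fin n → Bool
    low u = toℕ u <ᵇ a

    role-low : ∀ u → T (low u) → role u ≡ none
    role-low u h = cong [ const none , role₂ ]′ (splitAt-< a u (<ᵇ⇒< (toℕ u) a h))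

    incident : Role → Role → Bool
    incident (point x y) (line α b) = (toℕ α * toℕ x + toℕ b) % p ≡ᵇ toℕ y
    incident _           _          = false

    inc : Fin n → Fin n → Bool
    inc u v = incident (role u) (role v) ∨ incident (role v) (role u)

    inc-sym : ∀ u v → inc u v ≡ inc v u
    inc-sym u v = ∨-comm (incident (role u) (role v)) _

    record Meets (u v : Fin n) : Set where
      constructor meets
      field
        {x α}  : Fin s
        {y b}  : Fin p
        point≡ : role u ≡ point x y
        line≡  : role v ≡ line α b
        on     : (toℕ α * toℕ x + toℕ b) % p ≡ toℕ y

    incident⇒meets : ∀ u v → T (incident (role u) (role v)) → Meets u v
    incident⇒meets u v h with role u in equ | role v in eqv
    ... | point x y | line α b = meets equ eqv (≡ᵇ⇒≡ _ _ h)

    inc⇒meets : ∀ u v → T (inc u v) → Meets u v ⊎ Meets v u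
    inc⇒meets u v h with Equivalence.to (T-∨ {incident (role u) (role v)}) h
    ... | inj₁ h₁ = inj₁ (incident⇒meets u v h₁)
    ... | inj₂ h₂ = inj₂ (incident⇒meets v u h₂)

    point≢line : ∀ {u : Role} {x y α b} → u ≡ point x y → u ≢ line α b
    point≢line refl ()

    from-point : ∀ {u v w} → Meets u v → T (inc u w) → Meets u w
    from-point {u} {v} {w} (meets pu _ _) h with inc⇒meets u w h
    ... | inj₁ m = m
    ... | inj₂ (meets _ lu _) = ⊥-elim (point≢line pu lu)

    from-line : ∀ {u v w} → Meets u v → T (inc w v) → Meets w v
    from-line {u} {v} {w} (meets _ lv _) h with inc⇒meets w v h
    ... | inj₁ m = m
    ... | inj₂ (meets pv _ _) = ⊥-elim (point≢line pv lv)

    point-inj : ∀ {x y x′ y′} → point x y ≡ point x′ y′ → x ≡ x′ × y ≡ y′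
    point-inj refl = refl , refl

    line-inj : ∀ {α b α′ b′} → line α b ≡ line α′ b′ → α ≡ α′ × b ≡ b′
    line-inj refl = refl , refl

    -- By `rectangle` the slopes or the abscissas coincide. Lines of equal slope through a common
    -- point have equal intercepts, and points of equal abscissa on a common line have equal
    -- ordinates.
    no-rectangle : ∀ {u u′ v v′} → Meets u v → Meets u v′ → Meets u′ v → Meets u′ v′ → u ≡ u′ ⊎ v ≡ v′
    no-rectangle {u} {u′} {v} {v′} (meets {x} {α} {y} {b} pu lv on₁) (meets {α = α′} {b = b′} pu₂ lv′ on₂)
        (meets {x = x′} {y = y′} pu′ lv₃ on₃) (meets pu′₄ lv′₄ on₄)
      with point-inj (trans (sym pu) pu₂) | point-inj (trans (sym pu′) pu′₄) | line-inj (trans (sym lv) lv₃) | line-inj (trans (sym lv′) lv′₄)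
    ... | refl , refl | refl , refl | refl , refl | refl , refl
      with rectangle pp {toℕ α} {toℕ α′} {toℕ x} {toℕ x′} {toℕ b} {toℕ b′} (<p α) (<p α′) (<p x) (<p x′) (trans on₁ (sym on₂)) (trans on₃ (sym on₄))
      where
      <p : ∀ (i : Fin s) → toℕ i < p
      <p i = <-≤-trans (toℕ<n i) s≤p
    ... | inj₁ α≡ with toℕ-injective α≡
    ...   | refl with toℕ-injective (+-%-cancel pp (toℕ α * toℕ x) (toℕ<n b) (toℕ<n b′) (trans on₁ (sym on₂)))
    ...     | refl = inj₂ (trans (role-line⁻ v lv) (sym (role-line⁻ v′ lv′)))
    no-rectangle {u} {u′} {v} {v′} (meets {x} {α} {y} {b} pu lv on₁) (meets {α = α′} {b = b′} pu₂ lv′ on₂)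
        (meets {x = x′} {y = y′} pu′ lv₃ on₃) (meets pu′₄ lv′₄ on₄)
      | refl , refl | refl , refl | refl , refl | refl , refl | inj₂ x≡ with toℕ-injective x≡
    ...   | refl with toℕ-injective (trans (sym on₁) on₃)
    ...     | refl = inj₁ (trans (role-point⁻ u pu) (sym (role-point⁻ u′ pu′)))

    C₄-free : ∀ {u u′ v v′} → u ≢ u′ → v ≢ v′ → ¬ T (inc u v ∧ inc u v′ ∧ inc u′ v ∧ inc u′ v′)
    C₄-free {u} {u′} {v} {v′} u≢ v≢ h with Equivalence.to (T-∧ {inc u v}) h
    ... | h₁ , h with Equivalence.to (T-∧ {inc u v′}) h
    ...   | h₂ , h with Equivalence.to (T-∧ {inc u′ v}) h
    ...     | h₃ , h₄ with inc⇒meets u v h₁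
    ...       | inj₁ m = [ u≢ , v≢ ]′ (no-rectangle m (from-point m h₂) (from-line m h₃) (from-line (from-point m h₂) h₄))
    ...       | inj₂ m = [ v≢ , u≢ ]′ (no-rectangle m (from-point m (flip h₃)) (from-line m (flip h₂)) (from-line (from-point m (flip h₃)) (flip h₄)))
      where
      flip : ∀ {u v} → T (inc u v) → T (inc v u)
      flip {u} {v} = subst T (inc-sym u v)

    color : Fin n → Fin n → ColorList
    color u v = if low u ∧ low v then ⟨r⟩ else (if inc u v then ⟨rb⟩ else ⟨b⟩)

    L : ListColoring n
    L e = color (lo e) (hi e)

    kind : Fin n → Kind
    kind u with low u | role u
    ... | true  | _         = A
    ... | false | line _ _  = Q
    ... | false | point _ _ = P
    ... | false | none      = P

    isA-kind : ∀ u → isA (kind u) ≡ low u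
    isA-kind u with low u | role u
    ... | true  | _         = refl
    ... | false | line _ _  = refl
    ... | false | point _ _ = refl
    ... | false | none      = refl

    meets-linked : ∀ {u v} → Meets u v → T (linked (kind u) (kind v)) × T (linked (kind v) (kind u))
    meets-linked {u} {v} (meets pu lv _) with low u in eu | low v in ev
    ... | true | _ with () ← trans (sym (role-low u (subst T (sym eu) tt))) pu
    ... | false | true with () ← trans (sym (role-low v (subst T (sym ev) tt))) lv
    ... | false | false rewrite pu | lv = tt , tt

    inc-linked : ∀ u v → T (inc u v) → T (linked (kind u) (kind v))
    inc-linked u v h with inc⇒meets u v h
    ... | inj₁ m = proj₁ (meets-linked m)
    ... | inj₂ m = proj₂ (meets-linked m)

    edge-lift : ∀ {S : EdgeSet n} {g : Fin n → Fin n → Bool} → (∀ e → ⟦ S e ⟧ ≡ ⟦ g (lo e) (hi e) ⟧) → (∀ u v → g u v ≡ g v u) →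
      ∀ {u v} → u ≢ v → adj S u v ≡ ⟦ g u v ⟧
    edge-lift {S} {g} S≡ g-sym {u} {v} u≢v with <ᶠ-cmp u v
    ... | tri< u<v _ _ = S≡ (edge u v u<v)
    ... | tri≈ _ u≡v _ = contradiction u≡v u≢v
    ... | tri> _ _ v<u = trans (S≡ (edge v u v<u)) (cong ⟦_⟧ (g-sym v u))

    redOnly-color : ∀ e → ⟦ redOnly L e ⟧ ≡ ⟦ isA (kind (lo e)) ∧ isA (kind (hi e)) ⟧
    redOnly-color e rewrite isA-kind (lo e) | isA-kind (hi e) with low (lo e) ∧ low (hi e)
    ... | true = refl
    ... | false with inc (lo e) (hi e)
    ...   | true  = refl
    ...   | false = refl

    blueOnly-color : ∀ e → ⟦ blueOnly L e ⟧ ≡ ⟦ not (isA (kind (lo e)) ∧ isA (kind (hi e))) ∧ not (inc (lo e) (hi e)) ⟧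
    blueOnly-color e rewrite isA-kind (lo e) | isA-kind (hi e) with low (lo e) ∧ low (hi e)
    ... | true = refl
    ... | false with inc (lo e) (hi e)
    ...   | true  = refl
    ...   | false = refl

    redOnly-adj : ∀ {u v} → u ≢ v → adj (redOnly L) u v ≡ red₁ (kind u) (kind v)
    redOnly-adj = edge-lift {redOnly L} {λ u v → isA (kind u) ∧ isA (kind v)} redOnly-color λ u v → ∧-comm (isA (kind u)) _

    blueOnly-adj : ∀ {u v} → u ≢ v → adj (blueOnly L) u v ≡ blue₁ (kind u) (kind v) (inc u v)
    blueOnly-adj = edge-lift {blueOnly L} {λ u v → not (isA (kind u) ∧ isA (kind v)) ∧ not (inc u v)} blueOnly-color
      λ u v → cong₂ (λ x y → not x ∧ not y) (∧-comm (isA (kind u)) _) (inc-sym u v)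

    module _ (f : Fin 5 → Fin n) (inj : Injective _≡_ _≡_ f) where

      private
        K : Fin 5 → Kind
        K i = kind (f i)

        G : Fin 5 → Fin 5 → Bool
        G i j = inc (f i) (f j)

        linked-G : ∀ i j → T (G i j) → T (linked (K i) (K j))
        linked-G i j = inc-linked (f i) (f j)

        no-cycle : ∀ i i′ j j′ {i≢ : False (i ≟ᶠ i′)} {j≢ : False (j ≟ᶠ j′)} {g₁ g₂ g₃ g₄} →
          g₁ ≡ G i j → g₂ ≡ G i j′ → g₃ ≡ G i′ j → g₄ ≡ G i′ j′ → ¬ T (g₁ ∧ g₂ ∧ g₃ ∧ g₄)
        no-cycle i i′ j j′ {i≢} {j≢} refl refl refl refl =
          C₄-free {f i} {f i′} {f j} {f j′} (λ eq → toWitnessFalse i≢ (inj eq)) (λ eq → toWitnessFalse j≢ (inj eq))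

        no-cycles : All (λ b → ¬ T b) (fourCycles (G 0F 1F) (G 0F 2F) (G 0F 3F) (G 0F 4F) (G 1F 2F) (G 1F 3F) (G 1F 4F) (G 2F 3F) (G 2F 4F) (G 3F 4F))
        no-cycles =
          no-cycle 0F 1F 2F 3F refl refl refl refl ∷
          no-cycle 0F 1F 2F 4F refl refl refl refl ∷
          no-cycle 0F 1F 3F 4F refl refl refl refl ∷
          no-cycle 0F 2F 1F 3F refl refl (inc-sym (f 1F) (f 2F)) refl ∷
          no-cycle 0F 2F 1F 4F refl refl (inc-sym (f 1F) (f 2F)) refl ∷
          no-cycle 0F 2F 3F 4F refl refl refl refl ∷
          no-cycle 0F 3F 1F 2F refl refl (inc-sym (f 1F) (f 3F)) (inc-sym (f 2F) (f 3F)) ∷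
          no-cycle 0F 3F 1F 4F refl refl (inc-sym (f 1F) (f 3F)) refl ∷
          no-cycle 0F 3F 2F 4F refl refl (inc-sym (f 2F) (f 3F)) refl ∷
          no-cycle 0F 4F 1F 2F refl refl (inc-sym (f 1F) (f 4F)) (inc-sym (f 2F) (f 4F)) ∷
          no-cycle 0F 4F 1F 3F refl refl (inc-sym (f 1F) (f 4F)) (inc-sym (f 3F) (f 4F)) ∷
          no-cycle 0F 4F 2F 3F refl refl (inc-sym (f 2F) (f 4F)) (inc-sym (f 3F) (f 4F)) ∷
          no-cycle 1F 2F 3F 4F refl refl refl refl ∷
          no-cycle 1F 3F 2F 4F refl refl (inc-sym (f 2F) (f 3F)) refl ∷
          no-cycle 1F 4F 2F 3F refl refl (inc-sym (f 2F) (f 4F)) (inc-sym (f 3F) (f 4F)) ∷ []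

        none-true : ∀ {bs} → All (λ b → ¬ T b) bs → ¬ T (or bs)
        none-true {b ∷ bs} (¬b ∷ ¬bs) h = [ ¬b , none-true ¬bs ]′ (Equivalence.to (T-∨ {b}) h)

        red-adj : ∀ i j {i≢j : False (i ≟ᶠ j)} → adj (redOnly L) (f i) (f j) ≡ red₁ (K i) (K j)
        red-adj i j {i≢j} = redOnly-adj (λ eq → toWitnessFalse i≢j (inj eq))

        blue-adj : ∀ i j {i≢j : False (i ≟ᶠ j)} → adj (blueOnly L) (f i) (f j) ≡ blue₁ (K i) (K j) (G i j)
        blue-adj i j {i≢j} = blueOnly-adj (λ eq → toWitnessFalse i≢j (inj eq))

        within-red : within (redOnly L) f ≡ redCount (K 0F) (K 1F) (K 2F) (K 3F) (K 4F)
        within-red = trans (sum-pair (λ i j → adj (redOnly L) (f i) (f j)))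
          (cong₂ _+_ (red-adj 0F 1F) (cong₂ _+_ (red-adj 0F 2F) (cong₂ _+_ (red-adj 0F 3F) (cong₂ _+_ (red-adj 0F 4F) (cong₂ _+_ (red-adj 1F 2F) (cong₂ _+_ (red-adj 1F 3F) (cong₂ _+_ (red-adj 1F 4F) (cong₂ _+_ (red-adj 2F 3F) (cong₂ _+_ (red-adj 2F 4F) (cong₂ _+_ (red-adj 3F 4F) (refl)))))))))))

        within-blue : within (blueOnly L) f ≡ blueCount (K 0F) (K 1F) (K 2F) (K 3F) (K 4F)
          (G 0F 1F) (G 0F 2F) (G 0F 3F) (G 0F 4F) (G 1F 2F) (G 1F 3F) (G 1F 4F) (G 2F 3F) (G 2F 4F) (G 3F 4F)
        within-blue = trans (sum-pair (λ i j → adj (blueOnly L) (f i) (f j)))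
          (cong₂ _+_ (blue-adj 0F 1F) (cong₂ _+_ (blue-adj 0F 2F) (cong₂ _+_ (blue-adj 0F 3F) (cong₂ _+_ (blue-adj 0F 4F) (cong₂ _+_ (blue-adj 1F 2F) (cong₂ _+_ (blue-adj 1F 3F) (cong₂ _+_ (blue-adj 1F 4F) (cong₂ _+_ (blue-adj 2F 3F) (cong₂ _+_ (blue-adj 2F 4F) (cong₂ _+_ (blue-adj 3F 4F) (refl)))))))))))

        verdict : T (or (fourCycles (G 0F 1F) (G 0F 2F) (G 0F 3F) (G 0F 4F) (G 1F 2F) (G 1F 3F) (G 1F 4F) (G 2F 3F) (G 2F 4F) (G 3F 4F)) ∨
          ((6 ≤ᵇ redCount (K 0F) (K 1F) (K 2F) (K 3F) (K 4F)) ∨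
           (6 ≤ᵇ blueCount (K 0F) (K 1F) (K 2F) (K 3F) (K 4F)
             (G 0F 1F) (G 0F 2F) (G 0F 3F) (G 0F 4F) (G 1F 2F) (G 1F 3F) (G 1F 4F) (G 2F 3F) (G 2F 4F) (G 3F 4F))))
        verdict = claim-holds
          (K 0F) (K 1F) (G 0F 1F) (linked-G 0F 1F) (K 2F) (G 0F 2F) (linked-G 0F 2F) (G 1F 2F) (linked-G 1F 2F) (K 3F) (G 0F 3F) (linked-G 0F 3F) (G 1F 3F) (linked-G 1F 3F) (G 2F 3F) (linked-G 2F 3F) (K 4F) (G 0F 4F) (linked-G 0F 4F) (G 1F 4F) (linked-G 1F 4F) (G 2F 4F) (linked-G 2F 4F) (G 3F 4F) (linked-G 3F 4F)

      unbalanced : within (redOnly L) f ≤ 5 → ¬ within (blueOnly L) f ≤ 5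
      unbalanced R≤ B≤ with Equivalence.to (T-∨ {or (fourCycles (G 0F 1F) (G 0F 2F) (G 0F 3F) (G 0F 4F) (G 1F 2F) (G 1F 3F) (G 1F 4F) (G 2F 3F) (G 2F 4F) (G 3F 4F))}) verdict
      ... | inj₁ cyclic = none-true no-cycles cyclic
      ... | inj₂ many with Equivalence.to (T-∨ {6 ≤ᵇ redCount (K 0F) (K 1F) (K 2F) (K 3F) (K 4F)}) many
      ...   | inj₁ h = <⇒≱ (subst (6 ≤_) (sym within-red) (≤ᵇ⇒≤ 6 _ h)) R≤
      ...   | inj₂ h = <⇒≱ (subst (6 ≤_) (sym within-blue) (≤ᵇ⇒≤ 6 _ h)) B≤

    ¬balanced : ¬ BalancedCopy L K₅
    ¬balanced copyL = refute (Balanced⇒Good copyL)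
      where
      refute : ¬ ∃ (Good L)
      refute (f , good inj R≤ B≤) = unbalanced f inj R≤ B≤

    toℕ-pointV : ∀ x y → toℕ (pointV x y) ≡ a + toℕ (combine x y)
    toℕ-pointV x y = trans (toℕ-↑ʳ a _) (cong (a +_) (toℕ-↑ˡ (combine x y) (s * p + r)))

    toℕ-lineV : ∀ α b → toℕ (lineV α b) ≡ a + (s * p + toℕ (combine α b))
    toℕ-lineV α b = trans (toℕ-↑ʳ a _) (cong (a +_) (trans (toℕ-↑ʳ (s * p) _) (cong (s * p +_) (toℕ-↑ˡ (combine α b) r))))

    pointV<lineV : ∀ x y α b → pointV x y <ᶠ lineV α b
    pointV<lineV x y α b = subst₂ _<_ (sym (toℕ-pointV x y)) (sym (toℕ-lineV α b))
      (+-monoʳ-< a (<-≤-trans (toℕ<n (combine x y)) (m≤m+n (s * p) _)))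

    height : Fin s → Fin s → Fin p → Fin p
    height x α b = fromℕ< (m%n<n (toℕ α * toℕ x + toℕ b) p)

    xOf αOf : Fin (s * (s * p)) → Fin s
    xOf t = proj₁ (remQuot {s} (s * p) t)
    αOf t = proj₁ (remQuot {s} p (proj₂ (remQuot {s} (s * p) t)))

    bOf : Fin (s * (s * p)) → Fin p
    bOf t = proj₂ (remQuot {s} p (proj₂ (remQuot {s} (s * p) t)))

    -- Each line has exactly one point above each abscissa, so the incidences are indexed by the
    -- triples (x, α, b).
    incidence : Fin (s * (s * p)) → Edge n
    incidence t = edge (pointV (xOf t) (height (xOf t) (αOf t) (bOf t))) (lineV (αOf t) (bOf t))
      (pointV<lineV (xOf t) (height (xOf t) (αOf t) (bOf t)) (αOf t) (bOf t))

    coordinates : ∀ t → combine (xOf t) (combine (αOf t) (bOf t)) ≡ t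
    coordinates t = trans (cong (combine (xOf t)) (combine-remQuot {s} p _)) (combine-remQuot {s} (s * p) t)

    incidence-injective : Injective _≡_ _≡_ incidence
    incidence-injective {t} {t′} eq = trans (sym (coordinates t)) (trans (cong₂ combine x≡ (cong₂ combine α≡ b≡)) (coordinates t′))
      where
      points≡ : point (xOf t) _ ≡ point (xOf t′) _
      points≡ = trans (sym (role-pointV (xOf t) _)) (trans (cong (role ∘ lo) eq) (role-pointV (xOf t′) _))
      lines≡ : line (αOf t) (bOf t) ≡ line (αOf t′) (bOf t′)
      lines≡ = trans (sym (role-lineV (αOf t) (bOf t))) (trans (cong (role ∘ hi) eq) (role-lineV (αOf t′) (bOf t′)))
      x≡ = proj₁ (point-inj points≡)
      α≡ = proj₁ (line-inj lines≡)
      b≡ = proj₂ (line-inj lines≡)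

    low-pointV : ∀ x y → low (pointV x y) ≡ false
    low-pointV x y with low (pointV x y) in eq
    ... | false = refl
    ... | true  = contradiction (<ᵇ⇒< _ a (subst T (sym eq) tt)) (≤⇒≯ (subst (a ≤_) (sym (toℕ-pointV x y)) (m≤m+n a _)))

    inc-incidence : ∀ x α b → inc (pointV x (height x α b)) (lineV α b) ≡ true
    inc-incidence x α b rewrite role-pointV x (height x α b) | role-lineV α b | toℕ-fromℕ< (m%n<n (toℕ α * toℕ x + toℕ b) p)
      with ((toℕ α * toℕ x + toℕ b) % p) ≡ᵇ ((toℕ α * toℕ x + toℕ b) % p) | ≡⇒≡ᵇ ((toℕ α * toℕ x + toℕ b) % p) _ refl
    ... | true | _ = refl

    incidence∈both : ∀ t → incidence t ∈ both L
    incidence∈both t rewrite low-pointV (xOf t) (height (xOf t) (αOf t) (bOf t)) | inc-incidence (xOf t) (αOf t) (bOf t) = tt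

    ∣both∣≥ : s * (s * p) ≤ ∣ both L ∣
    ∣both∣≥ = ≤-trans (≤-reflexive (sym (trans (sum-const (s * (s * p)) 1) (*-identityʳ _))))
      (count-≥ incidence (const true) incidence-injective (λ t _ → incidence∈both t))

    -- Fills the fourth place of `∣∣-+` in the two identities below.
    nothing : EdgeSet n
    nothing _ = false

    ∣nothing∣ : ∣ nothing ∣ ≡ 0
    ∣nothing∣ = trans (∣∣≡sum nothing) (sum-zero λ i → sum-zero λ j → zero-upper i j)
      where
      zero-upper : ∀ i j → upper nothing i j ≡ 0
      zero-upper i j with i <ᶠ? j
      ... | yes _ = refl
      ... | no _  = refl

    ∣red∣ : ∣ red L ∣ ≡ ∣ inside {n} a ∣ + ∣ both L ∣
    ∣red∣ = trans (sym (+-identityʳ _)) (trans (cong (∣ red L ∣ +_) (sym ∣nothing∣)) (∣∣-+ (red L) nothing (inside a) (both L) pointwise))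
      where
      pointwise : ∀ e → ⟦ red L e ⟧ + 0 ≡ ⟦ inside a e ⟧ + ⟦ both L e ⟧
      pointwise e with low (lo e) ∧ low (hi e)
      ... | true = refl
      ... | false with inc (lo e) (hi e)
      ...   | true  = refl
      ...   | false = refl

    ∣blue∣ : ∣ blue L ∣ + ∣ inside {n} a ∣ ≡ n C 2
    ∣blue∣ = trans (∣∣-+ (blue L) (inside a) everything nothing pointwise)
      (trans (cong₂ _+_ (∣everything∣ n) ∣nothing∣) (+-identityʳ _))
      where
      pointwise : ∀ e → ⟦ blue L e ⟧ + ⟦ inside a e ⟧ ≡ 1
      pointwise e with low (lo e) ∧ low (hi e)
      ... | true = refl
      ... | false with inc (lo e) (hi e)
      ...   | true  = refl
      ...   | false = refl

    2∣red∣ : a * a + 2 * (s * (s * p)) ≤ 2 * ∣ red L ∣ + a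
    2∣red∣ = begin
      a * a + 2 * (s * (s * p))              ≤⟨ +-monoʳ-≤ (a * a) (*-monoʳ-≤ 2 ∣both∣≥) ⟩
      a * a + 2 * ∣ both L ∣                 ≡⟨ cong (_+ 2 * ∣ both L ∣) (∣inside∣ n a (m≤m+n a _)) ⟨
      I + I + a + 2 * ∣ both L ∣             ≡⟨ regroup I a ∣ both L ∣ ⟩
      2 * (I + ∣ both L ∣) + a               ≡⟨ cong (λ t → 2 * t + a) ∣red∣ ⟨
      2 * ∣ red L ∣ + a                      ∎
      where
      open ≤-Reasoning
      I = ∣ inside {n} a ∣
      regroup : ∀ i a b → i + i + a + 2 * b ≡ 2 * (i + b) + a
      regroup = solve-∀

    2∣blue∣ : 2 * (n C 2) ≤ 2 * ∣ blue L ∣ + a * a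
    2∣blue∣ = begin
      2 * (n C 2)                            ≡⟨ cong (2 *_) ∣blue∣ ⟨
      2 * (∣ blue L ∣ + I)                   ≡⟨ regroup ∣ blue L ∣ I ⟩
      2 * ∣ blue L ∣ + (I + I)               ≤⟨ +-monoʳ-≤ (2 * ∣ blue L ∣) (m≤m+n (I + I) a) ⟩
      2 * ∣ blue L ∣ + (I + I + a)           ≡⟨ cong (2 * ∣ blue L ∣ +_) (∣inside∣ n a (m≤m+n a _)) ⟩
      2 * ∣ blue L ∣ + a * a                 ∎
      where
      open ≤-Reasoning
      I = ∣ inside {n} a ∣
      regroup : ∀ b i → 2 * (b + i) ≡ 2 * b + (i + i)
      regroup = solve-∀

-- Choice of parameters and estimates in ℕ

module Asymptotics where

  open import Defs using (ListColoring; BalancedCopy; K₅; red; blue; ∣_∣)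
  open import Data.Bool.Base using () renaming (T to Tᵇ)
  open import Data.Nat.Base
  open import Data.Nat.Combinatorics using (_C_)
  open import Data.Nat.DivMod using (_/_; _%_; m≡m%n+[m/n]*n; m%n<n; m/n*n≤m)
  open import Data.Nat.Primality using (Prime; prime⇒nonZero)
  open import Data.Nat.Properties
  open import Data.Nat.Tactic.RingSolver
  open import Data.Product.Base using (∃; _×_; _,_)
  open import Data.Sum.Base using ([_,_]′)
  open import Relation.Binary.PropositionalEquality
  open import Relation.Nullary
  open PrimeGaps
  open EdgeCounting using (2*nC2)
  open IncidenceColoring using (module Construction)

  cube : ℕ → ℕ
  cube x = x * (x * x)

  private
    cube-mono : ∀ {x y} → x ≤ y → cube x ≤ cube y
    cube-mono x≤y = *-mono-≤ x≤y (*-mono-≤ x≤y x≤y)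

    cube-* : ∀ x y → x * y * (x * y * (x * y)) ≡ x * (x * x) * (y * (y * y))
    cube-* = solve-∀

    square-cancel-≤ : ∀ {x y} → x * x ≤ y * y → x ≤ y
    square-cancel-≤ {x} {y} le = ≮⇒≥ λ y<x → <⇒≱ (*-mono-< y<x y<x) le

    m<[m/n+1]*n : ∀ m n .{{_ : NonZero n}} → m < suc (m / n) * n
    m<[m/n+1]*n m n = subst (_< suc (m / n) * n) (sym (m≡m%n+[m/n]*n m n)) (+-monoˡ-< (m / n * n) (m%n<n m n))

  -- The case s = p: then s²p = p³, and the lower end x/y of the window for p/ρ decides.
  dense-tall : ∀ A B x y ρ p → .{{NonZero (cube y)}} → cube y * A ≤ B * cube x → x * ρ ≤ y * p → A * cube ρ ≤ B * cube p
  dense-tall A B x y ρ p consts le = *-cancelˡ-≤ (cube y) (begin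
    cube y * (A * cube ρ)       ≡⟨ *-assoc (cube y) A (cube ρ) ⟨
    cube y * A * cube ρ         ≤⟨ *-monoˡ-≤ (cube ρ) consts ⟩
    B * cube x * cube ρ         ≡⟨ *-assoc B (cube x) (cube ρ) ⟩
    B * (cube x * cube ρ)       ≡⟨ cong (B *_) (cube-* x ρ) ⟨
    B * cube (x * ρ)            ≤⟨ *-monoʳ-≤ B (cube-mono le) ⟩
    B * cube (y * p)            ≡⟨ cong (B *_) (cube-* y p) ⟩
    B * (cube y * cube p)       ≡⟨ swap B (cube y) (cube p) ⟩
    cube y * (B * cube p)       ∎)
    where
    open ≤-Reasoning
    swap : ∀ a b c → a * (b * c) ≡ b * (a * c)
    swap = solve-∀

  -- The case s = ⌊N/p⌋: then s²p is about N²/p with N about (c/E)ρ², and the upper end x/y of the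
  -- window for p/ρ decides.
  dense-wide : ∀ A B x y c E ρ p s N → .{{NonZero p}} → .{{NonZero y}} → .{{NonZero (E * E)}} →
    E * E * A * x ≤ y * B * (c * c) → y * p ≤ x * ρ → E * p + c * (ρ * ρ) ≤ E * N →
    N ≤ p + s * p → A * cube ρ ≤ B * (s * (s * p))
  dense-wide A B x y c E ρ p s N consts p≤ N≥ N≤ = *-cancelʳ-≤ _ _ p (*-cancelˡ-≤ (E * E) (*-cancelˡ-≤ y (begin
    y * (E * E * (A * cube ρ * p))               ≡⟨ r₁ y (E * E) A ρ p ⟩
    E * E * A * cube ρ * (y * p)                 ≤⟨ *-monoʳ-≤ (E * E * A * cube ρ) p≤ ⟩
    E * E * A * cube ρ * (x * ρ)                 ≡⟨ r₂ (E * E * A) x ρ ⟩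
    E * E * A * x * (ρ * ρ * (ρ * ρ))            ≤⟨ *-monoˡ-≤ (ρ * ρ * (ρ * ρ)) consts ⟩
    y * B * (c * c) * (ρ * ρ * (ρ * ρ))          ≡⟨ r₃ (y * B) c (ρ * ρ) ⟩
    y * B * (c * (ρ * ρ) * (c * (ρ * ρ)))        ≤⟨ *-monoʳ-≤ (y * B) (*-mono-≤ sp≥ sp≥) ⟩
    y * B * (E * (s * p) * (E * (s * p)))        ≡⟨ r₄ y B E s p ⟩
    y * (E * E * (B * (s * (s * p)) * p))        ∎)))
    where
    open ≤-Reasoning
    sp≥ : c * (ρ * ρ) ≤ E * (s * p)
    sp≥ = +-cancelˡ-≤ (E * p) _ _ (≤-trans N≥ (≤-trans (*-monoʳ-≤ E N≤) (≤-reflexive (*-distribˡ-+ E p (s * p)))))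
    r₁ : ∀ a b c ρ p → a * (b * (c * (ρ * (ρ * ρ)) * p)) ≡ b * c * (ρ * (ρ * ρ)) * (a * p)
    r₁ = solve-∀
    r₂ : ∀ a b ρ → a * (ρ * (ρ * ρ)) * (b * ρ) ≡ a * b * (ρ * ρ * (ρ * ρ))
    r₂ = solve-∀
    r₃ : ∀ a b x → a * (b * b) * (x * x) ≡ a * (b * x * (b * x))
    r₃ = solve-∀
    r₄ : ∀ a b c s p → a * b * (c * (s * p) * (c * (s * p))) ≡ a * (c * c * (b * (s * (s * p)) * p))
    r₄ = solve-∀

  tall-bound : ∀ x y b M ρ v p → y * b ≡ x * M → ρ ≤ v * M → b * v ≤ p → x * ρ ≤ y * p
  tall-bound x y b M ρ v p consts ρ≤ p≥ = begin
    x * ρ            ≤⟨ *-monoʳ-≤ x ρ≤ ⟩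
    x * (v * M)      ≡⟨ r x v M ⟩
    x * M * v        ≡⟨ cong (_* v) consts ⟨
    y * b * v        ≡⟨ *-assoc y b v ⟩
    y * (b * v)      ≤⟨ *-monoʳ-≤ y p≥ ⟩
    y * p            ∎
    where
    open ≤-Reasoning
    r : ∀ x v M → x * (v * M) ≡ x * M * v
    r = solve-∀

  wide-bound : ∀ x y b M ρ q p → y * b ≡ x * M → q * M ≤ ρ → x * M ≤ ρ → p ≤ b * suc q → y * p ≤ suc x * ρ
  wide-bound x y b M ρ q p consts q≤ M≤ p≤ = begin
    y * p                    ≤⟨ *-monoʳ-≤ y p≤ ⟩
    y * (b * suc q)          ≡⟨ *-assoc y b (suc q) ⟨
    y * b * suc q            ≡⟨ cong (_* suc q) consts ⟩
    x * M * suc q            ≡⟨ r x M q ⟩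
    x * M + x * (q * M)      ≤⟨ +-mono-≤ M≤ (*-monoʳ-≤ x q≤) ⟩
    suc x * ρ                ∎
    where
    open ≤-Reasoning
    r : ∀ x M q → x * M * suc q ≡ x * M + x * (q * M)
    r = solve-∀

  -- For large r, lowering the constant from suc c to c pays for p, for rounding √n up to suc r and
  -- for rounding N down.
  room : ∀ c E r n p N → p ≤ suc r → r * r ≤ n → 2 * E + c ≤ r → suc (E + 2 * c) ≤ r → suc c * n ≤ E * suc N →
    E * p + c * (suc r * suc r) ≤ E * N
  room c E r n p N p≤ r²≤n big big′ N≥ = +-cancelʳ-≤ E _ _ (begin
    E * p + c * (suc r * suc r) + E                     ≤⟨ +-monoˡ-≤ E (+-monoˡ-≤ (c * (suc r * suc r)) (*-monoʳ-≤ E p≤)) ⟩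
    E * suc r + c * (suc r * suc r) + E                 ≡⟨ expand E c r ⟩
    c * (r * r) + ((E + 2 * c) * r + (2 * E + c))       ≤⟨ +-monoʳ-≤ (c * (r * r)) (+-monoʳ-≤ ((E + 2 * c) * r) big) ⟩
    c * (r * r) + ((E + 2 * c) * r + r)                 ≡⟨ collect c (E + 2 * c) r ⟩
    c * (r * r) + suc (E + 2 * c) * r                   ≤⟨ +-monoʳ-≤ (c * (r * r)) (*-monoˡ-≤ r big′) ⟩
    c * (r * r) + r * r                                 ≡⟨ +-comm (c * (r * r)) (r * r) ⟩
    suc c * (r * r)                                     ≤⟨ *-monoʳ-≤ (suc c) r²≤n ⟩
    suc c * n                                           ≤⟨ N≥ ⟩
    E * suc N                                           ≡⟨ trans (*-suc E N) (+-comm E (E * N)) ⟩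
    E * N + E                                           ∎)
    where
    open ≤-Reasoning
    expand : ∀ a b r → a * suc r + b * (suc r * suc r) + a ≡ b * (r * r) + ((a + 2 * b) * r + (2 * a + b))
    expand = solve-∀
    collect : ∀ b c r → b * (r * r) + (c * r + r) ≡ b * (r * r) + suc c * r
    collect = solve-∀

  scale-floor : ∀ k u w {U W} n N → k * u ≡ U → k * w ≡ W → u * n < suc N * w → U * n ≤ W * suc N
  scale-floor k u w n N refl refl lt = begin
    k * u * n          ≡⟨ *-assoc k u n ⟩
    k * (u * n)        ≤⟨ *-monoʳ-≤ k (<⇒≤ lt) ⟩
    k * (suc N * w)    ≡⟨ r k w (suc N) ⟩
    k * w * suc N      ∎
    where
    open ≤-Reasoning
    r : ∀ k w N → k * (N * w) ≡ k * w * N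
    r = solve-∀

  -- p lies in the window [0.8367, 1.7071]·√(βn) around √(βn), β = (√2 − 1)/(2√2),
  -- in which s²p comes out large enough; its ends have ratio just above 2. The factor
  -- 2301/70000 exceeds 23/700 by enough to absorb the loss 3n of LowerColoring.
  record Parameters (n : ℕ) : Set where
    field
      ρ p s : ℕ
      prime : Prime p
      s≤p   : s ≤ p
      n<ρ²  : n < ρ * ρ
      fits  : 1250 * (s * p) ≤ 183 * n
      dense : 2301 * cube ρ ≤ 70000 * (s * (s * p))
      ρ-big : 280000 ≤ ρ

  parameters : ∀ n → 50000000 * 50000000 ≤ n → Parameters n
  parameters n big with isqrt n
  ... | r , r²≤n , n<ρ² = build (prime-between v 70000≤v)
    where
    open ≤-Reasoning
    ρ = suc r
    -- As 200/622 = 100/311 and 402/622 = 201/311, the prime found has p/ρ between 100/311 and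
    -- 202/311, rounding included. Relative to √β this is about [0.840, 1.697].
    v = suc (ρ / 622)
    r-big : 50000000 ≤ r
    r-big = s≤s⁻¹ (≰⇒> λ ρ≤ → <⇒≱ n<ρ² (≤-trans (*-mono-≤ ρ≤ ρ≤) big))
    r≥ : ∀ k → Tᵇ (k ≤ᵇ 50000000) → k ≤ r
    r≥ k h = ≤-trans (≤ᵇ⇒≤ k 50000000 h) r-big
    ρ<622v : ρ < v * 622
    ρ<622v = m<[m/n+1]*n ρ 622
    70000≤v : 70000 ≤ v
    70000≤v = *-cancelʳ-≤ 70000 v 622 (≤-trans (r≥ (70000 * 622) _) (≤-trans (n≤1+n r) (<⇒≤ ρ<622v)))
    -- 183/1250 = 0.1464 lies just below β ≈ 0.14645, so up to N points and N lines have room. All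
    -- p² points are used if p² ≤ N, otherwise s is cut to N / p.
    N = 183 * n / 1250
    build : (∃ λ p → Prime p × 200 * v < p × p ≤ 402 * v) → Parameters n
    build (p , pp , lo , hi) = record
      { ρ = ρ ; p = p ; s = p ⊓ (N / p) ; prime = pp ; s≤p = m⊓n≤m p (N / p) ; n<ρ² = n<ρ²
      ; fits = begin
          1250 * ((p ⊓ (N / p)) * p)   ≤⟨ *-monoʳ-≤ 1250 (≤-trans (*-monoˡ-≤ p (m⊓n≤n p (N / p))) (m/n*n≤m N p)) ⟩
          1250 * N                     ≡⟨ *-comm 1250 N ⟩
          N * 1250                     ≤⟨ m/n*n≤m (183 * n) 1250 ⟩
          183 * n                      ∎
      ; dense = dense
      ; ρ-big = m≤n⇒m≤1+n (r≥ 280000 _)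
      }
      where
      instance
        p≢0 : NonZero p
        p≢0 = prime⇒nonZero pp
      wide : 311 * p ≤ 202 * ρ
      wide = wide-bound 201 311 402 622 ρ (ρ / 622) p refl (m/n*n≤m ρ 622) (m≤n⇒m≤1+n (r≥ (201 * 622) _)) hi
      p≤ρ : p ≤ ρ
      p≤ρ = *-cancelˡ-≤ 311 (≤-trans wide (*-monoˡ-≤ ρ (≤ᵇ⇒≤ 202 311 _)))
      dense : 2301 * cube ρ ≤ 70000 * ((p ⊓ (N / p)) * ((p ⊓ (N / p)) * p))
      dense = [ tall , short ]′ (≤-total p (N / p))
        where
        tall : p ≤ N / p → 2301 * cube ρ ≤ 70000 * ((p ⊓ (N / p)) * ((p ⊓ (N / p)) * p))
        tall p≤ = subst (λ s → 2301 * cube ρ ≤ 70000 * (s * (s * p))) (sym (m≤n⇒m⊓n≡m p≤))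
          (dense-tall 2301 70000 100 311 ρ p (≤ᵇ⇒≤ (cube 311 * 2301) (70000 * cube 100) _)
            (tall-bound 100 311 200 622 ρ v p refl (<⇒≤ ρ<622v) (<⇒≤ lo)))
        short : N / p ≤ p → 2301 * cube ρ ≤ 70000 * ((p ⊓ (N / p)) * ((p ⊓ (N / p)) * p))
        short p≥ = subst (λ s → 2301 * cube ρ ≤ 70000 * (s * (s * p))) (sym (m≥n⇒m⊓n≡n p≥))
          (dense-wide 2301 70000 202 311 1463 10000 ρ p (N / p) N
            (≤ᵇ⇒≤ (10000 * 10000 * 2301 * 202) (311 * 70000 * (1463 * 1463)) _) wide
            (room 1463 10000 r n p N p≤ρ r²≤n (r≥ (2 * 10000 + 1463) _) (r≥ (suc (10000 + 2 * 1463)) _)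
              (scale-floor 8 183 1250 n N refl refl (m<[m/n+1]*n (183 * n) 1250)))
            (<⇒≤ (m<[m/n+1]*n N p)))

  record LowerColoring (n g : ℕ) : Set where
    field
      L          : ListColoring n
      unbalanced : ¬ BalancedCopy L K₅
      large      : n C 2 + g ≤ 2 * (∣ red L ∣ ⊓ ∣ blue L ∣) + 3 * n

  -- The clique size a = ⌊√(T − g)⌋ makes the two color classes equal up to O(n).
  constructed : ∀ a s p r → Prime p → s ≤ p → let n = a + (s * p + (s * p + r)) in
    a * a + s * (s * p) ≤ n C 2 → n C 2 < suc a * suc a + s * (s * p) → LowerColoring n (s * (s * p))
  constructed a s p r pp s≤p lo hi = record
    { L = L ; unbalanced = ¬balanced ; large = [ (λ eq → subst bound (sym eq) red-large) , (λ eq → subst bound (sym eq) blue-large) ]′ (⊓-sel ∣ red L ∣ ∣ blue L ∣) }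
    where
    open ≤-Reasoning
    open Construction a s p r pp s≤p
    g = s * (s * p)
    bound : ℕ → Set
    bound x = n C 2 + g ≤ 2 * x + 3 * n
    expand : ∀ a g → suc a * suc a + g + g ≡ suc (a * a + 2 * g + 2 * a)
    expand = solve-∀
    collect : ∀ x a → x + a + 2 * a ≡ x + 3 * a
    collect = solve-∀
    red-large : bound ∣ red L ∣
    red-large = s≤s⁻¹ (begin
      suc (n C 2 + g)                 ≤⟨ +-monoˡ-≤ g hi ⟩
      suc a * suc a + g + g           ≡⟨ expand a g ⟩
      suc (a * a + 2 * g + 2 * a)     ≤⟨ s≤s (+-monoˡ-≤ (2 * a) 2∣red∣) ⟩
      suc (2 * ∣ red L ∣ + a + 2 * a)  ≡⟨ cong suc (collect (2 * ∣ red L ∣) a) ⟩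
      suc (2 * ∣ red L ∣ + 3 * a)     ≤⟨ s≤s (+-monoʳ-≤ (2 * ∣ red L ∣) (*-monoʳ-≤ 3 (m≤m+n a _))) ⟩
      suc (2 * ∣ red L ∣ + 3 * n)     ∎)
    regroup : ∀ t g a → t + g + a ≡ t + (a + g)
    regroup = solve-∀
    blue-large : bound ∣ blue L ∣
    blue-large = ≤-trans (+-cancelʳ-≤ (a * a) _ _ (begin
      n C 2 + g + a * a               ≡⟨ regroup (n C 2) g (a * a) ⟩
      n C 2 + (a * a + g)             ≤⟨ +-monoʳ-≤ (n C 2) lo ⟩
      n C 2 + n C 2                   ≡⟨ cong (n C 2 +_) (+-identityʳ _) ⟨
      2 * (n C 2)                     ≤⟨ 2∣blue∣ ⟩
      2 * ∣ blue L ∣ + a * a          ∎)) (m≤m+n (2 * ∣ blue L ∣) (3 * n))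

  n≤nC2 : ∀ n → 3 ≤ n → n ≤ n C 2
  n≤nC2 n 3≤n = *-cancelˡ-≤ 2 (+-cancelʳ-≤ n _ _ (begin
    2 * n + n                    ≡⟨ r n ⟩
    3 * n                        ≤⟨ *-monoˡ-≤ n 3≤n ⟩
    n * n                        ≡⟨ 2*nC2 n ⟨
    n C 2 + n C 2 + n            ≡⟨ cong (λ t → n C 2 + t + n) (+-identityʳ _) ⟨
    2 * (n C 2) + n              ∎))
    where
    open ≤-Reasoning
    r : ∀ n → 2 * n + n ≡ 3 * n
    r = solve-∀

  lowerColoring : ∀ n s p → 3 ≤ n → Prime p → s ≤ p → 1250 * (s * p) ≤ 183 * n → LowerColoring n (s * (s * p))
  lowerColoring n s p 3≤n pp s≤p fits with isqrt (n C 2 ∸ s * (s * p))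
  ... | a , a²≤ , <a² = subst (λ n → LowerColoring n g) n≡ (constructed a s p r pp s≤p
      (subst (λ n → a * a + g ≤ n C 2) (sym n≡) lo) (subst (λ n → n C 2 < suc a * suc a + g) (sym n≡) hi))
    where
    open ≤-Reasoning
    g = s * (s * p)
    T = n C 2
    instance
      p≢0 : NonZero p
      p≢0 = prime⇒nonZero pp
    4sp≤n : 4 * (s * p) ≤ n
    4sp≤n = *-cancelˡ-≤ 183 (begin
      183 * (4 * (s * p))      ≡⟨ *-assoc 183 4 (s * p) ⟨
      183 * 4 * (s * p)        ≤⟨ *-monoˡ-≤ (s * p) (≤ᵇ⇒≤ (183 * 4) 1250 _) ⟩
      1250 * (s * p)           ≤⟨ fits ⟩
      183 * n                  ∎)
    16g : ∀ x → 16 * (x * x) ≡ 4 * x * (4 * x)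
    16g = solve-∀
    3t : ∀ t → t + t + t ≡ 3 * t
    3t = solve-∀
    -- Makes the truncated `T ∸ g` under the square root a true difference; the crude 16g ≤ n²
    -- suffices.
    g≤T : g ≤ T
    g≤T = *-cancelˡ-≤ 16 (begin
      16 * g                   ≤⟨ *-monoʳ-≤ 16 (*-monoˡ-≤ (s * p) (m≤m*n s p)) ⟩
      16 * (s * p * (s * p))   ≡⟨ 16g (s * p) ⟩
      4 * (s * p) * (4 * (s * p))  ≤⟨ *-mono-≤ 4sp≤n 4sp≤n ⟩
      n * n                    ≡⟨ 2*nC2 n ⟨
      T + T + n                ≤⟨ +-monoʳ-≤ (T + T) (n≤nC2 n 3≤n) ⟩
      T + T + T                ≡⟨ 3t T ⟩
      3 * T                    ≤⟨ *-monoˡ-≤ T (≤ᵇ⇒≤ 3 16 _) ⟩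
      16 * T                   ∎)
    lo : a * a + g ≤ T
    lo = ≤-trans (+-monoˡ-≤ g a²≤) (≤-reflexive (m∸n+n≡m g≤T))
    hi : T < suc a * suc a + g
    hi = subst (_< suc a * suc a + g) (m∸n+n≡m g≤T) (+-monoˡ-< g <a²)
    2a²≤n² : 2 * (a * a) ≤ n * n
    2a²≤n² = begin
      2 * (a * a)              ≤⟨ *-monoʳ-≤ 2 (≤-trans (m≤m+n (a * a) g) lo) ⟩
      2 * T                    ≡⟨ cong (T +_) (+-identityʳ T) ⟩
      T + T                    ≤⟨ m≤m+n (T + T) n ⟩
      T + T + n                ≡⟨ 2*nC2 n ⟩
      n * n                    ∎
    a-bound : ∀ A B → A * A ≤ 2 * (B * B) → A * a ≤ B * n
    a-bound A B consts = square-cancel-≤ (*-cancelˡ-≤ 2 (begin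
      2 * (A * a * (A * a))    ≡⟨ rearrange A a ⟩
      A * A * (2 * (a * a))    ≤⟨ *-mono-≤ consts 2a²≤n² ⟩
      2 * (B * B) * (n * n)    ≡⟨ rearrange′ B n ⟩
      2 * (B * n * (B * n))    ∎))
      where
      rearrange : ∀ A a → 2 * (A * a * (A * a)) ≡ A * A * (2 * (a * a))
      rearrange = solve-∀
      rearrange′ : ∀ B n → 2 * (B * B) * (n * n) ≡ 2 * (B * n * (B * n))
      rearrange′ = solve-∀
    fit : ∀ A B D x → .{{NonZero A}} → A ≡ B + 2 * D → A * a ≤ B * n → A * x ≤ D * n → a + (x + x) ≤ n
    fit A B D x A≡ a≤ x≤ = *-cancelˡ-≤ A (begin
      A * (a + (x + x))              ≡⟨ distribute A a x ⟩
      A * a + 2 * (A * x)            ≤⟨ +-mono-≤ a≤ (*-monoʳ-≤ 2 x≤) ⟩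
      B * n + 2 * (D * n)            ≡⟨ factor B D n ⟩
      (B + 2 * D) * n                ≡⟨ cong (_* n) A≡ ⟨
      A * n                          ∎)
      where
      distribute : ∀ A a x → A * (a + (x + x)) ≡ A * a + 2 * (A * x)
      distribute = solve-∀
      factor : ∀ B D n → B * n + 2 * (D * n) ≡ (B + 2 * D) * n
      factor = solve-∀
    -- 884/1250 = 0.7072 lies just above 1/√2, and 884 + 2 · 183 = 1250.
    a+2sp≤n : a + (s * p + s * p) ≤ n
    a+2sp≤n = fit 1250 884 183 (s * p) refl (a-bound 1250 884 (≤ᵇ⇒≤ (1250 * 1250) (2 * (884 * 884)) _)) fits
    r = n ∸ (a + (s * p + s * p))
    n≡ : a + (s * p + (s * p + r)) ≡ n
    n≡ = trans (cong (a +_) (sym (+-assoc (s * p) (s * p) r))) (trans (sym (+-assoc a (s * p + s * p) r)) (m+[n∸m]≡n a+2sp≤n))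

  -- 23/1400 is an upper bound for 2·(31/81)⁵, hence for c.
  record Lower (n : ℕ) : Set where
    field
      ρ          : ℕ
      n≤ρ²       : n ≤ ρ * ρ
      L          : ListColoring n
      unbalanced : ¬ BalancedCopy L K₅
      large      : 700 * (n C 2) + 23 * cube ρ ≤ 1400 * (∣ red L ∣ ⊓ ∣ blue L ∣)

  -- Multiplied by E, the conclusion takes E * c copies of R; the additional copy in the hypothesis
  -- pays for 3n.
  absorb : ∀ E k c T g M n R → .{{NonZero E}} → suc (E * c) * R ≤ E * k * g → T + g ≤ 2 * M + 3 * n → E * k * (3 * n) ≤ R →
    k * T + c * R ≤ 2 * k * M
  absorb E k c T g M n R dense large small = *-cancelˡ-≤ E (+-cancelʳ-≤ R _ _ (begin
    E * (k * T + c * R) + R                  ≡⟨ r₁ E k c T R ⟩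
    E * k * T + suc (E * c) * R              ≤⟨ +-monoʳ-≤ (E * k * T) dense ⟩
    E * k * T + E * k * g                    ≡⟨ *-distribˡ-+ (E * k) T g ⟨
    E * k * (T + g)                          ≤⟨ *-monoʳ-≤ (E * k) large ⟩
    E * k * (2 * M + 3 * n)                  ≡⟨ r₂ E k M (3 * n) ⟩
    E * (2 * k * M) + E * k * (3 * n)        ≤⟨ +-monoʳ-≤ (E * (2 * k * M)) small ⟩
    E * (2 * k * M) + R                      ∎))
    where
    open ≤-Reasoning
    r₁ : ∀ E k c T R → E * (k * T + c * R) + R ≡ E * k * T + suc (E * c) * R
    r₁ = solve-∀
    r₂ : ∀ E k M x → E * k * (2 * M + x) ≡ E * (2 * k * M) + E * k * x
    r₂ = solve-∀

  cubic-small : ∀ k x ρ n → k * x ≤ ρ → n ≤ ρ * ρ → k * (x * n) ≤ cube ρ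
  cubic-small k x ρ n kx≤ n≤ = ≤-trans (≤-reflexive (sym (*-assoc k x n))) (*-mono-≤ kx≤ n≤)

  lower : ∀ n → 50000000 * 50000000 ≤ n → Lower n
  lower n big = build (parameters n big)
    where
    3≤n : 3 ≤ n
    3≤n = ≤-trans (≤ᵇ⇒≤ 3 (50000000 * 50000000) _) big
    build : Parameters n → Lower n
    build par = record { ρ = ρ ; n≤ρ² = <⇒≤ n<ρ² ; L = L ; unbalanced = unbalanced
      ; large = absorb 100 700 23 (n C 2) (s * (s * p)) (∣ red L ∣ ⊓ ∣ blue L ∣) n (cube ρ) dense large
          (cubic-small (100 * 700) 3 ρ n (≤-trans (≤ᵇ⇒≤ (100 * 700 * 3) 280000 _) ρ-big) (<⇒≤ n<ρ²)) }
      where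
      open Parameters par
      open LowerColoring (lowerColoring n s p 3≤n prime s≤p fits)

  -- `tight` is √2 · K · n(s + 55) ≤ (K + 1)r³, squared to stay in ℕ; s is near √(n/2) and r near
  -- √n. It is suc r whose square stays below n, because the rational root of n is later known only
  -- to within 1.
  record Upper (K n : ℕ) : Set where
    field
      s r k   : ℕ
      n≤2s²   : n ≤ 2 * (s * s)
      above   : 2 * (n C 2) + n * (s + 55) < 4 * suc k
      k≤      : 4 * k ≤ 2 * (n C 2) + n * (s + 55)
      r²≤n    : suc r * suc r ≤ n
      tight   : 2 * (K * (n * (s + 55)) * (K * (n * (s + 55)))) ≤ suc K * cube r * (suc K * cube r)

  cube-slack : ∀ h r → h * (3 * h + 1) ≤ r → cube (r + h) ≤ cube r + (3 * h + 1) * (r * r)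
  cube-slack h r h≤ = begin
    cube (r + h)                                           ≡⟨ expand r h ⟩
    cube r + 3 * h * (r * r) + (3 * (h * h) * r + h * (h * h))  ≤⟨ +-monoʳ-≤ (cube r + 3 * h * (r * r)) (+-monoʳ-≤ (3 * (h * h) * r) (*-monoʳ-≤ h hh≤r)) ⟩
    cube r + 3 * h * (r * r) + (3 * (h * h) * r + h * r)   ≡⟨ cong (cube r + 3 * h * (r * r) +_) (factor h r) ⟩
    cube r + 3 * h * (r * r) + h * (3 * h + 1) * r         ≤⟨ +-monoʳ-≤ (cube r + 3 * h * (r * r)) (*-monoˡ-≤ r h≤) ⟩
    cube r + 3 * h * (r * r) + r * r                       ≡⟨ collect (cube r) (3 * h) (r * r) ⟩
    cube r + (3 * h + 1) * (r * r)                         ∎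
    where
    open ≤-Reasoning
    hh≤r : h * h ≤ r
    hh≤r = ≤-trans (*-monoʳ-≤ h (≤-trans (m≤m+n h (2 * h)) (m≤m+n (3 * h) 1))) h≤
    expand : ∀ r h → (r + h) * ((r + h) * (r + h)) ≡ r * (r * r) + 3 * h * (r * r) + (3 * (h * h) * r + h * (h * h))
    expand = solve-∀
    factor : ∀ h r → 3 * (h * h) * r + h * r ≡ h * (3 * h + 1) * r
    factor = solve-∀
    collect : ∀ c h x → c + h * x + x ≡ c + (h + 1) * x
    collect = solve-∀

  upper : ∀ K n → (343 * K + 40002) * (343 * K + 40002) ≤ n → Upper K n
  upper K n big with isqrt n | isqrt (n / 2)
  ... | r₀ , r₀²≤n , n<r₀² | t , t²≤ , <t² = record
    { s = suc t ; r = r ; k = (2 * (n C 2) + X) / 4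
    ; n≤2s² = ≤-trans (<⇒≤ (m<[m/n+1]*n n 2)) (≤-trans (*-monoˡ-≤ 2 <t²) (≤-reflexive (*-comm (suc t * suc t) 2)))
    ; above = subst (2 * (n C 2) + X <_) (*-comm (suc ((2 * (n C 2) + X) / 4)) 4) (m<[m/n+1]*n (2 * (n C 2) + X) 4)
    ; k≤    = subst (_≤ 2 * (n C 2) + X) (*-comm ((2 * (n C 2) + X) / 4) 4) (m/n*n≤m (2 * (n C 2) + X) 4)
    ; r²≤n  = subst (λ x → x * x ≤ n) (sym sr≡) r₀²≤n
    ; tight = begin
        2 * (K * X * (K * X))                              ≡⟨ r₁ K n (suc t + 55) ⟩
        K * K * (n * n) * (2 * ((suc t + 55) * (suc t + 55)))  ≤⟨ *-mono-≤ (*-monoʳ-≤ (K * K) (*-mono-≤ n≤w² n≤w²)) s≤w ⟩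
        K * K * (w * w * (w * w)) * (w * w)                ≡⟨ r₂ K w ⟩
        K * cube w * (K * cube w)                          ≤⟨ *-mono-≤ Kw≤ Kw≤ ⟩
        suc K * cube r * (suc K * cube r)                  ∎
    }
    where
    open ≤-Reasoning
    X = n * (suc t + 55)
    -- 343 = 3 · 114 + 1, and 40002 exceeds 114 · 343, as `cube-slack` with h = 114 asks.
    B = 343 * K + 40002
    r = pred r₀
    -- This shift absorbs all rounding: 2(t + 56)² = 2t² + 224t + 6272 with 2t² ≤ (r + 2)² and t ≤ r
    -- + 1, so the linear coefficient is at most 4 + 224 = 2 · 114.
    w = r + 114
    B≤r₀ : B ≤ r₀
    B≤r₀ = s≤s⁻¹ (≰⇒> λ le → <⇒≱ n<r₀² (≤-trans (*-mono-≤ le le) big))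
    sr≡ : suc r ≡ r₀
    sr≡ = suc-pred r₀ {{>-nonZero (≤-trans (≤-trans (≤ᵇ⇒≤ 1 40002 _) (m≤n+m 40002 (343 * K))) B≤r₀)}}
    B≤sr : B ≤ suc r
    B≤sr = subst (B ≤_) (sym sr≡) B≤r₀
    343K≤r : 343 * K ≤ r
    343K≤r = s≤s⁻¹ (≤-trans (≤-trans (≤-reflexive (+-comm 1 (343 * K))) (+-monoʳ-≤ (343 * K) (≤ᵇ⇒≤ 1 40002 _))) B≤sr)
    h≤r : 114 * (3 * 114 + 1) ≤ r
    h≤r = s≤s⁻¹ (≤-trans (≤-trans (≤ᵇ⇒≤ (suc (114 * (3 * 114 + 1))) 40002 _) (m≤n+m 40002 (343 * K))) B≤sr)
    n≤[r+2]² : n ≤ (r + 2) * (r + 2)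
    n≤[r+2]² = subst (λ x → n ≤ x * x) (trans (cong suc (sym sr≡)) (+-comm 2 r)) (<⇒≤ n<r₀²)
    n≤w² : n ≤ w * w
    n≤w² = ≤-trans n≤[r+2]² (*-mono-≤ {r + 2} {w} (+-monoʳ-≤ r (≤ᵇ⇒≤ 2 114 _)) (+-monoʳ-≤ r (≤ᵇ⇒≤ 2 114 _)))
    2t²≤n : 2 * (t * t) ≤ n
    2t²≤n = ≤-trans (*-monoʳ-≤ 2 t²≤) (≤-trans (≤-reflexive (*-comm 2 (n / 2))) (m/n*n≤m n 2))
    t≤sr : t ≤ suc r
    t≤sr = subst (t ≤_) (sym sr≡) (s≤s⁻¹ (≰⇒> λ le → <⇒≱ n<r₀² (≤-trans (*-mono-≤ le le)
      (≤-trans t²≤ (≤-trans (m≤m*n (n / 2) 2) (m/n*n≤m n 2))))))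
    s≤w : 2 * ((suc t + 55) * (suc t + 55)) ≤ w * w
    s≤w = begin
      2 * ((suc t + 55) * (suc t + 55))                    ≡⟨ e₁ t ⟩
      2 * (t * t) + (224 * t + 6272)                       ≤⟨ +-mono-≤ (≤-trans 2t²≤n n≤[r+2]²) (+-monoˡ-≤ 6272 (*-monoʳ-≤ 224 t≤sr)) ⟩
      (r + 2) * (r + 2) + (224 * suc r + 6272)             ≤⟨ m≤m+n _ 6496 ⟩
      (r + 2) * (r + 2) + (224 * suc r + 6272) + 6496      ≡⟨ e₂ r ⟩
      w * w                                                ∎
      where
      e₁ : ∀ t → 2 * ((suc t + 55) * (suc t + 55)) ≡ 2 * (t * t) + (224 * t + 6272)
      e₁ = solve-∀
      e₂ : ∀ r → (r + 2) * (r + 2) + (224 * suc r + 6272) + 6496 ≡ (r + 114) * (r + 114)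
      e₂ = solve-∀
    absorb-cube : ∀ h → h * (3 * h + 1) ≤ r → K * (3 * h + 1) ≤ r → K * cube (r + h) ≤ suc K * cube r
    absorb-cube h h≤ Kh≤ = begin
      K * cube (r + h)                              ≤⟨ *-monoʳ-≤ K (cube-slack h r h≤) ⟩
      K * (cube r + (3 * h + 1) * (r * r))          ≡⟨ e₃ K (cube r) (3 * h + 1) (r * r) ⟩
      K * cube r + K * (3 * h + 1) * (r * r)        ≤⟨ +-monoʳ-≤ (K * cube r) (*-monoˡ-≤ (r * r) Kh≤) ⟩
      K * cube r + cube r                           ≡⟨ +-comm (K * cube r) (cube r) ⟩
      suc K * cube r                                ∎
      where
      e₃ : ∀ K c h x → K * (c + h * x) ≡ K * c + K * h * x
      e₃ = solve-∀
    Kw≤ : K * cube w ≤ suc K * cube r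
    Kw≤ = absorb-cube 114 h≤r (≤-trans (≤-reflexive (*-comm K 343)) 343K≤r)
    r₁ : ∀ K n s → 2 * (K * (n * s) * (K * (n * s))) ≡ K * K * (n * n) * (2 * (s * s))
    r₁ = solve-∀
    r₂ : ∀ K w → K * K * (w * w * (w * w)) * (w * w) ≡ K * (w * (w * w)) * (K * (w * (w * w)))
    r₂ = solve-∀

  both-bounds : ∀ K → ∃ λ N → ∀ n → N ≤ n → 5 ≤ n × Lower n × Upper K n
  both-bounds K = B + A , λ n le →
    ≤-trans (≤ᵇ⇒≤ 5 A _) (≤-trans (m≤n+m A B) le) , lower n (≤-trans (m≤n+m A B) le) , upper K n (≤-trans (m≤m+n B A) le)
    where
    A = 50000000 * 50000000
    B = (343 * K + 40002) * (343 * K + 40002)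

-- The two bounds at a single index of the Cauchy sequences

module RationalEstimates where

  open import Defs using (module Rational)
  open import Data.Integer.Base as ℤ using (+_)
  import Data.Integer.Properties as ℤₚ
  open import Data.Nat.Base as ℕ using (ℕ; zero; suc)
  import Data.Nat.Properties as ℕₚ
  open import Data.Product.Base using (_,_)
  open import Data.Rational.Base
  open import Data.Rational.Properties
  open import Data.Rational.Solver using (module +-*-Solver)
  import Data.Rational.Unnormalised.Base as ℚᵘ
  import Data.Rational.Unnormalised.Properties as ℚᵘₚ
  open import Relation.Binary.PropositionalEquality
  open import Relation.Nullary
  open import Relation.Nullary.Decidable using (toWitness)
  open Asymptotics using (cube)
  open Rational
  open +-*-Solver using (solve; con; _:=_; _:+_; _:*_; _:-_)

  ι : ℕ → ℚ
  ι n = + n / 1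

  private
    ι-≃ : ∀ n → toℚᵘ (ι n) ℚᵘ.≃ ℚᵘ.mkℚᵘ (+ n) 0
    ι-≃ n = toℚᵘ-fromℚᵘ (ℚᵘ.mkℚᵘ (+ n) 0)

  ι-+ : ∀ a b → ι (a ℕ.+ b) ≡ ι a + ι b
  ι-+ a b = toℚᵘ-injective (ℚᵘₚ.≃-trans (ι-≃ (a ℕ.+ b)) (ℚᵘₚ.≃-trans
    (ℚᵘ.*≡* (cong (ℤ._* + 1) (sym (cong₂ ℤ._+_ (ℤₚ.*-identityʳ (+ a)) (ℤₚ.*-identityʳ (+ b))))))
    (ℚᵘₚ.≃-sym (ℚᵘₚ.≃-trans (toℚᵘ-homo-+ (ι a) (ι b)) (ℚᵘₚ.+-cong (ι-≃ a) (ι-≃ b))))))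

  ι-* : ∀ a b → ι (a ℕ.* b) ≡ ι a * ι b
  ι-* a b = toℚᵘ-injective (ℚᵘₚ.≃-trans (ι-≃ (a ℕ.* b)) (ℚᵘₚ.≃-trans
    (ℚᵘ.*≡* (cong (ℤ._* + 1) (ℤₚ.pos-* a b)))
    (ℚᵘₚ.≃-sym (ℚᵘₚ.≃-trans (toℚᵘ-homo-* (ι a) (ι b)) (ℚᵘₚ.*-cong (ι-≃ a) (ι-≃ b))))))

  ι-mono : ∀ {a b} → a ℕ.≤ b → ι a ≤ ι b
  ι-mono {a} {b} a≤b = toℚᵘ-cancel-≤ (ℚᵘₚ.≤-respʳ-≃ (ℚᵘₚ.≃-sym (ι-≃ b)) (ℚᵘₚ.≤-respˡ-≃ (ℚᵘₚ.≃-sym (ι-≃ a))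
    (ℚᵘ.*≤* (ℤₚ.*-monoʳ-≤-nonNeg (+ 1) (ℤ.+≤+ a≤b)))))

  0≤ι : ∀ n → 0ℚ ≤ ι n
  0≤ι n = ι-mono {0} {n} ℕ.z≤n

  ι-unit : ∀ k → ι (suc k) * unit k ≡ 1ℚ
  ι-unit k = toℚᵘ-injective (ℚᵘₚ.≃-trans (toℚᵘ-homo-* (ι (suc k)) (unit k))
    (ℚᵘₚ.≃-trans (ℚᵘₚ.*-cong (ι-≃ (suc k)) (ℚᵘₚ.≃-refl {toℚᵘ (unit k)}))
      (ℚᵘ.*≡* (trans (ℤₚ.*-identityʳ _) (trans (ℤₚ.*-comm (+ suc k) (+ 1)) (cong (λ t → + 1 ℤ.* + suc t) (sym (ℕₚ.+-identityʳ k))))))))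

  square-cancel : ∀ {a b} → 0ℚ ≤ b → a * a ≤ b * b → a ≤ b
  square-cancel {a} {b} 0≤b le with a ≤? b
  ... | yes a≤b = a≤b
  ... | no a≰b  = contradiction (≤-<-trans le (≤-<-trans (*-mono 0≤b 0≤b ≤-refl ≤-refl) b²<a²)) (<-irrefl refl)
    where
    b<a = ≰⇒> a≰b
    0<a = ≤-<-trans 0≤b b<a
    b²<a² : b * b < a * a
    b²<a² = ≤-<-trans (*-monoˡ-≤-nonNeg b {{nonNegative 0≤b}} (<⇒≤ b<a)) (*-monoˡ-<-pos a {{positive 0<a}} b<a)

  pow : ℚ → ℕ → ℚ
  pow x zero    = ι 1
  pow x (suc k) = x * pow x k

  0≤* : ∀ {a b} → 0ℚ ≤ a → 0ℚ ≤ b → 0ℚ ≤ a * b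
  0≤* {a} {b} 0≤a 0≤b = subst (_≤ a * b) (*-zeroˡ 0ℚ) (*-mono ≤-refl 0≤b 0≤a 0≤b)

  0≤pow : ∀ {x} k → 0ℚ ≤ x → 0ℚ ≤ pow x k
  0≤pow zero    _   = 0≤ι 1
  0≤pow (suc k) 0≤x = 0≤* 0≤x (0≤pow k 0≤x)

  pow-mono : ∀ {x y} k → 0ℚ ≤ x → x ≤ y → pow x k ≤ pow y k
  pow-mono zero    _   _   = ≤-refl
  pow-mono (suc k) 0≤x x≤y = *-mono 0≤x (0≤pow k (≤-trans 0≤x x≤y)) x≤y (pow-mono k 0≤x x≤y)

  pow-ι : ∀ ρ → pow (ι ρ) 3 ≡ ι (cube ρ)
  pow-ι ρ = trans (cong (λ t → ι ρ * (ι ρ * t)) (*-identityʳ (ι ρ))) (sym (trans (ι-* ρ (ρ ℕ.* ρ)) (cong (ι ρ *_) (ι-* ρ ρ))))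

  *-cancelˡ : ∀ {a b c} → 0ℚ < c → c * a ≤ c * b → a ≤ b
  *-cancelˡ {c = c} 0<c = *-cancelˡ-≤-pos c {{positive 0<c}}

  0<ι : ∀ k → 0ℚ < ι (suc k)
  0<ι k = positive⁻¹ (ι (suc k)) {{normalize-pos (suc k) 1}}

  -- Just above √β ≈ 0.38268. Since 1 - 2u² = 4639/6561, the inequality (l - 1)/(2l) ≤ u² amounts to
  -- l ≤ 6561/4639.
  u : ℚ
  u = + 31 / 81

  -- l stands for an approximation of √2 from below; then (l − 1)/(2l) ≤ u², as √2 ≤ 6561/4639.
  β-bound : ∀ {l} → 0ℚ < l → l * l ≤ ι 2 → (l - ι 1) * recip (ι 2 * l) ≤ u * u
  β-bound {l} 0<l l²≤2 = ≤-trans (*-monoʳ-≤-nonNeg R {{nonNegative 0≤R}} num) (≤-reflexive (trans (*-assoc (u * u) (ι 2 * l) R)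
      (trans (cong (u * u *_) (*-recip 0<2l)) (*-identityʳ (u * u)))))
    where
    R = recip (ι 2 * l)
    w γ : ℚ
    w = + 6561 / 4639
    γ = + 4639 / 6561
    0<2l : 0ℚ < ι 2 * l
    0<2l = *-pos (0<ι 1) 0<l
    0≤R : 0ℚ ≤ R
    0≤R = <⇒≤ (recip-pos 0<2l)
    l≤w : l ≤ w
    l≤w = square-cancel (toWitness {a? = 0ℚ ≤? w} _) (≤-trans l²≤2 (toWitness {a? = ι 2 ≤? w * w} _))
    split : ∀ l → l - ι 1 ≡ (l * γ - ι 1) + (u * u) * (ι 2 * l)
    split = solve 1 (λ l → l :- con (ι 1) := (l :* con γ :- con (ι 1)) :+ con (u * u) :* (con (ι 2) :* l)) refl
    num : l - ι 1 ≤ (u * u) * (ι 2 * l)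
    num = begin
      l - ι 1                                       ≡⟨ split l ⟩
      (l * γ - ι 1) + (u * u) * (ι 2 * l)           ≤⟨ +-monoˡ-≤ ((u * u) * (ι 2 * l)) (+-monoˡ-≤ (- ι 1) (*-monoʳ-≤-nonNeg γ {{nonNegative (toWitness {a? = 0ℚ ≤? γ} _)}} l≤w)) ⟩
      (w * γ - ι 1) + (u * u) * (ι 2 * l)           ≡⟨ +-identityˡ _ ⟩
      (u * u) * (ι 2 * l)                           ∎
      where open ≤-Reasoning

  -- The bisection approximates roots from below, so at every index the root inside c is at most u
  -- and that of n at most ρ. The rest is 1400 · 2u⁵ ≤ 23.
  lower-at : ∀ {T k ρ n} {e l} m → 700 ℕ.* T ℕ.+ 23 ℕ.* cube ρ ℕ.≤ 1400 ℕ.* k → n ℕ.≤ ρ ℕ.* ρ → 0ℚ ≤ e → 0ℚ < l → l * l ≤ ι 2 →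
    ½ * ι T + ((ι 1 - e) * (ι 2 * pow (sqrt m (((l - ι 1) * recip (ι 2 * l)) ⊔ 0ℚ)) 5)) * pow (sqrt m (ι n ⊔ 0ℚ)) 3 ≤ ι k
  lower-at {T} {k} {ρ} {n} {e} {l} m bound n≤ρ² 0≤e 0<l l²≤2 = *-cancelˡ (0<ι 1399) (begin
    ι 1400 * (½ * ι T + ((ι 1 - e) * c) * pow S 3)        ≤⟨ *-monoˡ-≤-nonNeg (ι 1400) {{nonNegative (0≤ι 1400)}} (+-monoʳ-≤ (½ * ι T) V≤) ⟩
    ι 1400 * (½ * ι T + (ι 2 * pow u 5) * pow (ι ρ) 3)    ≡⟨ expand (ι T) (pow (ι ρ) 3) ⟩
    ι 700 * ι T + (ι 1400 * (ι 2 * pow u 5)) * pow (ι ρ) 3  ≤⟨ +-monoʳ-≤ (ι 700 * ι T) (*-monoʳ-≤-nonNeg (pow (ι ρ) 3) {{nonNegative (0≤pow 3 (0≤ι ρ))}} (toWitness {a? = ι 1400 * (ι 2 * pow u 5) ≤? ι 23} _)) ⟩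
    ι 700 * ι T + ι 23 * pow (ι ρ) 3                      ≡⟨ cong₂ _+_ (sym (ι-* 700 T)) (trans (cong (ι 23 *_) (pow-ι ρ)) (sym (ι-* 23 (cube ρ)))) ⟩
    ι (700 ℕ.* T) + ι (23 ℕ.* cube ρ)                     ≡⟨ ι-+ (700 ℕ.* T) (23 ℕ.* cube ρ) ⟨
    ι (700 ℕ.* T ℕ.+ 23 ℕ.* cube ρ)                       ≤⟨ ι-mono bound ⟩
    ι (1400 ℕ.* k)                                        ≡⟨ ι-* 1400 k ⟩
    ι 1400 * ι k                                          ∎)
    where
    open ≤-Reasoning
    q = (l - ι 1) * recip (ι 2 * l)
    U = sqrt m (q ⊔ 0ℚ)
    S = sqrt m (ι n ⊔ 0ℚ)
    c = ι 2 * pow U 5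
    expand : ∀ t x → ι 1400 * (½ * t + (ι 2 * pow u 5) * x) ≡ ι 700 * t + (ι 1400 * (ι 2 * pow u 5)) * x
    expand = solve 2 (λ t x → con (ι 1400) :* (con ½ :* t :+ con (ι 2 * pow u 5) :* x) := con (ι 700) :* t :+ con (ι 1400 * (ι 2 * pow u 5)) :* x) refl
    0≤u : 0ℚ ≤ u
    0≤u = toWitness {a? = 0ℚ ≤? u} _
    0≤U : 0ℚ ≤ U
    0≤U = sqrt-nonNeg m (p≤q⊔p q 0ℚ)
    0≤S : 0ℚ ≤ S
    0≤S = sqrt-nonNeg m (p≤q⊔p (ι n) 0ℚ)
    U≤u : U ≤ u
    U≤u = square-cancel 0≤u (≤-trans (sqrt-lower m (p≤q⊔p q 0ℚ)) (⊔-lub (β-bound 0<l l²≤2) (0≤* 0≤u 0≤u)))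
    S≤ρ : S ≤ ι ρ
    S≤ρ = square-cancel (0≤ι ρ) (≤-trans (sqrt-lower m (p≤q⊔p (ι n) 0ℚ)) (⊔-lub (≤-trans (ι-mono n≤ρ²) (≤-reflexive (ι-* ρ ρ))) (0≤* (0≤ι ρ) (0≤ι ρ))))
    0≤c : 0ℚ ≤ c
    0≤c = 0≤* (0≤ι 2) (0≤pow 5 0≤U)
    1-e≤1 : ι 1 - e ≤ ι 1
    1-e≤1 = subst (ι 1 - e ≤_) (+-identityʳ (ι 1)) (+-monoʳ-≤ (ι 1) (neg-antimono-≤ 0≤e))
    V≤ : ((ι 1 - e) * c) * pow S 3 ≤ (ι 2 * pow u 5) * pow (ι ρ) 3
    V≤ = ≤-trans
      (*-monoʳ-≤-nonNeg (pow S 3) {{nonNegative (0≤pow 3 0≤S)}} (≤-trans (*-monoʳ-≤-nonNeg c {{nonNegative 0≤c}} 1-e≤1) (≤-reflexive (*-identityˡ c))))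
      (*-mono 0≤c (0≤pow 3 (0≤ι ρ)) (*-monoˡ-≤-nonNeg (ι 2) {{nonNegative (0≤ι 2)}} (pow-mono 5 0≤U U≤u)) (pow-mono 3 0≤S S≤ρ))

  -- Approximating √2 from below is harmless, as 1/(4l) only grows, but S might fall short of √n.
  -- Once the bisection interval has width at most 1, suc r ≤ √n gives r ≤ S.
  upper-at : ∀ {T X k r n K} {e l} m → 4 ℕ.* k ℕ.≤ 2 ℕ.* T ℕ.+ X →
    2 ℕ.* (suc K ℕ.* X ℕ.* (suc K ℕ.* X)) ℕ.≤ suc (suc K) ℕ.* cube r ℕ.* (suc (suc K) ℕ.* cube r) →
    suc r ℕ.* suc r ℕ.≤ n → unit K ≤ e → 0ℚ < l → l * l ≤ ι 2 → halves m ≤ recip (ι n + 1ℚ) →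
    ι k ≤ ½ * ι T + ((ι 1 + e) * (ι 1 * recip (ι 4 * l))) * pow (sqrt m (ι n ⊔ 0ℚ)) 3
  upper-at {T} {X} {k} {r} {n} {K} {e} {l} m k≤ tight r²≤n e≥ 0<l l²≤2 fine = *-cancelˡ (0<ι 3) (begin
    ι 4 * ι k                                 ≡⟨ ι-* 4 k ⟨
    ι (4 ℕ.* k)                               ≤⟨ ι-mono k≤ ⟩
    ι (2 ℕ.* T ℕ.+ X)                         ≡⟨ trans (ι-+ (2 ℕ.* T) X) (cong (_+ ι X) (ι-* 2 T)) ⟩
    ι 2 * ι T + ι X                           ≤⟨ +-monoʳ-≤ (ι 2 * ι T) X≤4Y ⟩
    ι 2 * ι T + ι 4 * Y                       ≡⟨ factor (ι T) Y ⟩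
    ι 4 * (½ * ι T + Y)                       ∎)
    where
    open ≤-Reasoning
    S = sqrt m (ι n ⊔ 0ℚ)
    R = recip (ι 4 * l)
    Y = ((ι 1 + e) * (ι 1 * R)) * pow S 3
    Kℚ = ι (suc K)
    factor : ∀ t y → ι 2 * t + ι 4 * y ≡ ι 4 * (½ * t + y)
    factor = solve 2 (λ t y → con (ι 2) :* t :+ con (ι 4) :* y := con (ι 4) :* (con ½ :* t :+ y)) refl
    0<4l : 0ℚ < ι 4 * l
    0<4l = *-pos (0<ι 3) 0<l
    0≤S : 0ℚ ≤ S
    0≤S = sqrt-nonNeg m (p≤q⊔p (ι n) 0ℚ)
    0<n+1 : 0ℚ < ι n + 1ℚ
    0<n+1 = ≤-<-trans (0≤ι n) (p<p+q (positive⁻¹ 1ℚ))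
    ⊔≡ : ι n ⊔ 0ℚ ≡ ι n
    ⊔≡ = p≥q⇒p⊔q≡p (0≤ι n)
    width : halves m * ((ι n ⊔ 0ℚ) + 1ℚ) ≤ 1ℚ
    width = subst (λ q → halves m * (q + 1ℚ) ≤ 1ℚ) (sym ⊔≡) (≤-trans (*-monoʳ-≤-nonNeg (ι n + 1ℚ) {{nonNegative (<⇒≤ 0<n+1)}} fine)
      (≤-reflexive (trans (*-comm (recip (ι n + 1ℚ)) (ι n + 1ℚ)) (*-recip 0<n+1))))
    r≤S : ι r ≤ S
    r≤S = ≮⇒≥ λ S<r → <-irrefl refl (<-≤-trans (+-monoˡ-< 1ℚ S<r) (square-cancel (≤-trans 0≤S (p≤p+q (<⇒≤ (positive⁻¹ 1ℚ)))) (begin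
      (ι r + 1ℚ) * (ι r + 1ℚ)          ≡⟨ cong₂ _*_ suc≡ suc≡ ⟨
      ι (suc r) * ι (suc r)            ≡⟨ ι-* (suc r) (suc r) ⟨
      ι (suc r ℕ.* suc r)              ≤⟨ ι-mono r²≤n ⟩
      ι n                              ≡⟨ ⊔≡ ⟨
      ι n ⊔ 0ℚ                         ≤⟨ <⇒≤ (sqrt-upper m (p≤q⊔p (ι n) 0ℚ) width) ⟩
      (S + 1ℚ) * (S + 1ℚ)              ∎)))
      where
      suc≡ : ι (suc r) ≡ ι r + 1ℚ
      suc≡ = trans (ι-+ 1 r) (+-comm (ι 1) (ι r))
    KX≤ : (Kℚ * ι X) * l ≤ ι (suc (suc K)) * ι (cube r)
    KX≤ = square-cancel (0≤* (0≤ι (suc (suc K))) (0≤ι (cube r))) (begin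
      ((Kℚ * ι X) * l) * ((Kℚ * ι X) * l)        ≡⟨ sq (Kℚ * ι X) l ⟩
      (l * l) * ((Kℚ * ι X) * (Kℚ * ι X))        ≤⟨ *-monoʳ-≤-nonNeg ((Kℚ * ι X) * (Kℚ * ι X)) {{nonNegative (0≤* 0≤KX 0≤KX)}} l²≤2 ⟩
      ι 2 * ((Kℚ * ι X) * (Kℚ * ι X))            ≡⟨ cong (λ t → ι 2 * (t * t)) (ι-* (suc K) X) ⟨
      ι 2 * (ι (suc K ℕ.* X) * ι (suc K ℕ.* X))  ≡⟨ trans (ι-* 2 (suc K ℕ.* X ℕ.* (suc K ℕ.* X))) (cong (ι 2 *_) (ι-* (suc K ℕ.* X) (suc K ℕ.* X))) ⟨
      ι (2 ℕ.* (suc K ℕ.* X ℕ.* (suc K ℕ.* X)))  ≤⟨ ι-mono tight ⟩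
      ι (suc (suc K) ℕ.* cube r ℕ.* (suc (suc K) ℕ.* cube r))  ≡⟨ trans (ι-* (suc (suc K) ℕ.* cube r) (suc (suc K) ℕ.* cube r)) (cong₂ _*_ (ι-* (suc (suc K)) (cube r)) (ι-* (suc (suc K)) (cube r))) ⟩
      (ι (suc (suc K)) * ι (cube r)) * (ι (suc (suc K)) * ι (cube r))  ∎)
      where
      0≤KX : 0ℚ ≤ Kℚ * ι X
      0≤KX = 0≤* (0≤ι (suc K)) (0≤ι X)
      sq : ∀ x l → (x * l) * (x * l) ≡ (l * l) * (x * x)
      sq = solve 2 (λ x l → (x :* l) :* (x :* l) := (l :* l) :* (x :* x)) refl
    -- `unit K` is 1/(K + 1), so the factor (K + 2)/(K + 1) of `tight` is at most 1 + e.
    K+1≤ : ι (suc (suc K)) ≤ Kℚ * (ι 1 + e)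
    K+1≤ = begin
      ι (suc (suc K))                  ≡⟨ ι-+ 1 (suc K) ⟩
      ι 1 + Kℚ                         ≡⟨ cong (_+ Kℚ) (ι-unit K) ⟨
      Kℚ * unit K + Kℚ                 ≤⟨ +-monoˡ-≤ Kℚ (*-monoˡ-≤-nonNeg Kℚ {{nonNegative (0≤ι (suc K))}} e≥) ⟩
      Kℚ * e + Kℚ                      ≡⟨ distribute Kℚ e ⟩
      Kℚ * (ι 1 + e)                   ∎
      where
      distribute : ∀ k e → k * e + k ≡ k * (ι 1 + e)
      distribute = solve 2 (λ k e → k :* e :+ k := k :* (con (ι 1) :+ e)) refl
    X≤4Y : ι X ≤ ι 4 * Y
    X≤4Y = *-cancelˡ (*-pos (0<ι K) 0<l) (begin
      (Kℚ * l) * ι X                                  ≡⟨ swap Kℚ l (ι X) ⟩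
      (Kℚ * ι X) * l                                  ≤⟨ KX≤ ⟩
      ι (suc (suc K)) * ι (cube r)                    ≤⟨ *-mono (0≤ι (suc (suc K))) (0≤pow 3 0≤S) K+1≤ (≤-trans (≤-reflexive (sym (pow-ι r))) (pow-mono 3 (0≤ι r) r≤S)) ⟩
      (Kℚ * (ι 1 + e)) * pow S 3                      ≡⟨ trans (cong (λ t → (Kℚ * (ι 1 + e)) * t) (trans (cong (_* pow S 3) (*-recip 0<4l)) (*-identityˡ (pow S 3)))) refl ⟨
      (Kℚ * (ι 1 + e)) * ((ι 4 * l) * R * pow S 3)    ≡⟨ regroup Kℚ e l R (pow S 3) ⟩
      (Kℚ * l) * (ι 4 * Y)                            ∎)
      where
      swap : ∀ a b c → (a * b) * c ≡ (a * c) * b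
      swap = solve 3 (λ a b c → (a :* b) :* c := (a :* c) :* b) refl
      regroup : ∀ k e l R s → (k * (ι 1 + e)) * ((ι 4 * l) * R * s) ≡ (k * l) * (ι 4 * (((ι 1 + e) * (ι 1 * R)) * s))
      regroup = solve 5 (λ k e l R s → (k :* (con (ι 1) :+ e)) :* ((con (ι 4) :* l) :* R :* s) := (k :* l) :* (con (ι 4) :* (((con (ι 1) :+ e) :* (con (ι 1) :* R)) :* s))) refl

-- The inequalities between real numbers

open import Defs
open import Data.Nat.Base as ℕ using (ℕ; suc)
import Data.Nat.Properties as ℕₚ
open import Data.Nat.Combinatorics using (_C_)
open import Data.Product.Base using (∃; _×_; _,_; proj₁; proj₂)
open import Data.Rational.Base as ℚ using (ℚ; ½; 0ℚ; 1ℚ)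
import Data.Rational.Properties as ℚₚ
open import Relation.Binary.PropositionalEquality using (_≡_; subst)
open import Data.Integer.Base using (+_)
open ForcingThreshold
open Asymptotics
open RationalEstimates
open Real

eventually-≤ : ∀ (x y : ℝ) N → (∀ m → N ℕ.≤ m → seq x m ℚ.≤ seq y m) → x ≤ y
eventually-≤ x y N h δ 0<δ = N , λ m N≤m → ℚₚ.≤-trans (h m N≤m) (Rational.p≤p+q (ℚₚ.<⇒≤ 0<δ))

√2²≤2 : ∀ m → seq √2 m ℚ.* seq √2 m ℚ.≤ ι 2
√2²≤2 m = subst (seq √2 m ℚ.* seq √2 m ℚ.≤_) (ℚₚ.p≥q⇒p⊔q≡p (0≤ι 2)) (Rational.sqrt-lower m (ℚₚ.p≤q⊔p (ι 2) 0ℚ))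

0<√2 : fromℕ 0 < √2
0<√2 = √-pos

√2-from : ℕ
√2-from = _<_.from 0<√2

0<√2-at : ∀ m → √2-from ℕ.≤ m → 0ℚ ℚ.< seq √2 m
0<√2-at m le = ℚₚ.<-≤-trans (_<_.0<gap 0<√2) (eventually-pos 0<√2 m le)

lowerBound upperBound : ℝ → ℕ → ℝ
lowerBound ε n = fromℚ ½ * fromℕ (n C 2) + (fromℕ 1 - ε) * c * fromℕ n ^[ 3 /2]
upperBound ε n = fromℚ ½ * fromℕ (n C 2) + (fromℕ 1 + ε) * (fromℕ 1 / (fromℕ 4 * √2)) * fromℕ n ^[ 3 /2]

lbal-bounds : ∀ ε (0<ε : fromℕ 0 < ε) K → Rational.unit K ℚ.≤ _<_.gap 0<ε → ∀ {n} → 5 ℕ.≤ n → Lower n → Upper (suc K) n →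
  ∃ λ k → IsLbal n K₅ k × lowerBound ε n ≤ fromℤ k × fromℤ k ≤ upperBound ε n
lbal-bounds ε 0<ε K unit≤ {n} 5≤n low up = bounds (lbal-between 5≤n L unbalanced (forces-upper n s k₀ n≤2s² above))
  where
  open Lower low using (ρ; n≤ρ²; L; unbalanced; large)
  open Upper up using (s; r; n≤2s²; above; k≤; r²≤n; tight) renaming (k to k₀)
  open _<_ 0<ε using () renaming (from to ε-from; gap to gap; 0<gap to 0<gap)
  e≥ : ∀ m → ε-from ℕ.≤ m → gap ℚ.≤ seq ε m
  e≥ = eventually-pos 0<ε
  -- The bisection for √n starts from an interval of length n + 1, so from this index on its width
  -- is at most 1.
  fine : ∃ λ N → ∀ m → N ℕ.≤ m → Rational.halves m ℚ.≤ Rational.recip (ι n ℚ.+ 1ℚ)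
  fine = Rational.halves-small (Rational.recip-pos (ℚₚ.≤-<-trans (0≤ι n) (Rational.p<p+q {q = 1ℚ} (ℚₚ.positive⁻¹ 1ℚ))))
  bounds : (∃ λ k → IsLbal n K₅ (+ k) × k ℕ.≤ k₀ × (∀ M → M ℕ.≤ ∣ red L ∣ → M ℕ.≤ ∣ blue L ∣ → M ℕ.≤ k)) →
    ∃ λ k → IsLbal n K₅ k × lowerBound ε n ≤ fromℤ k × fromℤ k ≤ upperBound ε n
  bounds (k , isLbal , k≤k₀ , ≥min) = + k , isLbal ,
    eventually-≤ (lowerBound ε n) (fromℕ k) (√2-from ℕ.+ ε-from) (λ m le →
      lower-at {n C 2} {k} {ρ} {n} {seq ε m} {seq √2 m} m
        (ℕₚ.≤-trans large (ℕₚ.*-monoʳ-≤ 1400 (≥min (∣ red L ∣ ℕ.⊓ ∣ blue L ∣) (ℕₚ.m⊓n≤m ∣ red L ∣ ∣ blue L ∣) (ℕₚ.m⊓n≤n ∣ red L ∣ ∣ blue L ∣))))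
        n≤ρ²
        (ℚₚ.≤-trans (ℚₚ.<⇒≤ 0<gap) (e≥ m (ℕₚ.m+n≤o⇒n≤o √2-from le)))
        (0<√2-at m (ℕₚ.m+n≤o⇒m≤o √2-from le)) (√2²≤2 m)) ,
    eventually-≤ (fromℕ k) (upperBound ε n) (√2-from ℕ.+ (ε-from ℕ.+ proj₁ fine)) (λ m le →
      upper-at {n C 2} {n ℕ.* (s ℕ.+ 55)} {k} {r} {n} {K} {seq ε m} {seq √2 m} m
        (ℕₚ.≤-trans (ℕₚ.*-monoʳ-≤ 4 k≤k₀) k≤) tight r²≤n
        (ℚₚ.≤-trans unit≤ (e≥ m (ℕₚ.m+n≤o⇒m≤o ε-from (ℕₚ.m+n≤o⇒n≤o √2-from le))))
        (0<√2-at m (ℕₚ.m+n≤o⇒m≤o √2-from le)) (√2²≤2 m)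
        (proj₂ fine m (ℕₚ.m+n≤o⇒n≤o ε-from (ℕₚ.m+n≤o⇒n≤o √2-from le))))

theorem14 : (ε : ℝ) → fromℕ 0 < ε →
    ∃ λ (N : ℕ) → ∀ n → N ℕ.≤ n → ∃ λ k → IsLbal n K₅ k ×
    fromℚ ½ * fromℕ (n C 2) + (fromℕ 1 - ε) * c * fromℕ n ^[ 3 /2] ≤ fromℤ k ×
    fromℤ k ≤ fromℚ ½ * fromℕ (n C 2) + (fromℕ 1 + ε) * (fromℕ 1 / (fromℕ 4 * √2)) * fromℕ n ^[ 3 /2]
theorem14 ε 0<ε = eventually (Rational.unit-archimedean (_<_.0<gap 0<ε))
  where
  eventually : (∃ λ K → Rational.unit K ℚ.≤ _<_.gap 0<ε) →
    ∃ λ (N : ℕ) → ∀ n → N ℕ.≤ n → ∃ λ k → IsLbal n K₅ k × lowerBound ε n ≤ fromℤ k × fromℤ k ≤ upperBound ε n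
  eventually (K , unit≤) = threshold (both-bounds (suc K))
    where
    threshold : (∃ λ N → ∀ n → N ℕ.≤ n → 5 ℕ.≤ n × Lower n × Upper (suc K) n) →
      ∃ λ (N : ℕ) → ∀ n → N ℕ.≤ n → ∃ λ k → IsLbal n K₅ k × lowerBound ε n ≤ fromℤ k × fromℤ k ≤ upperBound ε n
    threshold (N , large) = N , λ n N≤n → let 5≤n , low , up = large n N≤n in lbal-bounds ε 0<ε K unit≤ 5≤n low up
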